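{- For every fixed integer $d\ge 2$ there is a constant $c_d>0$ (depending only on $d$) such that for infinitely many values of $n$ there exists an $n$-point set $P\subset\mathbb{R}^d$ with \[ \operatorname{disc}\mathcal{R}_d(P)\ge c_d\log^{d-1}n . \]
   Context: $\mathcal{R}_d$ denotes the family of all axis-parallel boxes $[a_1,b_1]\times\cdots\times[a_d,b_d]$ in $\mathbb{R}^d$, and $\mathcal{R}_d(P)=\{R\cap P: R\in\mathcal{R}_d\}$ is the set system on ground set $P$ induced by them. For a set system $\mathcal{F}$ on a finite ground set $V$, its (combinatorial) discrepancy is $\operatorname{disc}\mathcal{F}=\min_{x\in\{ -1,1\}^V}\max_{F\in\mathcal{F}}\bigl|\sum_{v\in F}x_v\bigr|$. -}

module Defs where

open import Level using (0ℓ)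
open import Data.Bool.Base using (if_then_else_)
open import Data.Fin.Base using (Fin)
open import Data.Fin.Subset using (Subset; _∈_)
open import Data.Integer.Base as ℤ using (ℤ; +_; _◃_)
import Data.Integer.Properties as ℤ
open import Data.Nat.Base as ℕ using (ℕ; zero; suc; z≤n; s≤s)
import Data.Nat.Properties as ℕ
open import Data.Product.Base using (Σ; ∃; ∃-syntax; Σ-syntax; _×_; _,_; proj₁; proj₂)
open import Data.Rational.Base as ℚ using (ℚ; mkℚ; 0ℚ; 1ℚ)
open import Data.Rational.Solver using (module +-*-Solver)
import Data.Rational.Properties as ℚ
open import Data.Rational.Unnormalised.Base as ℚᵘ using (mkℚᵘ)
import Data.Rational.Unnormalised.Properties as ℚᵘ
open import Data.Sign.Base using (Sign)
open import Data.Sum.Base using (inj₁; inj₂)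
open import Data.Vec.Base using (lookup)
open import Function.Bundles using (_⇔_)
open import Function.Definitions using (Injective)
open import Relation.Binary.PropositionalEquality
open import Relation.Unary using (Pred)
import Algebra.Properties.CommutativeMonoid.Sum as Sum

open Sum ℤ.+-0-commutativeMonoid using (sum)
open +-*-Solver using (solve; _:=_; _:+_; _:*_; _:-_; :-_)

------------------------------------------------------------------------
-- Cauchy reals.  They form a setoid: equality of reals is _≈_, not _≡_.

IsCauchy : (ℕ → ℚ) → Set
IsCauchy x = ∀ ε → 0ℚ ℚ.< ε →
  ∃[ N ] (∀ m n → N ℕ.≤ m → N ℕ.≤ n → ℚ.∣ x m ℚ.- x n ∣ ℚ.≤ ε)

record ℝ : Set where
  constructor mkℝ
  field
    seq    : ℕ → ℚ
    cauchy : IsCauchy seq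

open ℝ public

infix 4 _≤_ _<_ _≈_

_≤_ : ℝ → ℝ → Set
x ≤ y = ∀ ε → 0ℚ ℚ.< ε → ∃[ N ] (∀ n → N ℕ.≤ n → seq x n ℚ.≤ seq y n ℚ.+ ε)

_<_ : ℝ → ℝ → Set
x < y = ∃[ ε ] (0ℚ ℚ.< ε × ∃[ N ] (∀ n → N ℕ.≤ n → seq x n ℚ.+ ε ℚ.≤ seq y n))

_≈_ : ℝ → ℝ → Set
x ≈ y = x ≤ y × y ≤ x

fromℚ : ℚ → ℝ
fromℚ q = mkℝ (λ _ → q) λ ε 0<ε → 0 , λ _ _ _ _ →
  subst (ℚ._≤ ε) (cong ℚ.∣_∣ (sym (ℚ.+-inverseʳ q))) (ℚ.<⇒≤ 0<ε)

fromℕ : ℕ → ℝ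
fromℕ n = fromℚ (+ n ℚ./ 1)

0ℝ 1ℝ : ℝ
0ℝ = fromℕ 0
1ℝ = fromℕ 1

module CauchyFacts where
  module Identity where
    split : ∀ a b → a ≡ (a ℚ.- b) ℚ.+ b
    split = solve 2 (λ a b → a := (a :- b) :+ b) refl

    product-difference : ∀ a b c d →
      a ℚ.* b ℚ.- c ℚ.* d ≡ a ℚ.* (b ℚ.- d) ℚ.+ d ℚ.* (a ℚ.- c)
    product-difference =
      solve 4 (λ a b c d → a :* b :- c :* d := a :* (b :- d) :+ d :* (a :- c)) refl

    shift : ∀ a b c → a ℚ.- b ≡ (a ℚ.+ c) ℚ.- (b ℚ.+ c)
    shift = solve 3 (λ a b c → a :- b := (a :+ c) :- (b :+ c)) refl

    drop : ∀ a b c → a ℚ.- (b ℚ.+ c) ℚ.+ c ≡ a ℚ.- b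
    drop = solve 3 (λ a b c → a :- (b :+ c) :+ c := a :- b) refl

    swap : ∀ a b c → a ℚ.+ c ℚ.- b ≡ a ℚ.- b ℚ.+ c
    swap = solve 3 (λ a b c → a :+ c :- b := a :- b :+ c) refl

    cancel : ∀ a e → a ℚ.+ e ℚ.- a ≡ e
    cancel = solve 2 (λ a e → a :+ e :- a := e) refl

    negate : ∀ a b → ℚ.- (a ℚ.- b) ≡ b ℚ.- a
    negate = solve 2 (λ a b → :- (a :- b) := b :- a) refl

  0≤∣_∣ : ∀ p → 0ℚ ℚ.≤ ℚ.∣ p ∣
  0≤∣ p ∣ = ℚ.nonNegative⁻¹ ℚ.∣ p ∣ {{ℚ.∣-∣-nonNeg p}}

  bounded : ∀ {x} → IsCauchy x →
            Σ[ B ∈ ℚ ] (0ℚ ℚ.< B × ∃[ N ] (∀ n → N ℕ.≤ n → ℚ.∣ x n ∣ ℚ.≤ B))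
  bounded {x} cx with cx 1ℚ (ℚ.positive⁻¹ 1ℚ)
  ... | N , h = 1ℚ ℚ.+ ℚ.∣ x N ∣
              , ℚ.+-mono-<-≤ (ℚ.positive⁻¹ 1ℚ) 0≤∣ x N ∣
              , N , λ n N≤n → begin
      ℚ.∣ x n ∣
        ≡⟨ cong ℚ.∣_∣ (Identity.split (x n) (x N)) ⟩
      ℚ.∣ (x n ℚ.- x N) ℚ.+ x N ∣
        ≤⟨ ℚ.∣p+q∣≤∣p∣+∣q∣ (x n ℚ.- x N) (x N) ⟩
      ℚ.∣ x n ℚ.- x N ∣ ℚ.+ ℚ.∣ x N ∣
        ≤⟨ ℚ.+-monoˡ-≤ ℚ.∣ x N ∣ (h n N N≤n ℕ.≤-refl) ⟩
      1ℚ ℚ.+ ℚ.∣ x N ∣ ∎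
    where open ℚ.≤-Reasoning

  mul-≤ : ∀ {a b c d} → 0ℚ ℚ.≤ a → 0ℚ ℚ.≤ d → a ℚ.≤ b → c ℚ.≤ d → a ℚ.* c ℚ.≤ b ℚ.* d
  mul-≤ {a} {b} {c} {d} 0≤a 0≤d a≤b c≤d = ℚ.≤-trans
    (ℚ.*-monoˡ-≤-nonNeg a {{ℚ.nonNegative 0≤a}} c≤d)
    (ℚ.*-monoʳ-≤-nonNeg d {{ℚ.nonNegative 0≤d}} a≤b)

  divide : ∀ C ε → 0ℚ ℚ.< C → 0ℚ ℚ.< ε → Σ[ δ ∈ ℚ ] (0ℚ ℚ.< δ × C ℚ.* δ ≡ ε)
  divide C ε 0<C 0<ε = C⁻¹ ℚ.* ε , 0<δ , (begin
    C ℚ.* (C⁻¹ ℚ.* ε)  ≡⟨ ℚ.*-assoc C C⁻¹ ε ⟨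
    (C ℚ.* C⁻¹) ℚ.* ε  ≡⟨ cong (ℚ._* ε) (ℚ.*-inverseʳ C {{C≢0}}) ⟩
    1ℚ ℚ.* ε           ≡⟨ ℚ.*-identityˡ ε ⟩
    ε                  ∎)
    where
    open ≡-Reasoning
    C⁺ : ℚ.Positive C
    C⁺ = ℚ.positive 0<C
    C≢0 : ℚ.NonZero C
    C≢0 = ℚ.pos⇒nonZero C {{C⁺}}
    C⁻¹ = ℚ.1/_ C {{C≢0}}
    0<δ : 0ℚ ℚ.< C⁻¹ ℚ.* ε
    0<δ = subst (ℚ._< C⁻¹ ℚ.* ε) (ℚ.*-zeroʳ C⁻¹)
            (ℚ.*-monoʳ-<-pos C⁻¹ {{ℚ.1/pos⇒pos C {{C⁺}}}} 0<ε)

  *-cauchy : ∀ {x y} → IsCauchy x → IsCauchy y → IsCauchy (λ n → x n ℚ.* y n)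
  *-cauchy {x} {y} cx cy ε 0<ε =
    let A , 0<A , N₁ , hA  = bounded cx
        B , 0<B , N₂ , hB  = bounded cy
        δ , 0<δ , eq       = divide (A ℚ.+ B) ε (ℚ.+-mono-< 0<A 0<B) 0<ε
        N₃ , hx            = cx δ 0<δ
        N₄ , hy            = cy δ 0<δ
    in (N₁ ℕ.+ N₂) ℕ.+ (N₃ ℕ.+ N₄) , close A N₁ hA B N₂ hB δ 0<δ eq N₃ hx N₄ hy
    where
    open ℚ.≤-Reasoning
    close : ∀ A N₁ → (∀ n → N₁ ℕ.≤ n → ℚ.∣ x n ∣ ℚ.≤ A) →
            ∀ B N₂ → (∀ n → N₂ ℕ.≤ n → ℚ.∣ y n ∣ ℚ.≤ B) →
            ∀ δ → 0ℚ ℚ.< δ → (A ℚ.+ B) ℚ.* δ ≡ ε →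
            ∀ N₃ → (∀ m n → N₃ ℕ.≤ m → N₃ ℕ.≤ n → ℚ.∣ x m ℚ.- x n ∣ ℚ.≤ δ) →
            ∀ N₄ → (∀ m n → N₄ ℕ.≤ m → N₄ ℕ.≤ n → ℚ.∣ y m ℚ.- y n ∣ ℚ.≤ δ) →
            let N = (N₁ ℕ.+ N₂) ℕ.+ (N₃ ℕ.+ N₄) in
            ∀ m n → N ℕ.≤ m → N ℕ.≤ n → ℚ.∣ x m ℚ.* y m ℚ.- x n ℚ.* y n ∣ ℚ.≤ ε
    close A N₁ hA B N₂ hB δ 0<δ eq N₃ hx N₄ hy m n N≤m N≤n = begin
      ℚ.∣ x m ℚ.* y m ℚ.- x n ℚ.* y n ∣
        ≡⟨ cong ℚ.∣_∣ (Identity.product-difference (x m) (y m) (x n) (y n)) ⟩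
      ℚ.∣ x m ℚ.* (y m ℚ.- y n) ℚ.+ y n ℚ.* (x m ℚ.- x n) ∣
        ≤⟨ ℚ.∣p+q∣≤∣p∣+∣q∣ (x m ℚ.* (y m ℚ.- y n)) (y n ℚ.* (x m ℚ.- x n)) ⟩
      ℚ.∣ x m ℚ.* (y m ℚ.- y n) ∣ ℚ.+ ℚ.∣ y n ℚ.* (x m ℚ.- x n) ∣
        ≡⟨ cong₂ ℚ._+_ (ℚ.∣p*q∣≡∣p∣*∣q∣ (x m) (y m ℚ.- y n))
                       (ℚ.∣p*q∣≡∣p∣*∣q∣ (y n) (x m ℚ.- x n)) ⟩
      ℚ.∣ x m ∣ ℚ.* ℚ.∣ y m ℚ.- y n ∣ ℚ.+ ℚ.∣ y n ∣ ℚ.* ℚ.∣ x m ℚ.- x n ∣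
        ≤⟨ ℚ.+-mono-≤
             (mul-≤ 0≤∣ x m ∣ (ℚ.<⇒≤ 0<δ)
               (hA m (ℕ.≤-trans N₁≤N N≤m))
               (hy m n (ℕ.≤-trans N₄≤N N≤m) (ℕ.≤-trans N₄≤N N≤n)))
             (mul-≤ 0≤∣ y n ∣ (ℚ.<⇒≤ 0<δ)
               (hB n (ℕ.≤-trans N₂≤N N≤n))
               (hx m n (ℕ.≤-trans N₃≤N N≤m) (ℕ.≤-trans N₃≤N N≤n))) ⟩
      A ℚ.* δ ℚ.+ B ℚ.* δ
        ≡⟨ ℚ.*-distribʳ-+ δ A B ⟨
      (A ℚ.+ B) ℚ.* δ
        ≡⟨ eq ⟩
      ε ∎
      where
      N = (N₁ ℕ.+ N₂) ℕ.+ (N₃ ℕ.+ N₄)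
      N₁≤N : N₁ ℕ.≤ N
      N₁≤N = ℕ.≤-trans (ℕ.m≤m+n N₁ N₂) (ℕ.m≤m+n _ _)
      N₂≤N : N₂ ℕ.≤ N
      N₂≤N = ℕ.≤-trans (ℕ.m≤n+m N₂ N₁) (ℕ.m≤m+n _ _)
      N₃≤N : N₃ ℕ.≤ N
      N₃≤N = ℕ.≤-trans (ℕ.m≤m+n N₃ N₄) (ℕ.m≤n+m _ (N₁ ℕ.+ N₂))
      N₄≤N : N₄ ℕ.≤ N
      N₄≤N = ℕ.≤-trans (ℕ.m≤n+m N₄ N₃) (ℕ.m≤n+m _ (N₁ ℕ.+ N₂))

open CauchyFacts

infixl 7 _*_
infixr 8 _^_

_*_ : ℝ → ℝ → ℝ
x * y = mkℝ (λ n → seq x n ℚ.* seq y n) (*-cauchy {seq x} {seq y} (cauchy x) (cauchy y))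

_^_ : ℝ → ℕ → ℝ
x ^ zero  = 1ℝ
x ^ suc k = x * x ^ k

------------------------------------------------------------------------
-- The natural logarithm of a positive integer, as log n = ∫₁ⁿ dt/t.

harmonic : ℕ → ℚ
harmonic zero    = 0ℚ
harmonic (suc m) = harmonic m ℚ.+ + 1 ℚ./ suc m

-- With k = suc i, this is Σ_{k < j ≤ nk} 1/j = Σ_{k < j ≤ nk} (1/k) · 1/(j/k),
-- the right Riemann sum of ∫₁ⁿ dt/t with step 1/k.
logSum : ℕ → ℕ → ℚ
logSum n i = harmonic (n ℕ.* suc i) ℚ.- harmonic (suc i)

module LogFacts where
  frac-≤ : ∀ a b c d → a ℕ.* suc d ℕ.≤ c ℕ.* suc b → + a ℚ./ suc b ℚ.≤ + c ℚ./ suc d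
  frac-≤ a b c d h = ℚ.toℚᵘ-cancel-≤ (begin
    ℚ.toℚᵘ (ℚ.fromℚᵘ (mkℚᵘ (+ a) b))  ≃⟨ ℚ.toℚᵘ-fromℚᵘ (mkℚᵘ (+ a) b) ⟩
    mkℚᵘ (+ a) b
      ≤⟨ ℚᵘ.*≤* (subst₂ ℤ._≤_ (ℤ.pos-* a (suc d)) (ℤ.pos-* c (suc b)) (ℤ.+≤+ h)) ⟩
    mkℚᵘ (+ c) d                      ≃⟨ ℚ.toℚᵘ-fromℚᵘ (mkℚᵘ (+ c) d) ⟨
    ℚ.toℚᵘ (ℚ.fromℚᵘ (mkℚᵘ (+ c) d))  ∎)
    where open ℚᵘ.≤-Reasoning

  frac-suc : ∀ t b → + suc t ℚ./ suc b ≡ + t ℚ./ suc b ℚ.+ + 1 ℚ./ suc b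
  frac-suc t b = ℚ.toℚᵘ-injective (begin-equality
    ℚ.toℚᵘ (+ suc t ℚ./ suc b)           ≃⟨ ℚ.toℚᵘ-fromℚᵘ (mkℚᵘ (+ suc t) b) ⟩
    mkℚᵘ (+ suc t) b                     ≃⟨ ℚᵘ.*≡* same ⟩
    mkℚᵘ (+ t) b ℚᵘ.+ mkℚᵘ (+ 1) b
      ≃⟨ ℚᵘ.+-cong (ℚ.toℚᵘ-fromℚᵘ (mkℚᵘ (+ t) b)) (ℚ.toℚᵘ-fromℚᵘ (mkℚᵘ (+ 1) b)) ⟨
    ℚ.toℚᵘ (+ t ℚ./ suc b) ℚᵘ.+ ℚ.toℚᵘ (+ 1 ℚ./ suc b)
      ≃⟨ ℚ.toℚᵘ-homo-+ (+ t ℚ./ suc b) (+ 1 ℚ./ suc b) ⟨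
    ℚ.toℚᵘ (+ t ℚ./ suc b ℚ.+ + 1 ℚ./ suc b) ∎)
    where
    open ℚᵘ.≤-Reasoning
    B = + suc b
    same : + suc t ℤ.* (B ℤ.* B) ≡ (+ t ℤ.* B ℤ.+ + 1 ℤ.* B) ℤ.* B
    same = trans (sym (ℤ.*-assoc (+ suc t) B B)) (cong (ℤ._* B)
             (trans (cong (ℤ._* B) (cong +_ (ℕ.+-comm 1 t))) (ℤ.*-distribʳ-+ B (+ t) (+ 1))))

  frac-zero : ∀ b → + 0 ℚ./ suc b ≡ 0ℚ
  frac-zero b = ℚ.≤-antisym (frac-≤ 0 b 0 0 z≤n) (frac-≤ 0 0 0 b z≤n)

  harmonic-lower : ∀ N t M → N ℕ.+ t ℕ.≤ suc M →
                   harmonic N ℚ.+ + t ℚ./ suc M ℚ.≤ harmonic (N ℕ.+ t)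
  harmonic-lower N zero M h = ℚ.≤-reflexive (begin
    harmonic N ℚ.+ + 0 ℚ./ suc M  ≡⟨ cong (harmonic N ℚ.+_) (frac-zero M) ⟩
    harmonic N ℚ.+ 0ℚ             ≡⟨ ℚ.+-identityʳ (harmonic N) ⟩
    harmonic N                    ≡⟨ cong harmonic (ℕ.+-identityʳ N) ⟨
    harmonic (N ℕ.+ 0)            ∎)
    where open ≡-Reasoning
  harmonic-lower N (suc t) M h rewrite ℕ.+-suc N t = begin
    harmonic N ℚ.+ + suc t ℚ./ suc M
      ≡⟨ cong (harmonic N ℚ.+_) (frac-suc t M) ⟩
    harmonic N ℚ.+ (+ t ℚ./ suc M ℚ.+ + 1 ℚ./ suc M)
      ≡⟨ ℚ.+-assoc (harmonic N) (+ t ℚ./ suc M) (+ 1 ℚ./ suc M) ⟨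
    harmonic N ℚ.+ + t ℚ./ suc M ℚ.+ + 1 ℚ./ suc M
      ≤⟨ ℚ.+-mono-≤ (harmonic-lower N t M (ℕ.≤-trans (ℕ.n≤1+n _) h))
           (frac-≤ 1 M 1 (N ℕ.+ t) (ℕ.*-monoʳ-≤ 1 h)) ⟩
    harmonic (N ℕ.+ t) ℚ.+ + 1 ℚ./ suc (N ℕ.+ t) ∎
    where open ℚ.≤-Reasoning

  harmonic-upper : ∀ N t M → suc M ℕ.≤ N →
                   harmonic (N ℕ.+ t) ℚ.≤ harmonic N ℚ.+ + t ℚ./ suc M
  harmonic-upper N zero M h = ℚ.≤-reflexive (sym (begin
    harmonic N ℚ.+ + 0 ℚ./ suc M  ≡⟨ cong (harmonic N ℚ.+_) (frac-zero M) ⟩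
    harmonic N ℚ.+ 0ℚ             ≡⟨ ℚ.+-identityʳ (harmonic N) ⟩
    harmonic N                    ≡⟨ cong harmonic (ℕ.+-identityʳ N) ⟨
    harmonic (N ℕ.+ 0)            ∎))
    where open ≡-Reasoning
  harmonic-upper N (suc t) M h rewrite ℕ.+-suc N t = begin
    harmonic (N ℕ.+ t) ℚ.+ + 1 ℚ./ suc (N ℕ.+ t)
      ≤⟨ ℚ.+-mono-≤ (harmonic-upper N t M h)
           (frac-≤ 1 (N ℕ.+ t) 1 M
             (ℕ.*-monoʳ-≤ 1 (ℕ.≤-trans h (ℕ.≤-trans (ℕ.m≤m+n N t) (ℕ.n≤1+n _))))) ⟩
    harmonic N ℚ.+ + t ℚ./ suc M ℚ.+ + 1 ℚ./ suc M
      ≡⟨ ℚ.+-assoc (harmonic N) (+ t ℚ./ suc M) (+ 1 ℚ./ suc M) ⟩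
    harmonic N ℚ.+ (+ t ℚ./ suc M ℚ.+ + 1 ℚ./ suc M)
      ≡⟨ cong (harmonic N ℚ.+_) (frac-suc t M) ⟨
    harmonic N ℚ.+ + suc t ℚ./ suc M ∎
    where open ℚ.≤-Reasoning

  archimedean : ∀ ε → 0ℚ ℚ.< ε → ∃[ N ] (+ 1 ℚ./ suc N ℚ.≤ ε)
  archimedean ε@(mkℚ (+ suc p) q _) _ = q ,
    subst (+ 1 ℚ./ suc q ℚ.≤_) (ℚ.fromℚᵘ-toℚᵘ ε)
      (frac-≤ 1 q (suc p) q (ℕ.*-monoˡ-≤ (suc q) {1} {suc p} (s≤s z≤n)))
  archimedean (mkℚ (+ zero) _ _) (ℚ.*<* (ℤ.+<+ ()))
  archimedean (mkℚ ℤ.-[1+ _ ] _ _) (ℚ.*<* ())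

  module _ (n-1 : ℕ) where
    private
      n = suc n-1

      step : ∀ i → n ℕ.* suc i ℕ.+ n ≡ n ℕ.* suc (suc i)
      step i = trans (ℕ.+-comm (n ℕ.* suc i) n) (sym (ℕ.*-suc n (suc i)))

      cancel : ∀ k → 1 ℕ.* (n ℕ.* k) ≡ n ℕ.* k
      cancel k = ℕ.*-identityˡ (n ℕ.* k)

    logSum-step-≤ : ∀ i → logSum n i ℚ.≤ logSum n (suc i)
    logSum-step-≤ i = begin
      H ℚ.- h
        ≡⟨ Identity.shift H h e ⟩
      (H ℚ.+ e) ℚ.- (h ℚ.+ e)
        ≤⟨ ℚ.+-monoˡ-≤ (ℚ.- (h ℚ.+ e)) (begin
             H ℚ.+ e
               ≤⟨ ℚ.+-monoʳ-≤ H (frac-≤ 1 (suc i) n _ (ℕ.≤-reflexive (cancel (suc (suc i))))) ⟩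
             H ℚ.+ + n ℚ./ (n ℕ.* suc (suc i))
               ≤⟨ harmonic-lower (n ℕ.* suc i) n _ (ℕ.≤-reflexive (step i)) ⟩
             harmonic (n ℕ.* suc i ℕ.+ n)
               ≡⟨ cong harmonic (step i) ⟩
             harmonic (n ℕ.* suc (suc i)) ∎) ⟩
      harmonic (n ℕ.* suc (suc i)) ℚ.- (h ℚ.+ e) ∎
      where
      open ℚ.≤-Reasoning
      H = harmonic (n ℕ.* suc i)
      h = harmonic (suc i)
      e = + 1 ℚ./ suc (suc i)

    logSum-step-≥ : ∀ i → logSum n (suc i) ℚ.+ + 1 ℚ./ suc (suc i) ℚ.≤ logSum n i ℚ.+ + 1 ℚ./ suc i
    logSum-step-≥ i = begin
      harmonic (n ℕ.* suc (suc i)) ℚ.- (h ℚ.+ e) ℚ.+ e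
        ≡⟨ Identity.drop (harmonic (n ℕ.* suc (suc i))) h e ⟩
      harmonic (n ℕ.* suc (suc i)) ℚ.- h
        ≤⟨ ℚ.+-monoˡ-≤ (ℚ.- h) (begin
             harmonic (n ℕ.* suc (suc i))
               ≡⟨ cong harmonic (step i) ⟨
             harmonic (n ℕ.* suc i ℕ.+ n)
               ≤⟨ harmonic-upper (n ℕ.* suc i) n _ ℕ.≤-refl ⟩
             H ℚ.+ + n ℚ./ (n ℕ.* suc i)
               ≤⟨ ℚ.+-monoʳ-≤ H (frac-≤ n _ 1 i (ℕ.≤-reflexive (sym (cancel (suc i))))) ⟩
             H ℚ.+ e′ ∎) ⟩
      H ℚ.+ e′ ℚ.- h
        ≡⟨ Identity.swap H h e′ ⟩
      H ℚ.- h ℚ.+ e′ ∎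
      where
      open ℚ.≤-Reasoning
      H = harmonic (n ℕ.* suc i)
      h = harmonic (suc i)
      e = + 1 ℚ./ suc (suc i)
      e′ = + 1 ℚ./ suc i

    logSum-mono : ∀ i k → logSum n i ℚ.≤ logSum n (k ℕ.+ i)
    logSum-mono i zero    = ℚ.≤-refl
    logSum-mono i (suc k) = ℚ.≤-trans (logSum-mono i k) (logSum-step-≤ (k ℕ.+ i))

    logSum-anti : ∀ i k → logSum n (k ℕ.+ i) ℚ.+ + 1 ℚ./ suc (k ℕ.+ i) ℚ.≤ logSum n i ℚ.+ + 1 ℚ./ suc i
    logSum-anti i zero    = ℚ.≤-refl
    logSum-anti i (suc k) = ℚ.≤-trans (logSum-step-≥ (k ℕ.+ i)) (logSum-anti i k)

    logSum-close : ∀ i j → i ℕ.≤ j → ℚ.∣ logSum n j ℚ.- logSum n i ∣ ℚ.≤ + 1 ℚ./ suc i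
    logSum-close i j i≤j = subst (λ j → ℚ.∣ logSum n j ℚ.- logSum n i ∣ ℚ.≤ + 1 ℚ./ suc i)
                             (ℕ.m∸n+n≡m i≤j) (go (j ℕ.∸ i))
      where
      open ℚ.≤-Reasoning
      a = logSum n i
      go : ∀ k → ℚ.∣ logSum n (k ℕ.+ i) ℚ.- a ∣ ℚ.≤ + 1 ℚ./ suc i
      go k = begin
        ℚ.∣ b ℚ.- a ∣
          ≡⟨ ℚ.0≤p⇒∣p∣≡p (subst (ℚ._≤ b ℚ.- a) (ℚ.+-inverseʳ a)
               (ℚ.+-monoˡ-≤ (ℚ.- a) (logSum-mono i k))) ⟩
        b ℚ.- a
          ≡⟨ ℚ.+-identityʳ (b ℚ.- a) ⟨
        b ℚ.- a ℚ.+ 0ℚ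
          ≤⟨ ℚ.+-monoʳ-≤ (b ℚ.- a) (frac-≤ 0 0 1 (k ℕ.+ i) z≤n) ⟩
        b ℚ.- a ℚ.+ e
          ≡⟨ sym (Identity.swap b a e) ⟩
        b ℚ.+ e ℚ.- a
          ≤⟨ ℚ.+-monoˡ-≤ (ℚ.- a) (logSum-anti i k) ⟩
        a ℚ.+ + 1 ℚ./ suc i ℚ.- a
          ≡⟨ Identity.cancel a (+ 1 ℚ./ suc i) ⟩
        + 1 ℚ./ suc i ∎
        where
        b = logSum n (k ℕ.+ i)
        e = + 1 ℚ./ suc (k ℕ.+ i)

    logSum-cauchy : IsCauchy (logSum n)
    logSum-cauchy ε 0<ε with archimedean ε 0<ε
    ... | N , h = N , λ i j N≤i N≤j → close i j N≤i N≤j (ℕ.≤-total i j)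
      where
      bound : ∀ i j → N ℕ.≤ i → i ℕ.≤ j → ℚ.∣ logSum n j ℚ.- logSum n i ∣ ℚ.≤ ε
      bound i j N≤i i≤j = ℚ.≤-trans (logSum-close i j i≤j)
        (ℚ.≤-trans (frac-≤ 1 i 1 N (ℕ.*-monoʳ-≤ 1 (s≤s N≤i))) h)
      flip : ∀ a b → ℚ.∣ a ℚ.- b ∣ ≡ ℚ.∣ b ℚ.- a ∣
      flip a b = trans (sym (ℚ.∣-p∣≡∣p∣ (a ℚ.- b)))
        (cong ℚ.∣_∣ (Identity.negate a b))
      close : ∀ i j → N ℕ.≤ i → N ℕ.≤ j → _ → ℚ.∣ logSum n i ℚ.- logSum n j ∣ ℚ.≤ ε
      close i j N≤i N≤j (inj₁ i≤j) =
        subst (ℚ._≤ ε) (flip (logSum n j) (logSum n i)) (bound i j N≤i i≤j)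
      close i j N≤i N≤j (inj₂ j≤i) = bound j i N≤j j≤i

open LogFacts

-- The value at 0 is a junk value.
log : ℕ → ℝ
log zero    = 0ℝ
log (suc n) = mkℝ (logSum (suc n)) (logSum-cauchy n)

------------------------------------------------------------------------
-- Combinatorial discrepancy of set systems on the ground set Fin n

SetSystem : ℕ → Set₁
SetSystem n = Pred (Subset n) 0ℓ

Colouring : ℕ → Set
Colouring n = Fin n → Sign

signedSum : ∀ {n} → Colouring n → Subset n → ℤ
signedSum x F = sum (λ v → if lookup F v then x v ◃ 1 else + 0)

IsMax IsMin : Pred ℕ 0ℓ → ℕ → Set
IsMax A m = A m × (∀ k → A k → k ℕ.≤ m)
IsMin A m = A m × (∀ k → A k → m ℕ.≤ k)

-- Membership in 𝓕 need not be decidable, so the maximum and the minimum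
-- are relations between a set of values and its extremum.
IsDiscUnder : ∀ {n} → SetSystem n → Colouring n → ℕ → Set
IsDiscUnder 𝓕 x = IsMax (λ k → ∃[ F ] (𝓕 F × k ≡ ℤ.∣ signedSum x F ∣))

IsDisc : ∀ {n} → SetSystem n → ℕ → Set
IsDisc 𝓕 = IsMin (λ k → ∃[ x ] IsDiscUnder 𝓕 x k)

------------------------------------------------------------------------
-- Axis-parallel boxes in ℝᵈ

Point : ℕ → Set
Point d = Fin d → ℝ

_≋_ : ∀ {d} → Point d → Point d → Set
p ≋ q = ∀ j → p j ≈ q j

record Box (d : ℕ) : Set where
  field
    lower upper : Point d
    lower≤upper : ∀ j → lower j ≤ upper j

_∈ᴮ_ : ∀ {d} → Point d → Box d → Set
p ∈ᴮ R = ∀ j → Box.lower R j ≤ p j × p j ≤ Box.upper R j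

record PointSet (d n : ℕ) : Set where
  field
    point    : Fin n → Point d
    distinct : Injective _≡_ _≋_ point

open PointSet public

𝓡 : ∀ {d n} → PointSet d n → SetSystem n
𝓡 {d} P F = Σ[ R ∈ Box d ] (∀ i → i ∈ F ⇔ point P i ∈ᴮ R)

InfinitelyMany : Pred ℕ 0ℓ → Set
InfinitelyMany A = ∀ N → ∃[ n ] (N ℕ.≤ n × A n)

{-# OPTIONS --safe #-}
module Submission where

import Algebra.Properties.CommutativeMonoid.Sum as Sum
import Algebra.Solver.Ring
open import Algebra.Solver.Ring.AlmostCommutativeRing using (AlmostCommutativeRing; IsAlmostCommutativeRing; fromCommutativeRing; _-Raw-AlmostCommutative⟶_)
open import Data.Bool.Base using (Bool; true; false; if_then_else_)
open import Data.Fin.Base as Fin using (Fin; zero; suc; toℕ)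
open import Data.Fin.Patterns using (0F; 1F; 2F; 3F)
import Data.Fin.Properties as Fin
open import Data.Fin.Subset as Subset using (Subset; inside; outside; _∈_)
open import Data.Fin.Subset.Properties using (anySubset?; _∈?_; ∉⊥)
open import Data.Integer.Base as ℤ using (ℤ; _◃_)
import Data.Integer.Properties as ℤ
open import Data.List.Base using (List; []; _∷_; _++_; map; length)
import Data.Maybe.Base as Maybe
open import Data.Nat.Base as ℕ using (ℕ; zero; suc; s≤s; _∸_) renaming (_≤_ to _≤ℕ_)
import Data.Nat.Coprimality as Coprime
import Data.Nat.Properties as ℕ
open import Data.Nat.Solver using (module +-*-Solver)
open import Data.Product.Base using (Σ-syntax; ∃-syntax; _×_; _,_; proj₁; proj₂)
open import Data.Rational.Base as ℚ using (ℚ; mkℚ; 0ℚ; 1ℚ)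
import Data.Rational.Properties as ℚ
import Data.Rational.Unnormalised.Base as ℚᵘ
import Data.Rational.Unnormalised.Properties as ℚᵘ
open import Data.Sign.Base as Sign using (Sign)
open import Data.Sum.Base using (_⊎_; inj₁; inj₂)
open import Data.Unit.Base using (⊤; tt)
open import Data.Vec.Base as Vec using (Vec; []; _∷_; lookup; tabulate; toList)
open import Data.Vec.Membership.Propositional using () renaming (_∈_ to _∈ᵛ_)
open import Data.Vec.Membership.Propositional.Properties using (∈-lookup)
open import Data.Vec.Properties using (lookup∘tabulate; tabulate∘lookup; tabulate-cong; lookup⇒[]=; []=⇒lookup; length-toList)
open import Data.Vec.Relation.Unary.Any using (here; there)
open import Function.Base using (_∘_)
open import Function.Bundles using (mk⇔; Equivalence)
open import Level using (0ℓ)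
open import Relation.Binary.Consequences using (dec⇒weaklyDec)
open import Relation.Binary.Definitions using (tri<; tri≈; tri>)
open import Relation.Binary.PropositionalEquality hiding (J)
open import Relation.Nullary using (¬_; Dec; yes; no; contradiction; map′; _×-dec_; _→-dec_)
open import Relation.Nullary.Decidable using (dec-true; dec-false)
open import Relation.Unary using (Pred; Decidable)

open Sum ℤ.+-0-commutativeMonoid using (sum; sum-cong-≗)
open +-*-Solver using () renaming (solve to solveℕ; _:+_ to _⊞_; _:*_ to _⊠_; _:=_ to _≜_; con to conℕ)

-- Let the base-4 words of length m be the coordinates of a grid.  On a 4-adic interval R, let
-- y_R take the values (1, -3, 3, -1) on its four quarters, and let
-- g_R(p) = Σ_{a < p} y_R(a).  Since y_R annihilates quadratic polynomials, the functions g_R of different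
-- scales are orthogonal, as are the y_R.  In dimension d take tensor products over the boxes
-- R = R₁ × … × R_d of volume 4⁻ᵗ, where t = (d - 1) τ and m = t + 1; all sides but the last being
-- longer than 4^(-τ), there are K = 4ᵗ τᵈ⁻¹ of them.
--
-- For a colouring x of a set of grid points, the vector S_x = Σ_p x_p (g_R(p))_R is the image under the
-- matrix (y_R(a)) of the discrepancies of x on the orthants {p : a < p}, so Bessel's inequality
-- bounds |S_x| in terms of the largest of these discrepancies.  It remains to find a set all of whose
-- colourings have large |S_x|.  By a trace argument one can successively choose ≈ K grid points whose
-- vectors (g_R(p))_R are far from the span of the previous ones.  If every subset J of these points had
-- a colouring with small |S_x|, there would be 2ᵏ vectors x ∈ {-1, 0, 1}ᵏ, one with each support, with
-- small |S_x|; but reading the coordinates of S_x in the Gram–Schmidt basis from the last to the first,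
-- at most one of the three values of each x_i makes the corresponding coordinate small, so there are
-- fewer such x.  Hence some J has discrepancy ≥ c τᵈ⁻¹, while log |J| = O(τ).

-- A coarser `g` is affine on each quarter of its interval, so orthogonality across scales asks that
-- a finer `g` have mean and first moment zero. Hence the three vanishing moments of `y`, and hence
-- base 4: the third difference is the shortest such pattern.
--
-- Each level down scales the bounds on the squared norm of `g` by 1/64, so over boxes of one volume
-- the squared norms lie between a common Z and 6ᵈ Z, and one Bessel constant 6ᵈ Z serves them all.
-- The trace Σ_p |(g_R(p))_R|² is at least K Z, and a Gram-Schmidt step removes at most 6ᵈ Z from
-- it. With K = 10 · 6ᵈ (ℓ + 1), more than 4 · 6ᵈ (ℓ + 1) Z is left after 5 (ℓ + 1) steps; averaged
-- over the N grid points, this gives the squared distance s.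
--
-- The counting makes more than a fifth of the Gram-Schmidt coordinates of some S_x large, so |S_x|²
-- is at least of order s ℓ. Against the Bessel bound for `y`, this makes the squared discrepancy at
-- least of order (ℓ / 4ᵗ)², that is (τᵈ⁻¹)², since K = 4ᵗ τᵈ⁻¹.

module LinearAlgebra where

  -- Rational arithmetic and finite sums

  open import Data.Rational.Base using (_≤_; _<_)

  module ≤R = ℚ.≤-Reasoning

  -- The library's operations on ℚ unfold on variables (ℚ has η), which defeats
  -- unification; these opaque copies do not.
  infix  8 -_
  infixl 7 _*_
  infixl 6 _+_ _-_
  opaque
    _+_ _*_ : ℚ → ℚ → ℚ
    _+_ = ℚ._+_
    _*_ = ℚ._*_

    -_ : ℚ → ℚ
    -_ = ℚ.-_

  _-_ : ℚ → ℚ → ℚ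
  x - y = x + - y

  -- Given by its fields, so that `ι 0ℤ` and `ι 1ℤ` are `0ℚ` and `1ℚ` by computation, as the
  -- coefficient morphism of the solver requires.
  ι : ℤ → ℚ
  ι i = mkℚ i 0 (Coprime.sym (Coprime.1-coprimeTo ℤ.∣ i ∣))

  opaque
    unfolding _+_

    *≡ : ∀ x y → x * y ≡ x ℚ.* y
    *≡ x y = refl

    isAlmostCommutativeRing : IsAlmostCommutativeRing _≡_ _+_ _*_ -_ 0ℚ 1ℚ
    isAlmostCommutativeRing =
      AlmostCommutativeRing.isAlmostCommutativeRing (fromCommutativeRing ℚ.+-*-commutativeRing)

    ι-+ : ∀ i j → ι (i ℤ.+ j) ≡ ι i + ι j
    ι-+ i j = ℚ.toℚᵘ-injective (ℚᵘ.≃-sym (ℚᵘ.≃-trans (ℚ.toℚᵘ-homo-+ (ι i) (ι j))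
      (ℚᵘ.*≡* (cong (ℤ._* ℤ.1ℤ) (cong₂ ℤ._+_ (ℤ.*-identityʳ i) (ℤ.*-identityʳ j))))))

    ι-* : ∀ i j → ι (i ℤ.* j) ≡ ι i * ι j
    ι-* i j = ℚ.toℚᵘ-injective (ℚᵘ.≃-sym (ℚ.toℚᵘ-homo-* (ι i) (ι j)))

    ι-neg : ∀ i → ι (ℤ.- i) ≡ - ι i
    ι-neg (ℤ.+ zero)  = refl
    ι-neg ℤ.+[1+ n ]    = refl
    ι-neg ℤ.-[1+ n ]    = refl

    +-mono-≤ : ∀ {p q r s} → p ≤ q → r ≤ s → p + r ≤ q + s
    +-mono-≤ = ℚ.+-mono-≤

    +-mono-<-≤ : ∀ {p q r s} → p < q → r ≤ s → p + r < q + s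
    +-mono-<-≤ = ℚ.+-mono-<-≤

    neg-antimono-≤ : ∀ {p q} → p ≤ q → - q ≤ - p
    neg-antimono-≤ = ℚ.neg-antimono-≤

    *-monoʳ-≤ : ∀ {c a b} → 0ℚ ≤ c → a ≤ b → c * a ≤ c * b
    *-monoʳ-≤ {c} 0≤c = ℚ.*-monoˡ-≤-nonNeg c {{ℚ.nonNegative 0≤c}}

    *-monoʳ-< : ∀ {c a b} → 0ℚ < c → a < b → c * a < c * b
    *-monoʳ-< {c} 0<c = ℚ.*-monoʳ-<-pos c {{ℚ.positive 0<c}}

    *-cancel-≤ : ∀ {c a b} → 0ℚ < c → c * a ≤ c * b → a ≤ b
    *-cancel-≤ {c} 0<c = ℚ.*-cancelˡ-≤-pos c {{ℚ.positive 0<c}}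

  ring : AlmostCommutativeRing 0ℓ 0ℓ
  ring = record { isAlmostCommutativeRing = isAlmostCommutativeRing }

  open IsAlmostCommutativeRing isAlmostCommutativeRing using (+-comm; +-assoc; +-identityˡ; +-identityʳ; *-comm; *-assoc; *-identityˡ; *-identityʳ; zeroˡ; zeroʳ; distribˡ) public

  ι-morphism : ℤ.+-*-rawRing -Raw-AlmostCommutative⟶ ring
  ι-morphism = record
    { ⟦_⟧ = ι ; +-homo = ι-+ ; *-homo = ι-* ; -‿homo = ι-neg ; 0-homo = refl ; 1-homo = refl }

  open Algebra.Solver.Ring ℤ.+-*-rawRing ring ι-morphism
    (λ i j → Maybe.map (cong ι) (dec⇒weaklyDec ℤ._≟_ i j))
    using (solve; _:=_; _:+_; _:*_; _:-_; :-_; con) public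

  ⌜_⌝ : ℕ → ℚ
  ⌜ n ⌝ = ι (ℤ.+ n)

  ⌜⌝-+ : ∀ m n → ⌜ m ℕ.+ n ⌝ ≡ ⌜ m ⌝ + ⌜ n ⌝
  ⌜⌝-+ m n = ι-+ (ℤ.+ m) (ℤ.+ n)

  ⌜⌝-* : ∀ m n → ⌜ m ℕ.* n ⌝ ≡ ⌜ m ⌝ * ⌜ n ⌝
  ⌜⌝-* m n = trans (cong ι (ℤ.pos-* m n)) (ι-* (ℤ.+ m) (ℤ.+ n))

  0≤⌜_⌝ : ∀ n → 0ℚ ≤ ⌜ n ⌝
  0≤⌜ n ⌝ = ℚ.nonNegative⁻¹ ⌜ n ⌝

  infix 9 _²
  _² : ℚ → ℚ
  x ² = x * x

  +-monoʳ-≤ : ∀ c {a b} → a ≤ b → c + a ≤ c + b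
  +-monoʳ-≤ c = +-mono-≤ (ℚ.≤-refl {c})

  +-monoˡ-≤ : ∀ c {a b} → a ≤ b → a + c ≤ b + c
  +-monoˡ-≤ c a≤b = +-mono-≤ a≤b (ℚ.≤-refl {c})

  *-monoˡ-≤ : ∀ {c a b} → 0ℚ ≤ c → a ≤ b → a * c ≤ b * c
  *-monoˡ-≤ {c} {a} {b} 0≤c a≤b = subst₂ _≤_ (*-comm c a) (*-comm c b) (*-monoʳ-≤ 0≤c a≤b)

  *-nonneg : ∀ {a b} → 0ℚ ≤ a → 0ℚ ≤ b → 0ℚ ≤ a * b
  *-nonneg {a} {b} 0≤a 0≤b = subst (_≤ a * b) (zeroʳ a) (*-monoʳ-≤ 0≤a 0≤b)

  *-pos : ∀ {a b} → 0ℚ < a → 0ℚ < b → 0ℚ < a * b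
  *-pos {a} {b} 0<a 0<b = subst (_< a * b) (zeroʳ a) (*-monoʳ-< 0<a 0<b)

  *-mono-≤ : ∀ {a b c d} → 0ℚ ≤ a → 0ℚ ≤ d → a ≤ b → c ≤ d → a * c ≤ b * d
  *-mono-≤ 0≤a 0≤d a≤b c≤d = ℚ.≤-trans (*-monoʳ-≤ 0≤a c≤d) (*-monoˡ-≤ 0≤d a≤b)

  +-nonneg : ∀ {a b} → 0ℚ ≤ a → 0ℚ ≤ b → 0ℚ ≤ a + b
  +-nonneg {a} {b} 0≤a 0≤b = subst (_≤ a + b) (+-identityˡ 0ℚ) (+-mono-≤ 0≤a 0≤b)

  p≤q+p : ∀ {p q} → 0ℚ ≤ q → p ≤ q + p
  p≤q+p {p} {q} 0≤q = subst (_≤ q + p) (+-identityˡ p) (+-monoˡ-≤ p 0≤q)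

  ²-nonneg : ∀ x → 0ℚ ≤ x ²
  ²-nonneg x with ℚ.≤-total 0ℚ x
  ... | inj₁ 0≤x = *-nonneg 0≤x 0≤x
  ... | inj₂ x≤0 = subst (0ℚ ≤_) (solve 1 (λ x → (con ℤ.0ℤ :- x) :* (con ℤ.0ℤ :- x) := x :* x) refl x)
                     (*-nonneg 0≤-x 0≤-x)
    where
    0≤-x : 0ℚ ≤ 0ℚ - x
    0≤-x = subst (_≤ 0ℚ - x) (solve 1 (λ x → x :- x := con ℤ.0ℤ) refl x) (+-monoˡ-≤ (- x) x≤0)

  private variable
    α β γ : Set

  ∑ : List α → (α → ℚ) → ℚ
  ∑ []       f = 0ℚ
  ∑ (x ∷ xs) f = f x + ∑ xs f

  infix 8 ∑
  syntax ∑ xs (λ x → e) = ∑[ x ∈ xs ] e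

  card : List α → ℚ
  card xs = ∑[ _ ∈ xs ] 1ℚ

  ∑-cong : ∀ (xs : List α) {f g} → (∀ x → f x ≡ g x) → ∑ xs f ≡ ∑ xs g
  ∑-cong []       eq = refl
  ∑-cong (x ∷ xs) eq = cong₂ _+_ (eq x) (∑-cong xs eq)

  ∑-mono : ∀ (xs : List α) {f g} → (∀ x → f x ≤ g x) → ∑ xs f ≤ ∑ xs g
  ∑-mono []       le = ℚ.≤-refl
  ∑-mono (x ∷ xs) le = +-mono-≤ (le x) (∑-mono xs le)

  ∑-zero : ∀ (xs : List α) → ∑[ _ ∈ xs ] 0ℚ ≡ 0ℚ
  ∑-zero []       = refl
  ∑-zero (x ∷ xs) = trans (+-identityˡ _) (∑-zero xs)

  ∑-nonneg : ∀ (xs : List α) {f} → (∀ x → 0ℚ ≤ f x) → 0ℚ ≤ ∑ xs f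
  ∑-nonneg []       le = ℚ.≤-refl
  ∑-nonneg (x ∷ xs) le = +-nonneg (le x) (∑-nonneg xs le)

  ∑-+ : ∀ (xs : List α) f g → ∑[ x ∈ xs ] (f x + g x) ≡ ∑ xs f + ∑ xs g
  ∑-+ []       f g = sym (+-identityˡ 0ℚ)
  ∑-+ (x ∷ xs) f g = trans (cong (_ +_) (∑-+ xs f g))
    (solve 4 (λ a b c d → (a :+ b) :+ (c :+ d) := (a :+ c) :+ (b :+ d)) refl (f x) (g x) (∑ xs f) (∑ xs g))

  ∑-*ˡ : ∀ (xs : List α) c f → ∑[ x ∈ xs ] (c * f x) ≡ c * ∑ xs f
  ∑-*ˡ []       c f = sym (zeroʳ c)
  ∑-*ˡ (x ∷ xs) c f = trans (cong (_ +_) (∑-*ˡ xs c f)) (sym (distribˡ c _ _))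

  ∑-*ʳ : ∀ (xs : List α) f c → ∑[ x ∈ xs ] (f x * c) ≡ ∑ xs f * c
  ∑-*ʳ xs f c = trans (∑-cong xs (λ x → *-comm (f x) c)) (trans (∑-*ˡ xs c f) (*-comm c _))

  ∑-const : ∀ (xs : List α) c → ∑[ _ ∈ xs ] c ≡ c * card xs
  ∑-const xs c = trans (∑-cong xs (λ _ → sym (*-identityʳ c))) (∑-*ˡ xs c (λ _ → 1ℚ))

  ∑-swap : ∀ (xs : List α) (ys : List β) (f : α → β → ℚ) →
           ∑[ x ∈ xs ] ∑[ y ∈ ys ] f x y ≡ ∑[ y ∈ ys ] ∑[ x ∈ xs ] f x y
  ∑-swap []       ys f = sym (∑-zero ys)
  ∑-swap (x ∷ xs) ys f = trans (cong (_ +_) (∑-swap xs ys f)) (sym (∑-+ ys (f x) _))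

  ∑-++ : ∀ (xs ys : List α) f → ∑ (xs ++ ys) f ≡ ∑ xs f + ∑ ys f
  ∑-++ []       ys f = sym (+-identityˡ _)
  ∑-++ (x ∷ xs) ys f = trans (cong (f x +_) (∑-++ xs ys f)) (sym (+-assoc (f x) _ _))

  ∑-map : ∀ (h : α → β) xs f → ∑ (map h xs) f ≡ ∑[ x ∈ xs ] f (h x)
  ∑-map h []       f = refl
  ∑-map h (x ∷ xs) f = cong (_ +_) (∑-map h xs f)

  pairs : List α → (α → List β) → (α → β → γ) → List γ
  pairs []       ys h = []
  pairs (x ∷ xs) ys h = map (h x) (ys x) ++ pairs xs ys h

  ∑-pairs : ∀ xs (ys : α → List β) (h : α → β → γ) f →
            ∑ (pairs xs ys h) f ≡ ∑[ x ∈ xs ] ∑[ y ∈ ys x ] f (h x y)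
  ∑-pairs []       ys h f = refl
  ∑-pairs (x ∷ xs) ys h f = trans (∑-++ (map (h x) (ys x)) _ f)
    (cong₂ _+_ (∑-map (h x) (ys x) f) (∑-pairs xs ys h f))

  ∑-product : ∀ (xs : List α) (ys : List β) f g →
              ∑[ x ∈ xs ] ∑[ y ∈ ys ] (f x * g y) ≡ ∑ xs f * ∑ ys g
  ∑-product xs ys f g = trans (∑-cong xs (λ x → ∑-*ˡ ys (f x) g)) (∑-*ʳ xs f _)

  -- Averaging. The strict hypothesis excludes the empty list, where both sides vanish.
  large-term : ∀ (xs : List α) f s → s * card xs < ∑ xs f → ∃[ x ] s ≤ f x
  large-term []       f s lt = contradiction lt (ℚ.<-irrefl (zeroʳ s))
  large-term (x ∷ xs) f s lt with s ℚ.≤? f x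
  ... | yes s≤fx = x , s≤fx
  ... | no  s≰fx with s * card xs ℚ.<? ∑ xs f
  ...   | yes lt′ = large-term xs f s lt′
  ...   | no ¬lt′ = contradiction (ℚ.<-≤-trans lt (begin
    f x + ∑ xs f       ≤⟨ +-mono-≤ (ℚ.<⇒≤ (ℚ.≰⇒> s≰fx)) (ℚ.≮⇒≥ ¬lt′) ⟩
    s + s * card xs    ≡⟨ solve 2 (λ s c → s :+ s :* c := s :* (con ℤ.1ℤ :+ c)) refl s (card xs) ⟩
    s * (1ℚ + card xs) ∎)) (ℚ.<-irrefl refl)
    where open ≤R

  -- Expand 0 ≤ ∑ (c u - bᵀ w)² at w = b u.
  transpose-bound : ∀ {α β : Set} (xs : List α) (rs : List β) (b : β → α → ℚ) c → 0ℚ < c →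
    (∀ (w : β → ℚ) → ∑[ x ∈ xs ] (∑[ r ∈ rs ] (w r * b r x)) ² ≤ c * ∑[ r ∈ rs ] (w r) ²) →
    ∀ (u : α → ℚ) → ∑[ r ∈ rs ] (∑[ x ∈ xs ] (b r x * u x)) ² ≤ c * ∑[ x ∈ xs ] (u x) ²
  transpose-bound {α} {β} xs rs b c 0<c bound u = *-cancel-≤ 0<c (begin
    c * W                        ≡⟨ lhs c W ⟩
    (c * W + c * W) - c * W      ≤⟨ +-monoʳ-≤ _ (neg-antimono-≤ (bound w)) ⟩
    (c * W + c * W) - V          ≤⟨ p≤q+p E-nonneg ⟩
    E + ((c * W + c * W) - V)    ≡⟨ cong (_+ ((c * W + c * W) - V)) expand ⟩
    c * (c * U) - (c * W + c * W) + V + ((c * W + c * W) - V)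
                                 ≡⟨ solve 3 (λ p q r → p :- q :+ r :+ (q :- r) := p) refl (c * (c * U)) (c * W + c * W) V ⟩
    c * (c * U)                  ∎)
    where
    open ≤R
    w : β → ℚ
    w r = ∑[ x ∈ xs ] (b r x * u x)
    image : α → ℚ
    image x = ∑[ r ∈ rs ] (w r * b r x)
    U = ∑[ x ∈ xs ] (u x) ²
    W = ∑[ r ∈ rs ] (w r) ²
    V = ∑[ x ∈ xs ] (image x) ²
    E = ∑[ x ∈ xs ] (c * u x - image x) ²
    lhs : ∀ c W → c * W ≡ (c * W + c * W) - c * W
    lhs = solve 2 (λ c W → c :* W := (c :* W :+ c :* W) :- c :* W) refl
    E-nonneg : 0ℚ ≤ E
    E-nonneg = ∑-nonneg xs (λ x → ²-nonneg _)
    cross : ∑[ x ∈ xs ] (u x * image x) ≡ W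
    cross = begin-equality
      ∑[ x ∈ xs ] (u x * image x)
        ≡⟨ ∑-cong xs (λ x → ∑-*ˡ rs (u x) _) ⟨
      ∑[ x ∈ xs ] ∑[ r ∈ rs ] (u x * (w r * b r x))
        ≡⟨ ∑-swap xs rs _ ⟩
      ∑[ r ∈ rs ] ∑[ x ∈ xs ] (u x * (w r * b r x))
        ≡⟨ ∑-cong rs (λ r → trans (∑-cong xs (λ x →
             solve 3 (λ u w b → u :* (w :* b) := w :* (b :* u)) refl (u x) (w r) (b r x)))
             (∑-*ˡ xs (w r) _)) ⟩
      W ∎
    expand : E ≡ c * (c * U) - (c * W + c * W) + V
    expand = begin-equality
      E ≡⟨ ∑-cong xs (λ x → solve 3 (λ c u i →
             (c :* u :- i) :* (c :* u :- i) :=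
             (c :* c) :* (u :* u) :+ (:- (c :+ c)) :* (u :* i) :+ i :* i) refl c (u x) (image x)) ⟩
      ∑[ x ∈ xs ] ((c * c) * (u x) ² + (- (c + c)) * (u x * image x) + (image x) ²)
        ≡⟨ trans (∑-+ xs _ _) (cong (_+ V) (trans (∑-+ xs _ _)
             (cong₂ _+_ (∑-*ˡ xs (c * c) _) (trans (∑-*ˡ xs (- (c + c)) _) (cong (- (c + c) *_) cross))))) ⟩
      (c * c) * U + (- (c + c)) * W + V
        ≡⟨ solve 4 (λ c U W V → (c :* c) :* U :+ (:- (c :+ c)) :* W :+ V
             := c :* (c :* U) :- (c :* W :+ c :* W) :+ V) refl c U W V ⟩
      c * (c * U) - (c * W + c * W) + V ∎

  -- Total, with default value 0 at 0, so that projections can be written down before positivity is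
  -- known.
  inv : ℚ → ℚ
  inv a with a ℚ.≟ 0ℚ
  ... | yes _  = 0ℚ
  ... | no a≢0 = ℚ.1/_ a {{ℚ.≢-nonZero a≢0}}

  inv-right : ∀ {a} → 0ℚ < a → a * inv a ≡ 1ℚ
  inv-right {a} 0<a with a ℚ.≟ 0ℚ
  ... | yes refl = contradiction 0<a (ℚ.<-irrefl refl)
  ... | no a≢0   = trans (*≡ a _) (ℚ.*-inverseʳ a {{ℚ.≢-nonZero a≢0}})

  inv-nonneg : ∀ {a} → 0ℚ < a → 0ℚ ≤ inv a
  inv-nonneg {a} 0<a = *-cancel-≤ 0<a
    (subst₂ _≤_ (sym (zeroʳ a)) (sym (inv-right 0<a)) (ℚ.<⇒≤ (ℚ.positive⁻¹ 1ℚ)))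

  -- Counting vectors in {-1, 0, 1}ᵏ

  data Trit : Set where
    neg nul pos : Trit

  tri : Trit → ℚ
  tri neg = ι ℤ.-1ℤ
  tri nul = 0ℚ
  tri pos = 1ℚ

  -- Fails for at most one x.  The weights 1 and 8 are chosen so that 2⁵ · 8⁴ > (1 + 1 + 8)⁵.
  large? : ∀ a c x → Dec (a ² ≤ ⌜ 4 ⌝ * (tri x * a + c) ²)
  large? a c x = a ² ℚ.≤? ⌜ 4 ⌝ * (tri x * a + c) ²

  -- `weight₁` is 8 to the power 1 - `penalty`: a vector is heavy when few of its coordinates are
  -- large.
  penalty weight₁ : ∀ a c → Trit → ℕ
  penalty a c x with large? a c x
  ... | yes _ = 1
  ... | no  _ = 0
  weight₁ a c x with large? a c x
  ... | yes _ = 1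
  ... | no  _ = 8

  -- Two failures would make the left-hand side of the identity smaller than 2 a², which the
  -- nonnegative excess `d` forbids.
  not-both : ∀ a c x y d → 0ℚ ≤ d →
    ⌜ 4 ⌝ * (tri x * a + c) ² + ⌜ 4 ⌝ * (tri y * a + c) ² ≡ d + (a ² + a ²) →
    ¬ (a ² ≤ ⌜ 4 ⌝ * (tri x * a + c) ²) → a ² ≤ ⌜ 4 ⌝ * (tri y * a + c) ²
  not-both a c x y d 0≤d eq ¬x = ℚ.≮⇒≥ λ y< → contradiction (begin-strict
    ⌜ 4 ⌝ * (tri x * a + c) ² + ⌜ 4 ⌝ * (tri y * a + c) ²
      <⟨ +-mono-<-≤ (ℚ.≰⇒> ¬x) (ℚ.<⇒≤ y<) ⟩
    a ² + a ²        ≤⟨ p≤q+p 0≤d ⟩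
    d + (a ² + a ²)  ≡⟨ eq ⟨
    ⌜ 4 ⌝ * (tri x * a + c) ² + ⌜ 4 ⌝ * (tri y * a + c) ² ∎) (ℚ.<-irrefl refl)
    where open ≤R

  weight₁-sum : ∀ a c → weight₁ a c neg ℕ.+ weight₁ a c nul ℕ.+ weight₁ a c pos ℕ.≤ 10
  weight₁-sum a c with large? a c neg | large? a c nul | large? a c pos
  ... | yes _ | yes _ | yes _ = ℕ.m≤m+n 3 7
  ... | yes _ | yes _ | no  _ = ℕ.≤-refl
  ... | yes _ | no  _ | yes _ = ℕ.≤-refl
  ... | no  _ | yes _ | yes _ = ℕ.≤-refl
  -- For each pair of trits the excess is a sum of squares: 2 (a + 2 c)², 2 (a - 2 c)² and 6 a² + 8
  -- c² in the three cases.
  ... | _     | no ¬0 | no ¬+ = contradiction (not-both a c nul pos _ 0≤ eq ¬0) ¬+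
    where
    0≤ : 0ℚ ≤ (a + (c + c)) ² + (a + (c + c)) ²
    0≤ = +-nonneg (²-nonneg _) (²-nonneg _)
    eq = solve 2 (λ a c →
      con (ℤ.+ 4) :* ((con (ℤ.+ 0) :* a :+ c) :* (con (ℤ.+ 0) :* a :+ c)) :+
      con (ℤ.+ 4) :* ((con (ℤ.+ 1) :* a :+ c) :* (con (ℤ.+ 1) :* a :+ c)) :=
      ((a :+ (c :+ c)) :* (a :+ (c :+ c)) :+ (a :+ (c :+ c)) :* (a :+ (c :+ c))) :+ (a :* a :+ a :* a)) refl a c
  ... | no ¬- | no ¬0 | yes _ = contradiction (not-both a c nul neg _ 0≤ eq ¬0) ¬-
    where
    0≤ : 0ℚ ≤ (a - (c + c)) ² + (a - (c + c)) ²
    0≤ = +-nonneg (²-nonneg _) (²-nonneg _)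
    eq = solve 2 (λ a c →
      con (ℤ.+ 4) :* ((con (ℤ.+ 0) :* a :+ c) :* (con (ℤ.+ 0) :* a :+ c)) :+
      con (ℤ.+ 4) :* ((con ℤ.-1ℤ :* a :+ c) :* (con ℤ.-1ℤ :* a :+ c)) :=
      ((a :- (c :+ c)) :* (a :- (c :+ c)) :+ (a :- (c :+ c)) :* (a :- (c :+ c))) :+ (a :* a :+ a :* a)) refl a c
  ... | no ¬- | yes _ | no ¬+ = contradiction (not-both a c neg pos _ 0≤ eq ¬-) ¬+
    where
    0≤ : 0ℚ ≤ ⌜ 6 ⌝ * a ² + ⌜ 8 ⌝ * c ²
    0≤ = +-nonneg (*-nonneg (ℚ.nonNegative⁻¹ (⌜ 6 ⌝)) (²-nonneg a)) (*-nonneg (ℚ.nonNegative⁻¹ (⌜ 8 ⌝)) (²-nonneg c))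
    eq = solve 2 (λ a c →
      con (ℤ.+ 4) :* ((con ℤ.-1ℤ :* a :+ c) :* (con ℤ.-1ℤ :* a :+ c)) :+
      con (ℤ.+ 4) :* ((con (ℤ.+ 1) :* a :+ c) :* (con (ℤ.+ 1) :* a :+ c)) :=
      (con (ℤ.+ 6) :* (a :* a) :+ con (ℤ.+ 8) :* (c :* c)) :+ (a :* a :+ a :* a)) refl a c

  ^-distribʳ-* : ∀ n a b → (a ℕ.* b) ℕ.^ n ≡ a ℕ.^ n ℕ.* b ℕ.^ n
  ^-distribʳ-* zero    a b = refl
  ^-distribʳ-* (suc n) a b = trans (cong (a ℕ.* b ℕ.*_) (^-distribʳ-* n a b))
    (solveℕ 4 (λ a b x y → a ⊠ b ⊠ (x ⊠ y) ≜ a ⊠ x ⊠ (b ⊠ y)) refl a b (a ℕ.^ n) (b ℕ.^ n))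

  -- The head is summed innermost, for a fixed tail, because the test on the head depends on the
  -- tail.
  ∑³ : ∀ k → (Vec Trit k → ℕ) → ℕ
  ∑³ zero    f = f []
  ∑³ (suc k) f = ∑³ k (λ xs → f (neg ∷ xs) ℕ.+ f (nul ∷ xs) ℕ.+ f (pos ∷ xs))

  ∑³-mono : ∀ k {f g} → (∀ xs → f xs ℕ.≤ g xs) → ∑³ k f ℕ.≤ ∑³ k g
  ∑³-mono zero    le = le []
  ∑³-mono (suc k) le = ∑³-mono k (λ xs → ℕ.+-mono-≤ (ℕ.+-mono-≤ (le _) (le _)) (le _))

  ∑³-+ : ∀ k f g → ∑³ k (λ xs → f xs ℕ.+ g xs) ≡ ∑³ k f ℕ.+ ∑³ k g
  ∑³-+ zero    f g = refl
  ∑³-+ (suc k) f g = trans (∑³-cong k _ _ (λ xs → lemma (f (neg ∷ xs)) (g (neg ∷ xs))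
      (f (nul ∷ xs)) (g (nul ∷ xs)) (f (pos ∷ xs)) (g (pos ∷ xs)))) (∑³-+ k _ _)
    where
    lemma : ∀ a b c d e f → (a ℕ.+ b) ℕ.+ (c ℕ.+ d) ℕ.+ (e ℕ.+ f) ≡ (a ℕ.+ c ℕ.+ e) ℕ.+ (b ℕ.+ d ℕ.+ f)
    lemma = solveℕ 6 (λ a b c d e f → (a ⊞ b) ⊞ (c ⊞ d) ⊞ (e ⊞ f) ≜ (a ⊞ c ⊞ e) ⊞ (b ⊞ d ⊞ f)) refl
    ∑³-cong : ∀ k f g → (∀ xs → f xs ≡ g xs) → ∑³ k f ≡ ∑³ k g
    ∑³-cong zero    f g eq = eq []
    ∑³-cong (suc k) f g eq = ∑³-cong k _ _ (λ xs → cong₂ ℕ._+_ (cong₂ ℕ._+_ (eq _) (eq _)) (eq _))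

  ∑³-*ˡ : ∀ k c f → ∑³ k (λ xs → c ℕ.* f xs) ℕ.≤ c ℕ.* ∑³ k f
  ∑³-*ˡ zero    c f = ℕ.≤-refl
  ∑³-*ˡ (suc k) c f = ℕ.≤-trans (∑³-mono k (λ xs → ℕ.≤-reflexive (lemma c (f (neg ∷ xs)) (f (nul ∷ xs)) (f (pos ∷ xs))))) (∑³-*ˡ k c _)
    where
    lemma : ∀ c x y z → c ℕ.* x ℕ.+ c ℕ.* y ℕ.+ c ℕ.* z ≡ c ℕ.* (x ℕ.+ y ℕ.+ z)
    lemma = solveℕ 4 (λ c x y z → c ⊠ x ⊞ c ⊠ y ⊞ c ⊠ z ≜ c ⊠ (x ⊞ y ⊞ z)) refl

  ∑ˢ : ∀ k → (Subset k → ℕ) → ℕ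
  ∑ˢ zero    f = f []
  ∑ˢ (suc k) f = ∑ˢ k (λ J → f (outside ∷ J)) ℕ.+ ∑ˢ k (λ J → f (inside ∷ J))

  ∑ˢ-bound : ∀ k c {f} → (∀ J → c ℕ.≤ f J) → 2 ℕ.^ k ℕ.* c ℕ.≤ ∑ˢ k f
  ∑ˢ-bound zero    c {f} le = subst (ℕ._≤ f []) (sym (ℕ.*-identityˡ c)) (le [])
  ∑ˢ-bound (suc k) c {f} le = subst (ℕ._≤ ∑ˢ (suc k) f)
    (solveℕ 2 (λ p c → p ⊠ c ⊞ p ⊠ c ≜ (p ⊞ (p ⊞ conℕ 0)) ⊠ c) refl (2 ℕ.^ k) c)
    (ℕ.+-mono-≤ (∑ˢ-bound k c (λ _ → le _)) (∑ˢ-bound k c (λ _ → le _)))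

  size : ∀ {k} → Subset k → ℕ
  size []            = 0
  size (outside ∷ J) = size J
  size (inside  ∷ J) = suc (size J)

  size≤ : ∀ {k} (J : Subset k) → size J ℕ.≤ k
  size≤ []            = ℕ.z≤n
  size≤ (outside ∷ J) = ℕ.m≤n⇒m≤1+n (size≤ J)
  size≤ (inside  ∷ J) = ℕ.s≤s (size≤ J)

  trit : Sign → Trit
  trit Sign.+ = pos
  trit Sign.- = neg

  extend : ∀ {k} (J : Subset k) → (Fin (size J) → Sign) → Vec Trit k
  extend []            x = []
  extend (outside ∷ J) x = nul ∷ extend J x
  extend (inside  ∷ J) x = trit (x zero) ∷ extend J (x ∘ suc)

  -- Colourings of different subsets extend to different vectors.
  ∑ˢ≤∑³ : ∀ k (f : Vec Trit k → ℕ) (x : ∀ J → Fin (size J) → Sign) →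
          ∑ˢ k (λ J → f (extend J (x J))) ℕ.≤ ∑³ k f
  ∑ˢ≤∑³ zero    f x = ℕ.≤-refl
  ∑ˢ≤∑³ (suc k) f x = begin
    ∑ˢ k (λ J → f (nul ∷ extend J (x (outside ∷ J)))) ℕ.+
      ∑ˢ k (λ J → f (trit (x (inside ∷ J) zero) ∷ extend J (x (inside ∷ J) ∘ suc)))
        ≤⟨ ℕ.+-mono-≤ (∑ˢ≤∑³ k (λ xs → f (nul ∷ xs)) (λ J → x (outside ∷ J)))
             (ℕ.≤-trans (∑ˢ-mono k (λ J → ≤-either (x (inside ∷ J) zero) _))
               (∑ˢ≤∑³ k (λ xs → f (neg ∷ xs) ℕ.+ f (pos ∷ xs)) (λ J → x (inside ∷ J) ∘ suc))) ⟩
    ∑³ k (λ xs → f (nul ∷ xs)) ℕ.+ ∑³ k (λ xs → f (neg ∷ xs) ℕ.+ f (pos ∷ xs))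
        ≡⟨ ∑³-+ k _ _ ⟨
    ∑³ k (λ xs → f (nul ∷ xs) ℕ.+ (f (neg ∷ xs) ℕ.+ f (pos ∷ xs)))
        ≤⟨ ∑³-mono k (λ xs → ℕ.≤-reflexive (trans (sym (ℕ.+-assoc (f (nul ∷ xs)) _ _))
             (cong (ℕ._+ f (pos ∷ xs)) (ℕ.+-comm (f (nul ∷ xs)) _)))) ⟩
    ∑³ (suc k) f ∎
    where
    open ℕ.≤-Reasoning
    ≤-either : ∀ s xs → f (trit s ∷ xs) ℕ.≤ f (neg ∷ xs) ℕ.+ f (pos ∷ xs)
    ≤-either Sign.+ xs = ℕ.m≤n+m _ _
    ≤-either Sign.- xs = ℕ.m≤m+n _ _
    ∑ˢ-mono : ∀ k {f g} → (∀ J → f J ℕ.≤ g J) → ∑ˢ k f ℕ.≤ ∑ˢ k g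
    ∑ˢ-mono zero    le = le []
    ∑ˢ-mono (suc k) le = ℕ.+-mono-≤ (∑ˢ-mono k (λ _ → le _)) (∑ˢ-mono k (λ _ → le _))

  -- Applied to 10⁵ < 2⁵ · 8⁴. The exponent is a successor because the zeroth power would not be
  -- strict.
  power-< : ∀ a b c n → c ℕ.^ 5 ℕ.< a ℕ.^ 5 ℕ.* b ℕ.^ 4 →
            c ℕ.^ (suc n ℕ.* 5) ℕ.< a ℕ.^ (suc n ℕ.* 5) ℕ.* b ℕ.^ (suc n ℕ.* 4)
  power-< a b c n lt = subst₂ ℕ._<_ (power c 5)
    (trans (^-distribʳ-* (suc n) (a ℕ.^ 5) (b ℕ.^ 4)) (cong₂ ℕ._*_ (power a 5) (power b 4)))
    (ℕ.^-monoˡ-< (suc n) lt)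
    where
    power : ∀ a k → (a ℕ.^ k) ℕ.^ suc n ≡ a ℕ.^ (suc n ℕ.* k)
    power a k = trans (ℕ.^-*-assoc a k (suc n)) (cong (a ℕ.^_) (ℕ.*-comm k (suc n)))

  power-split : ∀ a .{{_ : ℕ.NonZero a}} n b → b ℕ.≤ suc n →
                a ℕ.^ (suc n ℕ.* 4) ℕ.* a ℕ.^ b ℕ.≤ a ℕ.^ (suc n ℕ.* 5)
  power-split a n b b≤ = begin
    a ℕ.^ (suc n ℕ.* 4) ℕ.* a ℕ.^ b ≡⟨ ℕ.^-distribˡ-+-* a (suc n ℕ.* 4) b ⟨
    a ℕ.^ (suc n ℕ.* 4 ℕ.+ b)       ≤⟨ ℕ.^-monoʳ-≤ a (ℕ.+-monoʳ-≤ (suc n ℕ.* 4) b≤) ⟩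
    a ℕ.^ (suc n ℕ.* 4 ℕ.+ suc n)
      ≡⟨ cong (a ℕ.^_) (trans (ℕ.+-comm (suc n ℕ.* 4) (suc n)) (sym (ℕ.*-suc (suc n) 4))) ⟩
    a ℕ.^ (suc n ℕ.* 5)             ∎
    where open ℕ.≤-Reasoning

  Distinct : ∀ {A : Set} {k} → Vec A k → Set
  Distinct []       = ⊤
  Distinct (p ∷ ps) = ¬ (p ∈ᵛ ps) × Distinct ps

  -- Gram-Schmidt coordinates and greedy selection

  module Selection {A B : Set} (rs : List B) where

    Family : Set
    Family = A → B → ℚ

    ⟨_,_⟩ : (B → ℚ) → (B → ℚ) → ℚ
    ⟨ f , g ⟩ = ∑[ r ∈ rs ] (f r * g r)

    ⟨⟩-comm : ∀ f g → ⟨ f , g ⟩ ≡ ⟨ g , f ⟩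
    ⟨⟩-comm f g = ∑-cong rs (λ r → *-comm (f r) (g r))

    ⟨⟩-linear : ∀ f c g h → ⟨ (λ r → c * f r + g r) , h ⟩ ≡ c * ⟨ f , h ⟩ + ⟨ g , h ⟩
    ⟨⟩-linear f c g h = trans (∑-cong rs (λ r →
        solve 4 (λ c f g h → (c :* f :+ g) :* h := c :* (f :* h) :+ g :* h) refl c (f r) (g r) (h r)))
      (trans (∑-+ rs _ _) (cong (_+ ⟨ g , h ⟩) (∑-*ˡ rs c _)))

    residue : (B → ℚ) → (B → ℚ) → B → ℚ
    residue u w r = - (⟨ w , u ⟩ * inv ⟨ u , u ⟩) * u r + w r

    -- Both sides are ⟨w, z⟩ minus ⟨w, u⟩ ⟨u, z⟩ / ⟨u, u⟩, which is symmetric in w and z. This moves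
    -- a projection from the family to the test vector.
    residue-adjoint : ∀ u w z → ⟨ residue u w , z ⟩ ≡ ⟨ w , residue u z ⟩
    residue-adjoint u w z = begin
      ⟨ residue u w , z ⟩                                         ≡⟨ ⟨⟩-linear u _ w z ⟩
      - (⟨ w , u ⟩ * inv ⟨ u , u ⟩) * ⟨ u , z ⟩ + ⟨ w , z ⟩
        ≡⟨ cong₂ _+_ (cong (- (⟨ w , u ⟩ * inv ⟨ u , u ⟩) *_) (⟨⟩-comm u z)) (⟨⟩-comm w z) ⟩
      - (⟨ w , u ⟩ * inv ⟨ u , u ⟩) * ⟨ z , u ⟩ + ⟨ z , w ⟩
        ≡⟨ solve 4 (λ a b i z → :- (a :* i) :* b :+ z := :- (b :* i) :* a :+ z) refl ⟨ w , u ⟩ ⟨ z , u ⟩ (inv ⟨ u , u ⟩) ⟨ z , w ⟩ ⟩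
      - (⟨ z , u ⟩ * inv ⟨ u , u ⟩) * ⟨ w , u ⟩ + ⟨ z , w ⟩
        ≡⟨ cong (λ c → - (⟨ z , u ⟩ * inv ⟨ u , u ⟩) * c + ⟨ z , w ⟩) (⟨⟩-comm w u) ⟩
      - (⟨ z , u ⟩ * inv ⟨ u , u ⟩) * ⟨ u , w ⟩ + ⟨ z , w ⟩       ≡⟨ ⟨⟩-linear u _ z w ⟨
      ⟨ residue u z , w ⟩                                         ≡⟨ ⟨⟩-comm _ w ⟩
      ⟨ w , residue u z ⟩ ∎
      where open ≡-Reasoning

    pythagoras : ∀ u w → 0ℚ < ⟨ u , u ⟩ →
                 ⟨ w , w ⟩ ≡ ⟨ w , u ⟩ ² * inv ⟨ u , u ⟩ + ⟨ residue u w , residue u w ⟩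
    pythagoras u w 0<u = sym (begin
      ⟨ w , u ⟩ ² * i + ⟨ residue u w , residue u w ⟩
        ≡⟨ cong (⟨ w , u ⟩ ² * i +_) (begin
          ⟨ residue u w , residue u w ⟩
            ≡⟨ ⟨⟩-linear u _ w _ ⟩
          - (c * i) * ⟨ u , residue u w ⟩ + ⟨ w , residue u w ⟩
            ≡⟨ cong₂ (λ x y → - (c * i) * x + y) (trans (⟨⟩-comm u _) (⟨⟩-linear u _ w u)) (trans (⟨⟩-comm w _) (⟨⟩-linear u _ w w)) ⟩
          - (c * i) * (- (c * i) * a + c) + (- (c * i) * ⟨ u , w ⟩ + ⟨ w , w ⟩)
            ≡⟨ cong (λ x → - (c * i) * (- (c * i) * a + c) + (- (c * i) * x + ⟨ w , w ⟩)) (⟨⟩-comm u w) ⟩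
          - (c * i) * (- (c * i) * a + c) + (- (c * i) * c + ⟨ w , w ⟩)
            ≡⟨ solve 4 (λ a c i n → :- (c :* i) :* (:- (c :* i) :* a :+ c) :+ (:- (c :* i) :* c :+ n)
                 := c :* c :* i :* (a :* i) :- c :* c :* i :- c :* c :* i :+ n) refl a c i ⟨ w , w ⟩ ⟩
          c * c * i * (a * i) - c * c * i - c * c * i + ⟨ w , w ⟩
            ≡⟨ cong (λ x → c * c * i * x - c * c * i - c * c * i + ⟨ w , w ⟩) (inv-right 0<u) ⟩
          c * c * i * 1ℚ - c * c * i - c * c * i + ⟨ w , w ⟩ ∎) ⟩
      c * c * i + (c * c * i * 1ℚ - c * c * i - c * c * i + ⟨ w , w ⟩)
        ≡⟨ solve 2 (λ x n → x :+ (x :* con (ℤ.+ 1) :- x :- x :+ n) := n) refl (c * c * i) ⟨ w , w ⟩ ⟩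
      ⟨ w , w ⟩ ∎)
      where
      open ≡-Reasoning
      a = ⟨ u , u ⟩
      c = ⟨ w , u ⟩
      i = inv ⟨ u , u ⟩

    project : Family → A → Family
    project v p q = residue (v p) (v q)

    -- Since the whole family is projected after each choice, `⟨ v p , v p ⟩` is the squared
    -- distance of the original vector of `p` from the span of the vectors chosen before; no
    -- Gram-Schmidt basis has to be stored.
    Separated : ℚ → Family → ∀ {k} → Vec A k → Set
    Separated s v []       = ⊤
    Separated s v (p ∷ ps) = s ≤ ⟨ v p , v p ⟩ × Separated s (project v p) ps

    combination : Family → ∀ {k} → Vec A k → Vec Trit k → B → ℚ
    combination v []       []       r = 0ℚ
    combination v (p ∷ ps) (x ∷ xs) r = tri x * v p r + combination v ps xs r

    combination-residue : ∀ v u {k} (ps : Vec A k) xs r →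
      combination (λ q → residue u (v q)) ps xs r ≡ residue u (combination v ps xs) r
    combination-residue v u [] [] r = begin
      0ℚ                               ≡⟨ solve 2 (λ i u → con (ℤ.+ 0) := :- (con (ℤ.+ 0) :* i) :* u :+ con (ℤ.+ 0)) refl i (u r) ⟩
      - (0ℚ * i) * u r + 0ℚ            ≡⟨ cong (λ x → - (x * i) * u r + 0ℚ) (trans (∑-cong rs (λ r → zeroˡ (u r))) (∑-zero rs)) ⟨
      residue u (combination v [] []) r ∎
      where
      open ≡-Reasoning
      i = inv ⟨ u , u ⟩
    combination-residue v u (p ∷ ps) (x ∷ xs) r = begin
      tri x * residue u (v p) r + combination (λ q → residue u (v q)) ps xs r
        ≡⟨ cong (tri x * residue u (v p) r +_) (combination-residue v u ps xs r) ⟩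
      tri x * (- (⟨ v p , u ⟩ * i) * u r + v p r) + (- (⟨ S , u ⟩ * i) * u r + S r)
        ≡⟨ solve 7 (λ x a b i u v s → x :* (:- (a :* i) :* u :+ v) :+ (:- (b :* i) :* u :+ s)
             := :- ((x :* a :+ b) :* i) :* u :+ (x :* v :+ s)) refl (tri x) ⟨ v p , u ⟩ ⟨ S , u ⟩ i (u r) (v p r) (S r) ⟩
      - ((tri x * ⟨ v p , u ⟩ + ⟨ S , u ⟩) * i) * u r + (tri x * v p r + S r)
        ≡⟨ cong (λ y → - (y * i) * u r + (tri x * v p r + S r)) (⟨⟩-linear (v p) (tri x) S u) ⟨
      residue u (combination v (p ∷ ps) (x ∷ xs)) r ∎
      where
      open ≡-Reasoning
      i = inv ⟨ u , u ⟩
      S = combination v ps xs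

    residue-self : ∀ u → 0ℚ < ⟨ u , u ⟩ → ∀ c w r → residue u (λ r → c * u r + w r) r ≡ residue u w r
    residue-self u 0<u c w r = begin
      - (⟨ (λ r → c * u r + w r) , u ⟩ * i) * u r + (c * u r + w r)
        ≡⟨ cong (λ y → - (y * i) * u r + (c * u r + w r)) (⟨⟩-linear u c w u) ⟩
      - ((c * ⟨ u , u ⟩ + ⟨ w , u ⟩) * i) * u r + (c * u r + w r)
        ≡⟨ solve 6 (λ c a b i u w → :- ((c :* a :+ b) :* i) :* u :+ (c :* u :+ w)
             := :- (c :* (a :* i)) :* u :+ c :* u :+ (:- (b :* i) :* u :+ w)) refl c ⟨ u , u ⟩ ⟨ w , u ⟩ i (u r) (w r) ⟩
      - (c * (⟨ u , u ⟩ * i)) * u r + c * u r + residue u w r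
        ≡⟨ cong (λ y → - (c * y) * u r + c * u r + residue u w r) (inv-right 0<u) ⟩
      - (c * 1ℚ) * u r + c * u r + residue u w r
        ≡⟨ solve 3 (λ c u z → :- (c :* con (ℤ.+ 1)) :* u :+ c :* u :+ z := z) refl c (u r) (residue u w r) ⟩
      residue u w r ∎
      where
      open ≡-Reasoning
      i = inv ⟨ u , u ⟩

    -- The coordinate of S_x along `v p` is `tri x` times `⟨ v p , v p ⟩` plus an offset from the
    -- later entries only, the earlier vectors being orthogonal to `v p`. A high `badness` means
    -- many large coordinates, hence a large S_x.
    badness weight : Family → ∀ {k} → Vec A k → Vec Trit k → ℕ
    badness v []       []       = 0
    badness v (p ∷ ps) (x ∷ xs) =
      penalty ⟨ v p , v p ⟩ ⟨ combination v ps xs , v p ⟩ x ℕ.+ badness (project v p) ps xs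
    weight v []       []       = 1
    weight v (p ∷ ps) (x ∷ xs) =
      weight₁ ⟨ v p , v p ⟩ ⟨ combination v ps xs , v p ⟩ x ℕ.* weight (project v p) ps xs

    weight-badness : ∀ v {k} (ps : Vec A k) xs → weight v ps xs ℕ.* 8 ℕ.^ badness v ps xs ≡ 8 ℕ.^ k
    weight-badness v []       []       = refl
    weight-badness v (p ∷ ps) (x ∷ xs)
      with large? ⟨ v p , v p ⟩ ⟨ combination v ps xs , v p ⟩ x
    ... | yes _ = trans
      (solveℕ 2 (λ w b → (w ⊞ conℕ 0) ⊠ (conℕ 8 ⊠ b) ≜ conℕ 8 ⊠ (w ⊠ b)) refl (weight (project v p) ps xs) _)
      (cong (8 ℕ.*_) (weight-badness (project v p) ps xs))
    ... | no  _ = trans (ℕ.*-assoc 8 (weight (project v p) ps xs) _) (cong (8 ℕ.*_) (weight-badness (project v p) ps xs))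

    -- For a fixed tail the remaining weight does not depend on the head, and the three head weights
    -- add up to at most 10.
    ∑-weight : ∀ v {k} (ps : Vec A k) → ∑³ k (weight v ps) ℕ.≤ 10 ℕ.^ k
    ∑-weight v []               = ℕ.≤-refl
    ∑-weight v {suc k} (p ∷ ps) = begin
      ∑³ (suc k) (weight v (p ∷ ps))
        ≤⟨ ∑³-mono k (λ xs → let c = ⟨ combination v ps xs , v p ⟩ ; W = weight (project v p) ps xs in begin
             weight₁ a c neg ℕ.* W ℕ.+ weight₁ a c nul ℕ.* W ℕ.+ weight₁ a c pos ℕ.* W
               ≡⟨ trans (cong (ℕ._+ weight₁ a c pos ℕ.* W) (sym (ℕ.*-distribʳ-+ W (weight₁ a c neg) _)))
                   (sym (ℕ.*-distribʳ-+ W (weight₁ a c neg ℕ.+ weight₁ a c nul) _)) ⟩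
             (weight₁ a c neg ℕ.+ weight₁ a c nul ℕ.+ weight₁ a c pos) ℕ.* W
               ≤⟨ ℕ.*-monoˡ-≤ W (weight₁-sum a c) ⟩
             10 ℕ.* W ∎) ⟩
      ∑³ k (λ xs → 10 ℕ.* weight (project v p) ps xs) ≤⟨ ∑³-*ˡ k 10 _ ⟩
      10 ℕ.* ∑³ k (weight (project v p) ps)           ≤⟨ ℕ.*-monoʳ-≤ 10 (∑-weight (project v p) ps) ⟩
      10 ℕ.^ suc k                                    ∎
      where
      open ℕ.≤-Reasoning
      a = ⟨ v p , v p ⟩

    -- By Pythagoras, |S_x|² is the squared coordinate along `v p` plus the squared norm for the
    -- projected family. With a = `⟨ v p , v p ⟩`, a large coordinate contributes at least a/4,
    -- hence at least s/4.
    badness-bound : ∀ {s} → 0ℚ < s → ∀ v {k} (ps : Vec A k) → Separated s v ps → ∀ xs →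
      s * ⌜ badness v ps xs ⌝ ≤ ⌜ 4 ⌝ * ⟨ combination v ps xs , combination v ps xs ⟩
    badness-bound {s} 0<s v [] _ [] = subst (_≤ ⌜ 4 ⌝ * _) (sym (zeroʳ s))
      (*-nonneg (ℚ.nonNegative⁻¹ (⌜ 4 ⌝)) (∑-nonneg rs (λ _ → ²-nonneg _)))
    badness-bound {s} 0<s v (p ∷ ps) (s≤ , sep) (x ∷ xs) = begin
      s * ⌜ pen ℕ.+ bad ⌝
        ≡⟨ cong (s *_) (⌜⌝-+ pen bad) ⟩
      s * (⌜ pen ⌝ + ⌜ bad ⌝)
        ≡⟨ distribˡ s _ _ ⟩
      s * ⌜ pen ⌝ + s * ⌜ bad ⌝
        ≤⟨ +-mono-≤ penalty-bound (badness-bound 0<s (project v p) ps sep xs) ⟩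
      ⌜ 4 ⌝ * (⟨ S⁺ , u ⟩ ² * inv a) + ⌜ 4 ⌝ * ⟨ S′ , S′ ⟩
        ≡⟨ distribˡ (⌜ 4 ⌝) _ _ ⟨
      ⌜ 4 ⌝ * (⟨ S⁺ , u ⟩ ² * inv a + ⟨ S′ , S′ ⟩)
        ≡⟨ cong (λ y → ⌜ 4 ⌝ * (⟨ S⁺ , u ⟩ ² * inv a + y)) (∑-cong rs (λ r → cong₂ _*_ (same r) (same r))) ⟩
      ⌜ 4 ⌝ * (⟨ S⁺ , u ⟩ ² * inv a + ⟨ residue u S⁺ , residue u S⁺ ⟩)
        ≡⟨ cong (⌜ 4 ⌝ *_) (pythagoras u S⁺ 0<a) ⟨
      ⌜ 4 ⌝ * ⟨ S⁺ , S⁺ ⟩ ∎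
      where
      open ≤R
      u = v p
      a = ⟨ u , u ⟩
      S = combination v ps xs
      S⁺ = combination v (p ∷ ps) (x ∷ xs)
      S′ = combination (project v p) ps xs
      pen = penalty a ⟨ S , u ⟩ x
      bad = badness (project v p) ps xs
      0<a : 0ℚ < a
      0<a = ℚ.<-≤-trans 0<s s≤
      same : ∀ r → S′ r ≡ residue u S⁺ r
      same r = trans (combination-residue v u ps xs r) (sym (residue-self u 0<a (tri x) S r))
      penalty-bound : s * ⌜ pen ⌝ ≤ ⌜ 4 ⌝ * (⟨ S⁺ , u ⟩ ² * inv a)
      penalty-bound with large? a ⟨ S , u ⟩ x
      ... | yes large = begin
        s * 1ℚ             ≡⟨ *-identityʳ s ⟩
        s                  ≤⟨ s≤ ⟩
        a                  ≡⟨ *-identityʳ a ⟨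
        a * 1ℚ             ≡⟨ cong (a *_) (inv-right 0<a) ⟨
        a * (a * inv a)    ≡⟨ *-assoc a a (inv a) ⟨
        a ² * inv a        ≤⟨ *-monoˡ-≤ (inv-nonneg 0<a) large ⟩
        ⌜ 4 ⌝ * (tri x * a + ⟨ S , u ⟩) ² * inv a
          ≡⟨ cong (λ y → ⌜ 4 ⌝ * y ² * inv a) (⟨⟩-linear u (tri x) S u) ⟨
        ⌜ 4 ⌝ * ⟨ S⁺ , u ⟩ ² * inv a
          ≡⟨ *-assoc (⌜ 4 ⌝) _ _ ⟩
        ⌜ 4 ⌝ * (⟨ S⁺ , u ⟩ ² * inv a) ∎
      ... | no  _     = subst (_≤ ⌜ 4 ⌝ * (⟨ S⁺ , u ⟩ ² * inv a)) (sym (zeroʳ s))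
        (*-nonneg (ℚ.nonNegative⁻¹ (⌜ 4 ⌝)) (*-nonneg (²-nonneg _) (inv-nonneg 0<a)))

    -- With k = 5 (ℓ + 1), if every J had at most k/5 large coordinates, 2ᵏ different vectors would
    -- weigh at least 8^(4k/5) each. The total (2⁵ · 8⁴)^(k/5) exceeds the 10ᵏ allowed by
    -- `∑-weight`.
    some-bad : ∀ v ℓ (ps : Vec A (suc ℓ ℕ.* 5)) (x : ∀ J → Fin (size J) → Sign) →
               ¬ (∀ J → badness v ps (extend J (x J)) ℕ.≤ suc ℓ)
    some-bad v ℓ ps x le = ℕ.<⇒≱ (power-< 2 8 10 ℓ (ℕ.<ᵇ⇒< (10 ℕ.^ 5) (2 ℕ.^ 5 ℕ.* 8 ℕ.^ 4) tt))
      (ℕ.≤-trans (∑ˢ-bound k _ (λ J → heavy (extend J (x J)) (le J)))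
        (ℕ.≤-trans (∑ˢ≤∑³ k (weight v ps) x) (∑-weight v ps)))
      where
      open ℕ.≤-Reasoning
      k = suc ℓ ℕ.* 5
      heavy : ∀ xs → badness v ps xs ℕ.≤ suc ℓ → 8 ℕ.^ (suc ℓ ℕ.* 4) ℕ.≤ weight v ps xs
      heavy xs b≤ = ℕ.*-cancelʳ-≤ _ _ (8 ℕ.^ badness v ps xs) {{ℕ.m^n≢0 8 (badness v ps xs)}}
        (ℕ.≤-trans (power-split 8 ℓ (badness v ps xs) b≤) (ℕ.≤-reflexive (sym (weight-badness v ps xs))))

    Null : Family → A → Set
    Null v q = ∀ r → v q r ≡ 0ℚ

    null-project : ∀ v p q → Null v q → Null (project v p) q
    null-project v p q null r = begin
      - (⟨ v q , v p ⟩ * i) * v p r + v q r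
        ≡⟨ cong₂ (λ x y → - (x * i) * v p r + y)
             (trans (∑-cong rs (λ r → trans (cong (_* v p r) (null r)) (zeroˡ _))) (∑-zero rs)) (null r) ⟩
      - (0ℚ * i) * v p r + 0ℚ
        ≡⟨ solve 2 (λ i u → :- (con (ℤ.+ 0) :* i) :* u :+ con (ℤ.+ 0) := con (ℤ.+ 0)) refl i (v p r) ⟩
      0ℚ ∎
      where
      open ≡-Reasoning
      i = inv ⟨ v p , v p ⟩

    null-self : ∀ v p → 0ℚ < ⟨ v p , v p ⟩ → Null (project v p) p
    null-self v p 0<a r = begin
      - (⟨ v p , v p ⟩ * inv ⟨ v p , v p ⟩) * v p r + v p r
        ≡⟨ cong (λ y → - y * v p r + v p r) (inv-right 0<a) ⟩
      - 1ℚ * v p r + v p r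
        ≡⟨ solve 1 (λ u → :- con (ℤ.+ 1) :* u :+ u := con (ℤ.+ 0)) refl (v p r) ⟩
      0ℚ ∎
      where open ≡-Reasoning

    null-∉ : ∀ {s} → 0ℚ < s → ∀ v {k} (ps : Vec A k) → Separated s v ps → ∀ q → Null v q → ¬ (q ∈ᵛ ps)
    null-∉ 0<s v (p ∷ ps) (s≤ , sep) q null (here refl) = ℚ.<-irrefl refl
      (ℚ.<-≤-trans 0<s (subst (_ ≤_)
        (trans (∑-cong rs (λ r → trans (cong (_* v q r) (null r)) (zeroˡ _))) (∑-zero rs)) s≤))
    null-∉ 0<s v (p ∷ ps) (s≤ , sep) q null (there q∈) =
      null-∉ 0<s (project v p) ps sep q (null-project v p q null) q∈

    -- A chosen point is projected to the zero vector, which later projections keep zero, so it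
    -- cannot reach the positive threshold `s` again.
    separated-distinct : ∀ {s} → 0ℚ < s → ∀ v {k} (ps : Vec A k) → Separated s v ps → Distinct ps
    separated-distinct 0<s v []       _          = tt
    separated-distinct 0<s v (p ∷ ps) (s≤ , sep) =
      null-∉ 0<s (project v p) ps sep p (null-self v p (ℚ.<-≤-trans 0<s s≤)) ,
      separated-distinct 0<s (project v p) ps sep

    module Step (pts : List A) (c : ℚ) (0≤c : 0ℚ ≤ c) (v : Family)
      (bessel : ∀ w → ∑[ p ∈ pts ] ⟨ v p , w ⟩ ² ≤ c * ⟨ w , w ⟩)
      (p : A) (0<a : 0ℚ < ⟨ v p , v p ⟩) where
      open ≤R
      u : B → ℚ
      u = v p

      a : ℚ
      a = ⟨ u , u ⟩

      -- By adjointness the projection acts on `w` instead, and it does not increase the norm of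
      -- `w`; so the constant `c` survives.
      bessel′ : ∀ w → ∑[ q ∈ pts ] ⟨ project v p q , w ⟩ ² ≤ c * ⟨ w , w ⟩
      bessel′ w = begin
        ∑[ q ∈ pts ] ⟨ project v p q , w ⟩ ²
          ≡⟨ ∑-cong pts (λ q → cong _² (residue-adjoint u (v q) w)) ⟩
        ∑[ q ∈ pts ] ⟨ v q , residue u w ⟩ ²
          ≤⟨ bessel (residue u w) ⟩
        c * ⟨ residue u w , residue u w ⟩
          ≤⟨ *-monoʳ-≤ 0≤c (p≤q+p (*-nonneg (²-nonneg _) (inv-nonneg 0<a))) ⟩
        c * (⟨ w , u ⟩ ² * inv a + ⟨ residue u w , residue u w ⟩)
          ≡⟨ cong (c *_) (pythagoras u w 0<a) ⟨
        c * ⟨ w , w ⟩ ∎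

      lost : ℚ
      lost = ∑[ q ∈ pts ] (⟨ v q , u ⟩ ² * inv a)

      -- Bessel's inequality tested at `w = u`, divided by the squared norm of `u`.
      lost≤c : lost ≤ c
      lost≤c = begin
        lost                                  ≡⟨ ∑-*ʳ pts _ (inv a) ⟩
        ∑[ q ∈ pts ] ⟨ v q , u ⟩ ² * inv a    ≤⟨ *-monoˡ-≤ (inv-nonneg 0<a) (bessel u) ⟩
        c * a * inv a                         ≡⟨ *-assoc c a (inv a) ⟩
        c * (a * inv a)                       ≡⟨ cong (c *_) (inv-right 0<a) ⟩
        c * 1ℚ                                ≡⟨ *-identityʳ c ⟩
        c                                     ∎

      trace′ : ∀ n k → n + ⌜ suc k ⌝ * c < ∑[ q ∈ pts ] ⟨ v q , v q ⟩ →
               n + ⌜ k ⌝ * c < ∑[ q ∈ pts ] ⟨ project v p q , project v p q ⟩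
      trace′ n k trace = begin-strict
        n + ⌜ k ⌝ * c
          ≡⟨ solve 3 (λ n k c → n :+ k :* c := n :+ (con (ℤ.+ 1) :+ k) :* c :- c) refl n ⌜ k ⌝ c ⟩
        n + (1ℚ + ⌜ k ⌝) * c - c
          ≡⟨ cong (λ y → n + y * c - c) (⌜⌝-+ 1 k) ⟨
        n + ⌜ suc k ⌝ * c - c
          <⟨ +-mono-<-≤ trace (ℚ.≤-refl { - c}) ⟩
        ∑[ q ∈ pts ] ⟨ v q , v q ⟩ - c
          ≤⟨ +-monoʳ-≤ (∑[ q ∈ pts ] ⟨ v q , v q ⟩) (neg-antimono-≤ lost≤c) ⟩
        ∑[ q ∈ pts ] ⟨ v q , v q ⟩ - lost
          ≡⟨ cong (_- lost) (trans
               (∑-cong pts (λ q → pythagoras u (v q) 0<a)) (∑-+ pts _ _)) ⟩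
        lost + ∑[ q ∈ pts ] ⟨ project v p q , project v p q ⟩ - lost
          ≡⟨ solve 2 (λ x y → x :+ y :- x := y) refl lost (∑[ q ∈ pts ] ⟨ project v p q , project v p q ⟩) ⟩
        ∑[ q ∈ pts ] ⟨ project v p q , project v p q ⟩ ∎

    -- The trace hypothesis budgets `c` for each of the `k` projections to come; what is left always
    -- exceeds `s` per point, so averaging yields the next choice.
    select : ∀ (pts : List A) c → 0ℚ ≤ c → ∀ {s} → 0ℚ < s → ∀ k v →
      (∀ w → ∑[ p ∈ pts ] ⟨ v p , w ⟩ ² ≤ c * ⟨ w , w ⟩) →
      s * card pts + ⌜ k ⌝ * c < ∑[ p ∈ pts ] ⟨ v p , v p ⟩ →
      ∃[ ps ] Separated s v {k} ps
    select pts c 0≤c 0<s zero    v bessel trace = [] , tt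
    select pts c 0≤c {s} 0<s (suc k) v bessel trace =
      let p , s≤ = large-term pts (λ p → ⟨ v p , v p ⟩) s (ℚ.≤-<-trans
             (subst (s * card pts ≤_) (+-comm (⌜ suc k ⌝ * c) _)
               (p≤q+p (*-nonneg 0≤⌜ suc k ⌝ 0≤c))) trace)
          module S = Step pts c 0≤c v bessel p (ℚ.<-≤-trans 0<s s≤)
          ps , sep = select pts c 0≤c 0<s k (project v p) S.bessel′ (S.trace′ (s * card pts) k trace)
      in p ∷ ps , s≤ , sep

  -- Tensor products of multiscale kernels

  pow : ℚ → ℕ → ℚ
  pow x zero    = 1ℚ
  pow x (suc n) = x * pow x n

  pow-+ : ∀ x m n → pow x (m ℕ.+ n) ≡ pow x m * pow x n
  pow-+ x zero    n = sym (*-identityˡ _)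
  pow-+ x (suc m) n = trans (cong (x *_) (pow-+ x m n)) (sym (*-assoc x _ _))

  pow-nonneg : ∀ {x} → 0ℚ ≤ x → ∀ n → 0ℚ ≤ pow x n
  pow-nonneg 0≤x zero    = 0≤⌜ 1 ⌝
  pow-nonneg 0≤x (suc n) = *-nonneg 0≤x (pow-nonneg 0≤x n)

  pow-* : ∀ x y n → pow (x * y) n ≡ pow x n * pow y n
  pow-* x y zero    = sym (*-identityˡ 1ℚ)
  pow-* x y (suc n) = trans (cong (x * y *_) (pow-* x y n))
    (solve 4 (λ x y p q → x :* y :* (p :* q) := x :* p :* (y :* q)) refl x y (pow x n) (pow y n))

  ¼ : ℚ
  ¼ = ℤ.+ 1 ℚ./ 4

  4*¼ : ⌜ 4 ⌝ * ¼ ≡ 1ℚ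
  4*¼ = trans (*≡ ⌜ 4 ⌝ ¼) refl

  -- Base-4 words, intervals and boxes

  Digit : Set
  Digit = Fin 4

  -- Opaque, so that sums over it do not unfold.
  opaque
    digits : List Digit
    digits = 0F ∷ 1F ∷ 2F ∷ 3F ∷ []

    ∑-digits : ∀ f → ∑ digits f ≡ f 0F + (f 1F + (f 2F + (f 3F + 0ℚ)))
    ∑-digits f = refl

  words : ∀ m → List (Vec Digit m)
  words zero    = [] ∷ []
  words (suc m) = pairs digits (λ _ → words m) _∷_

  ∑-words : ∀ m f → ∑ (words (suc m)) f ≡ ∑[ e ∈ digits ] ∑[ w ∈ words m ] f (e ∷ w)
  ∑-words m f = ∑-pairs digits (λ _ → words m) _∷_ f

  four : ℕ → ℚ
  four = pow ⌜ 4 ⌝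

  card-words : ∀ m → card (words m) ≡ four m
  card-words zero    = +-identityʳ 1ℚ
  card-words (suc m) = trans (∑-words m _) (trans
    (cong (λ n → ∑[ _ ∈ digits ] n) (card-words m)) (trans (∑-digits _)
    (solve 1 (λ n → n :+ (n :+ (n :+ (n :+ con (ℤ.+ 0)))) := con (ℤ.+ 4) :* n) refl (four m))))

  δ : Digit → Digit → ℚ
  δ e f with e Fin.≟ f
  ... | yes _ = 1ℚ
  ... | no  _ = 0ℚ

  ∑-δʳ : ∀ e (f : Digit → ℚ) → ∑[ i ∈ digits ] (δ e i * f i) ≡ f e
  ∑-δʳ 0F f = trans (∑-digits _)
    (solve 4 (λ a b c d → con (ℤ.+ 1) :* a :+ (con (ℤ.+ 0) :* b :+ (con (ℤ.+ 0) :* c :+ (con (ℤ.+ 0) :* d :+ con (ℤ.+ 0)))) := a) refl (f 0F) (f 1F) (f 2F) (f 3F))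
  ∑-δʳ 1F f = trans (∑-digits _)
    (solve 4 (λ a b c d → con (ℤ.+ 0) :* a :+ (con (ℤ.+ 1) :* b :+ (con (ℤ.+ 0) :* c :+ (con (ℤ.+ 0) :* d :+ con (ℤ.+ 0)))) := b) refl (f 0F) (f 1F) (f 2F) (f 3F))
  ∑-δʳ 2F f = trans (∑-digits _)
    (solve 4 (λ a b c d → con (ℤ.+ 0) :* a :+ (con (ℤ.+ 0) :* b :+ (con (ℤ.+ 1) :* c :+ (con (ℤ.+ 0) :* d :+ con (ℤ.+ 0)))) := c) refl (f 0F) (f 1F) (f 2F) (f 3F))
  ∑-δʳ 3F f = trans (∑-digits _)
    (solve 4 (λ a b c d → con (ℤ.+ 0) :* a :+ (con (ℤ.+ 0) :* b :+ (con (ℤ.+ 0) :* c :+ (con (ℤ.+ 1) :* d :+ con (ℤ.+ 0)))) := d) refl (f 0F) (f 1F) (f 2F) (f 3F))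

  δ-sym : ∀ e f → δ e f ≡ δ f e
  δ-sym e f with e Fin.≟ f | f Fin.≟ e
  ... | yes _    | yes _   = refl
  ... | no _     | no _    = refl
  ... | yes refl | no e≢e  = contradiction refl e≢e
  ... | no e≢e   | yes refl = contradiction refl e≢e

  ∑-δˡ : ∀ e (f : Digit → ℚ) → ∑[ i ∈ digits ] (δ i e * f i) ≡ f e
  ∑-δˡ e f = trans (∑-cong digits (λ i → cong (_* f i) (δ-sym i e))) (∑-δʳ e f)

  -- The words of length less than J, that is, the 4-adic intervals longer than 4^(-J). The index
  -- makes the missing depth, `codepth`, available to recursion; it is always positive.
  data Node : ℕ → Set where
    root  : ∀ {J} → Node (suc J)
    child : ∀ {J} → Digit → Node J → Node (suc J)

  nodes : ∀ J → List (Node J)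
  nodes zero    = []
  nodes (suc J) = root ∷ pairs digits (λ _ → nodes J) child

  path : ∀ {J} → Node J → List Digit
  path root        = []
  path (child e R) = e ∷ path R

  depth codepth : ∀ {J} → Node J → ℕ
  depth root            = 0
  depth (child e R)     = suc (depth R)
  codepth (root {J})    = suc J
  codepth (child e R)   = codepth R

  depth+codepth : ∀ {J} (R : Node J) → depth R ℕ.+ codepth R ≡ J
  depth+codepth root        = refl
  depth+codepth (child e R) = cong suc (depth+codepth R)

  length-path : ∀ {J} (R : Node J) → length (path R) ≡ depth R
  length-path root        = refl
  length-path (child e R) = cong suc (length-path R)

  -- Each of the J levels contributes 4ʲ nodes of value 4^(J - j). This counts the first sides of
  -- boxes, weighted by the freedom they leave to the other sides.
  ∑-codepth : ∀ J → ∑[ R ∈ nodes J ] four (codepth R) ≡ ⌜ J ⌝ * four J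
  ∑-codepth zero    = sym (zeroˡ _)
  ∑-codepth (suc J) = begin
    ⌜ 4 ⌝ * four J + ∑ (pairs digits (λ _ → nodes J) child) (four ∘ codepth)
      ≡⟨ cong (⌜ 4 ⌝ * four J +_) (∑-pairs digits (λ _ → nodes J) child _) ⟩
    ⌜ 4 ⌝ * four J + ∑[ e ∈ digits ] ∑[ R ∈ nodes J ] four (codepth R)
      ≡⟨ cong (λ n → ⌜ 4 ⌝ * four J + ∑[ e ∈ digits ] n) (∑-codepth J) ⟩
    ⌜ 4 ⌝ * four J + ∑[ e ∈ digits ] (⌜ J ⌝ * four J)
      ≡⟨ cong (⌜ 4 ⌝ * four J +_) (∑-digits _) ⟩
    _ ≡⟨ solve 2 (λ j p → con (ℤ.+ 4) :* p :+ (j :* p :+ (j :* p :+ (j :* p :+ (j :* p :+ con (ℤ.+ 0)))))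
           := (con (ℤ.+ 1) :+ j) :* (con (ℤ.+ 4) :* p)) refl ⌜ J ⌝ (four J) ⟩
    (1ℚ + ⌜ J ⌝) * four (suc J)
      ≡⟨ cong (_* four (suc J)) (⌜⌝-+ 1 J) ⟨
    ⌜ suc J ⌝ * four (suc J) ∎
    where open ≡-Reasoning

  grid : ∀ m d → List (Vec (Vec Digit m) d)
  grid m zero    = [] ∷ []
  grid m (suc d) = pairs (words m) (λ _ → grid m d) _∷_

  ∑-grid : ∀ m d f → ∑ (grid m (suc d)) f ≡ ∑[ p ∈ words m ] ∑[ ps ∈ grid m d ] f (p ∷ ps)
  ∑-grid m d f = ∑-pairs (words m) (λ _ → grid m d) _∷_ f

  card-grid : ∀ m d → card (grid m d) ≡ pow (four m) d
  card-grid m zero    = +-identityʳ 1ℚ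
  card-grid m (suc d) = trans (∑-grid m d _) (trans (∑-const (words m) _)
    (trans (*-comm _ _) (cong₂ _*_ (card-words m) (card-grid m d))))

  -- hyp d u indexes the boxes in dimension d + 1 given by prefixes of lengths j₁, …, j_{d+1} with
  -- j₁ + … + j_{d+1} = d τ + u and j₁, …, j_d < τ.
  module Hyperbolic (τ : ℕ) where

    hyp : ∀ d (u : ℕ) → List (Vec (List Digit) (suc d))
    hyp zero    u = map (λ R → toList R ∷ []) (words u)
    hyp (suc d) u = pairs (nodes τ) (λ R → hyp d (codepth R ℕ.+ u)) (λ R Rs → path R ∷ Rs)

    ∑-hyp₀ : ∀ u f → ∑ (hyp 0 u) f ≡ ∑[ R ∈ words u ] f (toList R ∷ [])
    ∑-hyp₀ u f = ∑-map (λ R → toList R ∷ []) (words u) f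

    ∑-hyp : ∀ d u f → ∑ (hyp (suc d) u) f ≡
            ∑[ R ∈ nodes τ ] ∑[ Rs ∈ hyp d (codepth R ℕ.+ u) ] f (path R ∷ Rs)
    ∑-hyp d u f = ∑-pairs (nodes τ) (λ R → hyp d (codepth R ℕ.+ u)) (λ R Rs → path R ∷ Rs) f

    exponent : ∀ d u (R : Node τ) → depth R ℕ.+ (d ℕ.* τ ℕ.+ (codepth R ℕ.+ u)) ≡ suc d ℕ.* τ ℕ.+ u
    exponent d u R = begin
      depth R ℕ.+ (d ℕ.* τ ℕ.+ (codepth R ℕ.+ u))
        ≡⟨ solveℕ 4 (λ a b c d → a ⊞ (b ⊞ (c ⊞ d)) ≜ (a ⊞ c) ⊞ b ⊞ d) refl (depth R) (d ℕ.* τ) (codepth R) u ⟩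
      (depth R ℕ.+ codepth R) ℕ.+ d ℕ.* τ ℕ.+ u
        ≡⟨ cong (λ x → x ℕ.+ d ℕ.* τ ℕ.+ u) (depth+codepth R) ⟩
      suc d ℕ.* τ ℕ.+ u ∎
      where
      open ≡-Reasoning

  -- Bessel's inequality for multiscale kernels

  module Kernel (rootValue : ∀ {r} → Digit → Vec Digit r → ℚ) where

    kernel : ∀ {m} → List Digit → Vec Digit m → ℚ
    -- An interval consisting of a single grid cell has no quarters; prefixes of length at most t
    -- avoid this case since m = t + 1.
    kernel R       []      = 0ℚ
    kernel []      (e ∷ w) = rootValue e w
    kernel (f ∷ R) (e ∷ w) = δ e f * kernel R w

    kernelᵈ : ∀ {m d} → Vec (List Digit) d → Vec (Vec Digit m) d → ℚ
    kernelᵈ []       []       = 1ℚ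
    kernelᵈ (R ∷ Rs) (p ∷ ps) = kernel R p * kernelᵈ Rs ps

    ∑-child : ∀ {m} (h : Vec Digit (suc m) → ℚ) f R →
      ∑[ w ∈ words (suc m) ] (h w * kernel (f ∷ R) w) ≡ ∑[ w ∈ words m ] (h (f ∷ w) * kernel R w)
    ∑-child {m} h f R = begin
      ∑[ w ∈ words (suc m) ] (h w * kernel (f ∷ R) w)
        ≡⟨ ∑-words m _ ⟩
      ∑[ e ∈ digits ] ∑[ w ∈ words m ] (h (e ∷ w) * (δ e f * kernel R w))
        ≡⟨ ∑-cong digits (λ e → trans (∑-cong (words m) (λ w →
             solve 3 (λ h d k → h :* (d :* k) := d :* (h :* k)) refl (h (e ∷ w)) (δ e f) (kernel R w)))
             (∑-*ˡ (words m) (δ e f) _)) ⟩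
      ∑[ e ∈ digits ] (δ e f * ∑[ w ∈ words m ] (h (e ∷ w) * kernel R w))
        ≡⟨ ∑-δˡ f (λ e → ∑[ w ∈ words m ] (h (e ∷ w) * kernel R w)) ⟩
      ∑[ w ∈ words m ] (h (f ∷ w) * kernel R w) ∎
      where open ≡-Reasoning

    -- `norm m` bounds the squared norm of the profile of the full interval of words of length m,
    -- and `κ` is the factor per level. `orthogonal` compares the profile on one quarter with the
    -- kernels inside that quarter; kernels in different quarters are orthogonal by disjoint
    -- supports.
    module Bessel (norm : ℕ → ℚ) (κ : ℚ) (0≤κ : 0ℚ ≤ κ) (0≤norm : ∀ m → 0ℚ ≤ norm m)
      (norm-step : ∀ m → norm (suc m) * κ ≡ norm m)
      (root-norm : ∀ m → ∑[ e ∈ digits ] ∑[ w ∈ words m ] (rootValue e w) ² ≤ norm (suc m))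
      (orthogonal : ∀ R e m → ∑[ w ∈ words m ] (rootValue e w * kernel R w) ≡ 0ℚ) where

      bessel₀ : ∀ {A : Set} (rs : List A) (w : A → ℚ) (R : A → List Digit) →
                ∑[ p ∈ words 0 ] (∑[ r ∈ rs ] (w r * kernel (R r) p)) ² ≡ 0ℚ
      bessel₀ rs w R = begin
        (∑[ r ∈ rs ] (w r * 0ℚ)) ² + 0ℚ
          ≡⟨ cong (λ x → x ² + 0ℚ) (trans (∑-cong rs (λ r → zeroʳ (w r))) (∑-zero rs)) ⟩
        0ℚ ² + 0ℚ
          ≡⟨ solve 0 (con (ℤ.+ 0) :* con (ℤ.+ 0) :+ con (ℤ.+ 0) := con (ℤ.+ 0)) refl ⟩
        0ℚ ∎
        where open ≡-Reasoning

      -- At a point with leading digit e only the kernels in quarter e are nonzero.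
      collapse : ∀ {A : Set} (rs : List A) (w : Digit → A → ℚ) (R : A → List Digit) {m} e (p : Vec Digit m) →
        ∑[ f ∈ digits ] ∑[ r ∈ rs ] (w f r * (δ e f * kernel (R r) p)) ≡ ∑[ r ∈ rs ] (w e r * kernel (R r) p)
      collapse rs w R e p = trans
        (∑-cong digits (λ f → trans
          (∑-cong rs (λ r → solve 3 (λ w d k → w :* (d :* k) := d :* (w :* k)) refl (w f r) (δ e f) (kernel (R r) p)))
          (∑-*ˡ rs (δ e f) _)))
        (∑-δʳ e (λ f → ∑[ r ∈ rs ] (w f r * kernel (R r) p)))

      -- Recursion on the tree: the cross terms of the root with its descendants vanish quarter by
      -- quarter, and the four quarters are treated separately.
      bessel-nodes : ∀ m J (w : Node J → ℚ) →
        ∑[ p ∈ words m ] (∑[ R ∈ nodes J ] (w R * kernel (path R) p)) ²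
          ≤ norm m * ∑[ R ∈ nodes J ] (pow κ (depth R) * (w R) ²)
      bessel-nodes zero    J w = ℚ.≤-trans (ℚ.≤-reflexive (bessel₀ (nodes J) w path))
        (*-nonneg (0≤norm 0) (∑-nonneg (nodes J) (λ R → *-nonneg (pow-nonneg 0≤κ (depth R)) (²-nonneg _))))
      bessel-nodes (suc m) zero w = ℚ.≤-reflexive (begin
        ∑[ p ∈ words (suc m) ] 0ℚ ²  ≡⟨ ∑-cong (words (suc m)) (λ _ → zeroˡ 0ℚ) ⟩
        ∑[ p ∈ words (suc m) ] 0ℚ    ≡⟨ ∑-zero (words (suc m)) ⟩
        0ℚ                           ≡⟨ zeroʳ (norm (suc m)) ⟨
        norm (suc m) * 0ℚ            ∎)
        where open ≡-Reasoning
      bessel-nodes (suc m) (suc J) w = begin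
        ∑[ p ∈ words (suc m) ] (∑[ R ∈ nodes (suc J) ] (w R * kernel (path R) p)) ²
          ≡⟨ ∑-words m _ ⟩
        ∑[ e ∈ digits ] ∑[ p ∈ words m ] (a * rootValue e p + ∑ children (λ R → w R * kernel (path R) (e ∷ p))) ²
          ≡⟨ ∑-cong digits (λ e → ∑-cong (words m) (λ p → cong (λ x → (a * rootValue e p + x) ²)
               (trans (∑-pairs digits (λ _ → nodes J) child _) (collapse (nodes J) (λ f R → w (child f R)) path e p)))) ⟩
        ∑[ e ∈ digits ] ∑[ p ∈ words m ] (a * rootValue e p + X e p) ²
          ≡⟨ ∑-cong digits split ⟩
        ∑[ e ∈ digits ] (a ² * ∑[ p ∈ words m ] (rootValue e p) ² + ∑[ p ∈ words m ] (X e p) ²)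
          ≡⟨ trans (∑-+ digits _ _) (cong (_+ ∑[ e ∈ digits ] ∑[ p ∈ words m ] (X e p) ²) (∑-*ˡ digits (a ²) _)) ⟩
        a ² * ∑[ e ∈ digits ] ∑[ p ∈ words m ] (rootValue e p) ² + ∑[ e ∈ digits ] ∑[ p ∈ words m ] (X e p) ²
          ≤⟨ +-mono-≤ (*-monoʳ-≤ (²-nonneg a) (root-norm m))
               (∑-mono digits (λ e → bessel-nodes m J (λ R → w (child e R)))) ⟩
        a ² * norm (suc m) + ∑[ e ∈ digits ] (norm m * Y e)
          ≡⟨ cong (a ² * norm (suc m) +_) (begin-equality
               ∑[ e ∈ digits ] (norm m * Y e)                ≡⟨ ∑-*ˡ digits (norm m) Y ⟩
               norm m * ∑ digits Y                           ≡⟨ cong (_* ∑ digits Y) (norm-step m) ⟨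
               norm (suc m) * κ * ∑ digits Y                 ≡⟨ *-assoc (norm (suc m)) κ _ ⟩
               norm (suc m) * (κ * ∑ digits Y)               ≡⟨ cong (norm (suc m) *_) (begin-equality
                 κ * ∑ digits Y                              ≡⟨ ∑-*ˡ digits κ Y ⟨
                 ∑[ e ∈ digits ] (κ * Y e)                   ≡⟨ ∑-cong digits (λ e → trans (sym (∑-*ˡ (nodes J) κ _))
                                                                  (∑-cong (nodes J) (λ R → sym (*-assoc κ _ _)))) ⟩
                 ∑[ e ∈ digits ] ∑[ R ∈ nodes J ] (κ * pow κ (depth R) * (w (child e R)) ²)
                                                             ≡⟨ ∑-pairs digits (λ _ → nodes J) child _ ⟨
                 ∑ children (λ R → pow κ (depth R) * (w R) ²) ∎) ⟩
               norm (suc m) * ∑ children (λ R → pow κ (depth R) * (w R) ²) ∎) ⟩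
        a ² * norm (suc m) + norm (suc m) * ∑ children (λ R → pow κ (depth R) * (w R) ²)
          ≡⟨ solve 3 (λ a n c → a :* n :+ n :* c := n :* (con (ℤ.+ 1) :* a :+ c)) refl (a ²) (norm (suc m)) _ ⟩
        norm (suc m) * ∑[ R ∈ nodes (suc J) ] (pow κ (depth R) * (w R) ²) ∎
        where
        open ≤R
        a = w root
        children = pairs digits (λ _ → nodes J) child
        X : Digit → Vec Digit m → ℚ
        X e p = ∑[ R ∈ nodes J ] (w (child e R) * kernel (path R) p)
        Y : Digit → ℚ
        Y e = ∑[ R ∈ nodes J ] (pow κ (depth R) * (w (child e R)) ²)
        cross : ∀ e → ∑[ p ∈ words m ] (rootValue e p * X e p) ≡ 0ℚ
        cross e = begin-equality
          ∑[ p ∈ words m ] (rootValue e p * X e p)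
            ≡⟨ ∑-cong (words m) (λ p → ∑-*ˡ (nodes J) (rootValue e p) _) ⟨
          ∑[ p ∈ words m ] ∑[ R ∈ nodes J ] (rootValue e p * (w (child e R) * kernel (path R) p))
            ≡⟨ ∑-swap (words m) (nodes J) (λ p R → rootValue e p * (w (child e R) * kernel (path R) p)) ⟩
          ∑[ R ∈ nodes J ] ∑[ p ∈ words m ] (rootValue e p * (w (child e R) * kernel (path R) p))
            ≡⟨ ∑-cong (nodes J) (λ R → trans (∑-cong (words m) (λ p →
                 solve 3 (λ r w k → r :* (w :* k) := w :* (r :* k)) refl (rootValue e p) (w (child e R)) (kernel (path R) p)))
                 (trans (∑-*ˡ (words m) (w (child e R)) _)
                 (trans (cong (w (child e R) *_) (orthogonal (path R) e m)) (zeroʳ _)))) ⟩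
          ∑[ R ∈ nodes J ] 0ℚ
            ≡⟨ ∑-zero (nodes J) ⟩
          0ℚ ∎
        split : ∀ e → ∑[ p ∈ words m ] (a * rootValue e p + X e p) ² ≡
                      a ² * ∑[ p ∈ words m ] (rootValue e p) ² + ∑[ p ∈ words m ] (X e p) ²
        split e = begin-equality
          ∑[ p ∈ words m ] (a * rootValue e p + X e p) ²
            ≡⟨ ∑-cong (words m) (λ p → solve 3 (λ a r x → (a :* r :+ x) :* (a :* r :+ x)
                 := a :* a :* (r :* r) :+ (a :+ a) :* (r :* x) :+ x :* x) refl a (rootValue e p) (X e p)) ⟩
          ∑[ p ∈ words m ] (a ² * (rootValue e p) ² + (a + a) * (rootValue e p * X e p) + (X e p) ²)
            ≡⟨ trans (∑-+ (words m) _ _) (cong (_+ ∑[ p ∈ words m ] (X e p) ²) (trans (∑-+ (words m) _ _)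
                 (cong₂ _+_ (∑-*ˡ (words m) (a ²) _) (trans (∑-*ˡ (words m) (a + a) _)
                   (trans (cong ((a + a) *_) (cross e)) (zeroʳ _)))))) ⟩
          a ² * ∑[ p ∈ words m ] (rootValue e p) ² + 0ℚ + ∑[ p ∈ words m ] (X e p) ²
            ≡⟨ cong (_+ ∑[ p ∈ words m ] (X e p) ²) (+-identityʳ _) ⟩
          a ² * ∑[ p ∈ words m ] (rootValue e p) ² + ∑[ p ∈ words m ] (X e p) ² ∎

      -- Intervals of one depth are disjoint, so the sum of kernels descends digit by digit to a
      -- single profile.
      bessel-words : ∀ m t (w : Vec Digit t → ℚ) →
        ∑[ p ∈ words m ] (∑[ R ∈ words t ] (w R * kernel (toList R) p)) ²
          ≤ norm m * (pow κ t * ∑[ R ∈ words t ] (w R) ²)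
      bessel-words zero    t w = ℚ.≤-trans (ℚ.≤-reflexive (bessel₀ (words t) w toList))
        (*-nonneg (0≤norm 0) (*-nonneg (pow-nonneg 0≤κ t) (∑-nonneg (words t) (λ R → ²-nonneg _))))
      bessel-words (suc m) zero w = begin
        ∑[ p ∈ words (suc m) ] (w [] * kernel [] p + 0ℚ) ²
          ≡⟨ ∑-words m _ ⟩
        ∑[ e ∈ digits ] ∑[ p ∈ words m ] (w [] * rootValue e p + 0ℚ) ²
          ≡⟨ ∑-cong digits (λ e → trans (∑-cong (words m) (λ p →
               solve 2 (λ w r → (w :* r :+ con (ℤ.+ 0)) :* (w :* r :+ con (ℤ.+ 0)) := w :* w :* (r :* r)) refl (w []) (rootValue e p)))
               (∑-*ˡ (words m) ((w []) ²) _)) ⟩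
        ∑[ e ∈ digits ] ((w []) ² * ∑[ p ∈ words m ] (rootValue e p) ²)
          ≡⟨ ∑-*ˡ digits ((w []) ²) _ ⟩
        (w []) ² * ∑[ e ∈ digits ] ∑[ p ∈ words m ] (rootValue e p) ²
          ≤⟨ *-monoʳ-≤ (²-nonneg (w [])) (root-norm m) ⟩
        (w []) ² * norm (suc m)
          ≡⟨ solve 2 (λ a n → a :* n := n :* (con (ℤ.+ 1) :* (a :+ con (ℤ.+ 0)))) refl ((w []) ²) (norm (suc m)) ⟩
        norm (suc m) * (1ℚ * ((w []) ² + 0ℚ)) ∎
        where open ≤R
      bessel-words (suc m) (suc t) w = begin
        ∑[ p ∈ words (suc m) ] (∑[ R ∈ words (suc t) ] (w R * kernel (toList R) p)) ²
          ≡⟨ ∑-words m _ ⟩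
        ∑[ e ∈ digits ] ∑[ p ∈ words m ] (∑[ R ∈ words (suc t) ] (w R * kernel (toList R) (e ∷ p))) ²
          ≡⟨ ∑-cong digits (λ e → ∑-cong (words m) (λ p → cong _²
               (trans (∑-words t _) (collapse (words t) (λ f R → w (f ∷ R)) toList e p)))) ⟩
        ∑[ e ∈ digits ] ∑[ p ∈ words m ] (∑[ R ∈ words t ] (w (e ∷ R) * kernel (toList R) p)) ²
          ≤⟨ ∑-mono digits (λ e → bessel-words m t (λ R → w (e ∷ R))) ⟩
        ∑[ e ∈ digits ] (norm m * (pow κ t * ∑[ R ∈ words t ] (w (e ∷ R)) ²))
          ≡⟨ trans (∑-*ˡ digits (norm m) _) (cong (norm m *_) (∑-*ˡ digits (pow κ t) _)) ⟩
        norm m * (pow κ t * ∑[ e ∈ digits ] ∑[ R ∈ words t ] (w (e ∷ R)) ²)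
          ≡⟨ cong₂ (λ x y → x * (pow κ t * y)) (norm-step m) (∑-words t _) ⟨
        norm (suc m) * κ * (pow κ t * ∑[ R ∈ words (suc t) ] (w R) ²)
          ≡⟨ solve 4 (λ n k p s → n :* k :* (p :* s) := n :* (k :* p :* s)) refl (norm (suc m)) κ (pow κ t) _ ⟩
        norm (suc m) * (pow κ (suc t) * ∑[ R ∈ words (suc t) ] (w R) ²) ∎
        where open ≤R

      module _ (τ : ℕ) where
        open Hyperbolic τ

        -- With the other coordinates fixed, `bessel-nodes` applies to the first one, with the inner
        -- sums `W R ps` as coefficients; then recursion for each first side `R`. The powers of `κ`
        -- recombine to the same factor for every `R` because the total depth is fixed.
        bessel-hyp : ∀ m d u (w : Vec (List Digit) (suc d) → ℚ) →
          ∑[ p ∈ grid m (suc d) ] (∑[ R ∈ hyp d u ] (w R * kernelᵈ R p)) ²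
            ≤ pow (norm m) (suc d) * pow κ (d ℕ.* τ ℕ.+ u) * ∑[ R ∈ hyp d u ] (w R) ²
        bessel-hyp m zero u w = begin
          ∑[ p ∈ grid m 1 ] (∑[ R ∈ hyp 0 u ] (w R * kernelᵈ R p)) ²
            ≡⟨ ∑-grid m 0 _ ⟩
          ∑[ p ∈ words m ] ((∑[ R ∈ hyp 0 u ] (w R * kernelᵈ R (p ∷ []))) ² + 0ℚ)
            ≡⟨ ∑-cong (words m) (λ p → trans (+-identityʳ _) (cong _² (trans (∑-hyp₀ u _)
                 (∑-cong (words u) (λ R → cong (w (toList R ∷ []) *_) (*-identityʳ _)))))) ⟩
          ∑[ p ∈ words m ] (∑[ R ∈ words u ] (w (toList R ∷ []) * kernel (toList R) p)) ²
            ≤⟨ bessel-words m u (λ R → w (toList R ∷ [])) ⟩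
          norm m * (pow κ u * ∑[ R ∈ words u ] (w (toList R ∷ [])) ²)
            ≡⟨ cong (λ x → norm m * (pow κ u * x)) (∑-hyp₀ u _) ⟨
          norm m * (pow κ u * ∑[ R ∈ hyp 0 u ] (w R) ²)
            ≡⟨ solve 3 (λ n k s → n :* (k :* s) := n :* con (ℤ.+ 1) :* k :* s) refl (norm m) (pow κ u) _ ⟩
          pow (norm m) 1 * pow κ u * ∑[ R ∈ hyp 0 u ] (w R) ² ∎
          where open ≤R
        bessel-hyp m (suc d) u w = begin
          ∑[ p ∈ grid m (suc (suc d)) ] (∑[ R ∈ hyp (suc d) u ] (w R * kernelᵈ R p)) ²
            ≡⟨ trans (∑-grid m (suc d) _) (∑-swap (words m) (grid m (suc d)) _) ⟩
          ∑[ ps ∈ grid m (suc d) ] ∑[ p ∈ words m ] (∑[ R ∈ hyp (suc d) u ] (w R * kernelᵈ R (p ∷ ps))) ²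
            ≡⟨ ∑-cong (grid m (suc d)) (λ ps → ∑-cong (words m) (λ p → cong _² (trans (∑-hyp d u _)
                 (∑-cong (nodes τ) (λ R → trans (∑-cong (rest R) (λ Rs →
                   solve 3 (λ w k l → w :* (k :* l) := w :* l :* k) refl (w (path R ∷ Rs)) (kernel (path R) p) (kernelᵈ Rs ps)))
                   (∑-*ʳ (rest R) _ (kernel (path R) p))))))) ⟩
          ∑[ ps ∈ grid m (suc d) ] ∑[ p ∈ words m ] (∑[ R ∈ nodes τ ] (W R ps * kernel (path R) p)) ²
            ≤⟨ ∑-mono (grid m (suc d)) (λ ps → bessel-nodes m τ (λ R → W R ps)) ⟩
          ∑[ ps ∈ grid m (suc d) ] (norm m * ∑[ R ∈ nodes τ ] (pow κ (depth R) * (W R ps) ²))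
            ≡⟨ trans (∑-*ˡ (grid m (suc d)) (norm m) _) (cong (norm m *_)
                 (trans (∑-swap (grid m (suc d)) (nodes τ) _) (∑-cong (nodes τ) (λ R → ∑-*ˡ (grid m (suc d)) (pow κ (depth R)) _)))) ⟩
          norm m * ∑[ R ∈ nodes τ ] (pow κ (depth R) * ∑[ ps ∈ grid m (suc d) ] (W R ps) ²)
            ≤⟨ *-monoʳ-≤ (0≤norm m) (∑-mono (nodes τ) (λ R → *-monoʳ-≤ (pow-nonneg 0≤κ (depth R))
                 (bessel-hyp m d (codepth R ℕ.+ u) (λ Rs → w (path R ∷ Rs))))) ⟩
          norm m * ∑[ R ∈ nodes τ ] (pow κ (depth R) * (N * pow κ (d ℕ.* τ ℕ.+ (codepth R ℕ.+ u)) * V R))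
            ≡⟨ cong (norm m *_) (∑-cong (nodes τ) (λ R → trans
                 (solve 4 (λ k n l v → k :* (n :* l :* v) := n :* (k :* l) :* v) refl (pow κ (depth R)) N
                   (pow κ (d ℕ.* τ ℕ.+ (codepth R ℕ.+ u))) (V R))
                 (cong (λ x → N * x * V R) (trans (sym (pow-+ κ (depth R) _)) (cong (pow κ) (exponent d u R)))))) ⟩
          norm m * ∑[ R ∈ nodes τ ] (N * K * V R)
            ≡⟨ cong (norm m *_) (trans (∑-*ˡ (nodes τ) (N * K) V) (cong (N * K *_) (sym (∑-hyp d u _)))) ⟩
          norm m * (N * K * ∑[ R ∈ hyp (suc d) u ] (w R) ²)
            ≡⟨ solve 4 (λ n m k s → n :* (m :* k :* s) := n :* m :* k :* s) refl (norm m) N K _ ⟩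
          pow (norm m) (suc (suc d)) * K * ∑[ R ∈ hyp (suc d) u ] (w R) ² ∎
          where
          open ≤R
          N = pow (norm m) (suc d)
          K = pow κ (suc d ℕ.* τ ℕ.+ u)
          rest : Node τ → List (Vec (List Digit) (suc d))
          rest R = hyp d (codepth R ℕ.+ u)
          W : Node τ → Vec (Vec Digit m) (suc d) → ℚ
          W R ps = ∑[ Rs ∈ rest R ] (w (path R ∷ Rs) * kernelᵈ Rs ps)
          V : Node τ → ℚ
          V R = ∑[ Rs ∈ rest R ] (w (path R ∷ Rs)) ²

  -- The third difference (1, -3, 3, -1) is orthogonal to quadratic polynomials;
  -- height is its indefinite sum.
  slope height : Digit → ℚ
  slope 0F = 1ℚ
  slope 1F = ι ℤ.-[1+ 2 ]
  slope 2F = ⌜ 3 ⌝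
  slope 3F = ι ℤ.-[1+ 0 ]
  height 0F = 0ℚ
  height 1F = 1ℚ
  height 2F = ι ℤ.-[1+ 1 ]
  height 3F = 1ℚ

  -- The kernels `y` and `g`: moments and norms

  val : ∀ {m} → Vec Digit m → ℚ
  val []              = 0ℚ
  val {suc m} (e ∷ w) = ⌜ toℕ e ⌝ * four m + val w

  module Y = Kernel (λ e w → slope e)
  module G = Kernel (λ {r} e w → height e * four r + slope e * val w)
  open Y using () renaming (kernel to y; kernelᵈ to yᵈ)
  open G using () renaming (kernel to g; kernelᵈ to gᵈ)

  y-mean : ∀ R m → ∑[ w ∈ words m ] (1ℚ * y R w) ≡ 0ℚ
  y-mean R       zero    = solve 0 (con (ℤ.+ 1) :* con (ℤ.+ 0) :+ con (ℤ.+ 0) := con (ℤ.+ 0)) refl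
  y-mean (f ∷ R) (suc m) = trans (Y.∑-child (λ _ → 1ℚ) f R) (y-mean R m)
  y-mean []      (suc m) = begin
    ∑[ w ∈ words (suc m) ] (1ℚ * y [] w)             ≡⟨ ∑-words m _ ⟩
    ∑[ e ∈ digits ] ∑[ w ∈ words m ] (1ℚ * slope e)  ≡⟨ ∑-cong digits (λ e → ∑-const (words m) (1ℚ * slope e)) ⟩
    ∑[ e ∈ digits ] (1ℚ * slope e * card (words m))  ≡⟨ ∑-digits _ ⟩
    _ ≡⟨ solve 1 (λ n → con (ℤ.+ 1) :* con (ℤ.+ 1) :* n :+ (con (ℤ.+ 1) :* con ℤ.-[1+ 2 ] :* n :+
         (con (ℤ.+ 1) :* con (ℤ.+ 3) :* n :+ (con (ℤ.+ 1) :* con ℤ.-[1+ 0 ] :* n :+ con (ℤ.+ 0))))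
         := con (ℤ.+ 0)) refl (card (words m)) ⟩
    0ℚ ∎
    where open ≡-Reasoning

  y-orthogonal : ∀ R e m → ∑[ w ∈ words m ] (slope e * y R w) ≡ 0ℚ
  y-orthogonal R e m = begin
    ∑[ w ∈ words m ] (slope e * y R w)         ≡⟨ ∑-cong (words m) (λ w → cong (slope e *_) (*-identityˡ _)) ⟨
    ∑[ w ∈ words m ] (slope e * (1ℚ * y R w))  ≡⟨ ∑-*ˡ (words m) (slope e) _ ⟩
    slope e * ∑[ w ∈ words m ] (1ℚ * y R w)    ≡⟨ cong (slope e *_) (y-mean R m) ⟩
    slope e * 0ℚ                               ≡⟨ zeroʳ (slope e) ⟩
    0ℚ ∎
    where open ≡-Reasoning

  -- At the root, the sums over the quarters of `slope`, of `height` and of both times the digit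
  -- vanish. All affine functions occur together because entering a quarter shifts the constant
  -- term; a coarser `g` restricted to a quarter is the instance needed for orthogonality.
  g-moments : ∀ a b R m → ∑[ w ∈ words m ] ((a + b * val w) * g R w) ≡ 0ℚ
  g-moments a b R       zero    = solve 2 (λ a b → (a :+ b :* con (ℤ.+ 0)) :* con (ℤ.+ 0) :+ con (ℤ.+ 0) := con (ℤ.+ 0)) refl a b
  g-moments a b (f ∷ R) (suc m) = begin
    ∑[ w ∈ words (suc m) ] ((a + b * val w) * g (f ∷ R) w)
      ≡⟨ G.∑-child (λ w → a + b * val w) f R ⟩
    ∑[ w ∈ words m ] ((a + b * (⌜ toℕ f ⌝ * four m + val w)) * g R w)
      ≡⟨ ∑-cong (words m) (λ w → cong (_* g R w)
           (solve 4 (λ a b c v → a :+ b :* (c :+ v) := a :+ b :* c :+ b :* v) refl a b (⌜ toℕ f ⌝ * four m) (val w))) ⟩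
    ∑[ w ∈ words m ] ((a + b * (⌜ toℕ f ⌝ * four m) + b * val w) * g R w)
      ≡⟨ g-moments (a + b * (⌜ toℕ f ⌝ * four m)) b R m ⟩
    0ℚ ∎
    where open ≡-Reasoning
  g-moments a b []      (suc m) = begin
    ∑[ w ∈ words (suc m) ] ((a + b * val w) * g [] w)
      ≡⟨ ∑-words m _ ⟩
    ∑[ e ∈ digits ] ∑[ w ∈ words m ] ((a + b * (⌜ toℕ e ⌝ * q + val w)) * (height e * q + slope e * val w))
      ≡⟨ ∑-cong digits (λ e → trans (∑-cong (words m) (λ w →
           solve 7 (λ a b t h s q v → (a :+ b :* (t :* q :+ v)) :* (h :* q :+ s :* v) :=
             (a :+ b :* (t :* q)) :* (h :* q) :* con (ℤ.+ 1) :+ ((a :+ b :* (t :* q)) :* s :+ b :* (h :* q)) :* v :+ b :* s :* (v :* v))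
             refl a b ⌜ toℕ e ⌝ (height e) (slope e) q (val w)))
           (trans (∑-+ (words m) _ _) (cong₂ _+_ (trans (∑-+ (words m) _ _)
             (cong₂ _+_ (∑-*ˡ (words m) ((a + b * (⌜ toℕ e ⌝ * q)) * (height e * q)) (λ _ → 1ℚ))
                        (∑-*ˡ (words m) ((a + b * (⌜ toℕ e ⌝ * q)) * slope e + b * (height e * q)) val)))
             (∑-*ˡ (words m) (b * slope e) (λ w → (val w) ²))))) ⟩
    ∑[ e ∈ digits ] ((a + b * (⌜ toℕ e ⌝ * q)) * (height e * q) * N
        + ((a + b * (⌜ toℕ e ⌝ * q)) * slope e + b * (height e * q)) * V + b * slope e * V²)
      ≡⟨ ∑-digits _ ⟩
    _ ≡⟨ solve 6 (λ a b q N V W →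
           term a b q N V W (con (ℤ.+ 0)) (con (ℤ.+ 0)) (con (ℤ.+ 1)) :+
           (term a b q N V W (con (ℤ.+ 1)) (con (ℤ.+ 1)) (con ℤ.-[1+ 2 ]) :+
           (term a b q N V W (con (ℤ.+ 2)) (con ℤ.-[1+ 1 ]) (con (ℤ.+ 3)) :+
           (term a b q N V W (con (ℤ.+ 3)) (con (ℤ.+ 1)) (con ℤ.-[1+ 0 ]) :+ con (ℤ.+ 0)))) := con (ℤ.+ 0))
           refl a b q N V V² ⟩
    0ℚ ∎
    where
    open ≡-Reasoning
    q  = four m
    N  = card (words m)
    V  = ∑ (words m) val
    V² = ∑[ w ∈ words m ] (val w) ²
    term = λ a b q N V W t h s →
      (a :+ b :* (t :* q)) :* (h :* q) :* N :+ ((a :+ b :* (t :* q)) :* s :+ b :* (h :* q)) :* V :+ b :* s :* W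

  0≤four : ∀ m → 0ℚ ≤ four m
  0≤four = pow-nonneg 0≤⌜ 4 ⌝

  0≤val : ∀ {m} (w : Vec Digit m) → 0ℚ ≤ val w
  0≤val []              = ℚ.≤-refl
  0≤val {suc m} (e ∷ w) = +-nonneg (*-nonneg 0≤⌜ toℕ e ⌝ (0≤four m)) (0≤val w)

  ⌜⌝-mono : ∀ {m n} → m ℕ.≤ n → ⌜ m ⌝ ≤ ⌜ n ⌝
  ⌜⌝-mono {m} {n} m≤n = ℚ.*≤* (subst₂ ℤ._≤_ (sym (ℤ.*-identityʳ (ℤ.+ m))) (sym (ℤ.*-identityʳ (ℤ.+ n))) (ℤ.+≤+ m≤n))

  val≤four : ∀ {m} (w : Vec Digit m) → val w ≤ four m
  val≤four []              = 0≤⌜ 1 ⌝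
  val≤four {suc m} (e ∷ w) = begin
    ⌜ toℕ e ⌝ * four m + val w   ≤⟨ +-mono-≤ (*-monoˡ-≤ (0≤four m) (⌜⌝-mono {toℕ e} {3} (ℕ.s≤s⁻¹ (Fin.toℕ<n e)))) (val≤four w) ⟩
    ⌜ 3 ⌝ * four m + four m      ≡⟨ solve 1 (λ q → con (ℤ.+ 3) :* q :+ q := con (ℤ.+ 4) :* q) refl (four m) ⟩
    four (suc m) ∎
    where open ≤R

  -- The number 4^(m - 1) of grid points in a quarter, taken as 1/4 at m = 0 so that the scaling
  -- `side-step` holds for every m.
  side : ℕ → ℚ
  side m = ¼ * four m

  side-suc : ∀ m → side (suc m) ≡ four m
  side-suc m = begin
    ¼ * (⌜ 4 ⌝ * four m) ≡⟨ solve 3 (λ x y q → x :* (y :* q) := (y :* x) :* q) refl ¼ ⌜ 4 ⌝ (four m) ⟩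
    ⌜ 4 ⌝ * ¼ * four m   ≡⟨ cong (_* four m) 4*¼ ⟩
    1ℚ * four m          ≡⟨ *-identityˡ _ ⟩
    four m               ∎
    where open ≡-Reasoning

  side-step : ∀ m → side (suc m) * ¼ ≡ side m
  side-step m = trans (cong (_* ¼) (side-suc m)) (*-comm _ _)

  0≤¼ : 0ℚ ≤ ¼
  0≤¼ = ℚ.nonNegative⁻¹ ¼

  0≤side : ∀ m → 0ℚ ≤ side m
  0≤side m = *-nonneg 0≤¼ (0≤four m)

  y-norm g-norm : ℕ → ℚ
  y-norm m = ⌜ 20 ⌝ * side m
  g-norm m = ⌜ 6 ⌝ * pow (side m) 3

  y-root : ∀ m → ∑[ e ∈ digits ] ∑[ w ∈ words m ] (slope e) ² ≤ y-norm (suc m)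
  y-root m = ℚ.≤-reflexive (begin
    ∑[ e ∈ digits ] ∑[ w ∈ words m ] (slope e) ²   ≡⟨ ∑-cong digits (λ e → ∑-const (words m) _) ⟩
    ∑[ e ∈ digits ] ((slope e) ² * card (words m)) ≡⟨ ∑-digits _ ⟩
    _ ≡⟨ solve 1 (λ n → sq (con (ℤ.+ 1)) :* n :+ (sq (con ℤ.-[1+ 2 ]) :* n :+
         (sq (con (ℤ.+ 3)) :* n :+ (sq (con ℤ.-[1+ 0 ]) :* n :+ con (ℤ.+ 0)))) := con (ℤ.+ 20) :* n) refl (card (words m)) ⟩
    ⌜ 20 ⌝ * card (words m)                        ≡⟨ cong (⌜ 20 ⌝ *_) (trans (card-words m) (sym (side-suc m))) ⟩
    y-norm (suc m) ∎)
    where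
    open ≡-Reasoning
    sq = λ x → x :* x

  -- At offset v in a quarter of length q the four values are v, q - 3v, 3v - 2q and q - v. This
  -- form of their sum of squares serves both the upper bound 6 q² and the lower bound q².
  g-root-norm : ∀ m → ∑[ e ∈ digits ] ∑[ w ∈ words m ] (height e * four m + slope e * val w) ² ≡
    ∑[ w ∈ words m ] ((four m) ² + ⌜ 5 ⌝ * (four m - (val w + val w)) ²)
  g-root-norm m = trans (∑-swap digits (words m) (λ e w → (height e * four m + slope e * val w) ²))
    (∑-cong (words m) (λ w → trans (∑-digits _) (solve 2 (λ q v →
      sq (con (ℤ.+ 0) :* q :+ con (ℤ.+ 1) :* v) :+
      (sq (con (ℤ.+ 1) :* q :+ con ℤ.-[1+ 2 ] :* v) :+
      (sq (con ℤ.-[1+ 1 ] :* q :+ con (ℤ.+ 3) :* v) :+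
      (sq (con (ℤ.+ 1) :* q :+ con ℤ.-[1+ 0 ] :* v) :+ con (ℤ.+ 0))))
      := q :* q :+ con (ℤ.+ 5) :* sq (q :- (v :+ v))) refl (four m) (val w))))
    where sq = λ x → x :* x

  g-root : ∀ m → ∑[ e ∈ digits ] ∑[ w ∈ words m ] (height e * four m + slope e * val w) ² ≤ g-norm (suc m)
  g-root m = begin
    ∑[ e ∈ digits ] ∑[ w ∈ words m ] (height e * four m + slope e * val w) ²
      ≡⟨ g-root-norm m ⟩
    ∑[ w ∈ words m ] (q ² + ⌜ 5 ⌝ * (q - (val w + val w)) ²)
      ≤⟨ ∑-mono (words m) (λ w → begin
           q ² + ⌜ 5 ⌝ * (q - (val w + val w)) ²
             -- Since 0 ≤ v ≤ q, the added term 20 v (q - v) is nonnegative; it completes the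
             -- quadratic to 6 q².
             ≤⟨ p≤q+p (*-nonneg 0≤⌜ 20 ⌝ (*-nonneg (0≤val w) (0≤q-v w))) ⟩
           ⌜ 20 ⌝ * (val w * (q - val w)) + (q ² + ⌜ 5 ⌝ * (q - (val w + val w)) ²)
             ≡⟨ solve 2 (λ q v → con (ℤ.+ 20) :* (v :* (q :- v)) :+ (q :* q :+ con (ℤ.+ 5) :* ((q :- (v :+ v)) :* (q :- (v :+ v))))
                  := con (ℤ.+ 6) :* (q :* q)) refl q (val w) ⟩
           ⌜ 6 ⌝ * q ² ∎) ⟩
    ∑[ w ∈ words m ] (⌜ 6 ⌝ * q ²)
      ≡⟨ ∑-const (words m) _ ⟩
    ⌜ 6 ⌝ * q ² * card (words m)
      ≡⟨ cong (⌜ 6 ⌝ * q ² *_) (card-words m) ⟩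
    ⌜ 6 ⌝ * q ² * q
      ≡⟨ solve 1 (λ q → con (ℤ.+ 6) :* (q :* q) :* q := con (ℤ.+ 6) :* (q :* (q :* (q :* con (ℤ.+ 1))))) refl q ⟩
    ⌜ 6 ⌝ * pow q 3
      ≡⟨ cong (λ x → ⌜ 6 ⌝ * pow x 3) (side-suc m) ⟨
    g-norm (suc m) ∎
    where
    open ≤R
    q = four m
    0≤q-v : ∀ w → 0ℚ ≤ q - val w
    0≤q-v w = subst (_≤ q - val w) (solve 1 (λ v → v :- v := con (ℤ.+ 0)) refl (val w)) (+-monoˡ-≤ (- val w) (val≤four w))

  open Y.Bessel y-norm ¼ 0≤¼ (λ m → *-nonneg 0≤⌜ 20 ⌝ (0≤side m))
    (λ m → trans (*-assoc ⌜ 20 ⌝ _ _) (cong (⌜ 20 ⌝ *_) (side-step m)))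
    y-root y-orthogonal
    using () renaming (bessel-hyp to y-bessel) public

  open G.Bessel g-norm (pow ¼ 3) (pow-nonneg 0≤¼ 3) (λ m → *-nonneg 0≤⌜ 6 ⌝ (pow-nonneg (0≤side m) 3))
    (λ m → trans (*-assoc ⌜ 6 ⌝ _ _) (cong (⌜ 6 ⌝ *_) (trans (sym (pow-* (side (suc m)) ¼ 3)) (cong (λ x → pow x 3) (side-step m)))))
    g-root (λ R e m → g-moments (height e * four m) (slope e) R m)
    using () renaming (bessel-hyp to g-bessel) public

  -- Orthants and indefinite summation

  below : ∀ {m} → Vec Digit m → Vec Digit m → ℚ
  below []      []      = 0ℚ
  below (e ∷ a) (f ∷ p) with Fin.<-cmp e f
  ... | tri< _ _ _ = 1ℚ
  ... | tri≈ _ _ _ = below a p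
  ... | tri> _ _ _ = 0ℚ

  belowᵈ : ∀ {m d} → Vec (Vec Digit m) d → Vec (Vec Digit m) d → ℚ
  belowᵈ []       []       = 1ℚ
  belowᵈ (a ∷ as) (p ∷ ps) = below a p * belowᵈ as ps

  partialSum : (Digit → ℚ) → Digit → ℚ
  partialSum s 0F = 0ℚ
  partialSum s 1F = s 0F
  partialSum s 2F = s 0F + s 1F
  partialSum s 3F = s 0F + s 1F + s 2F

  -- A smaller leading digit puts all 4ᵐ words below, a larger one none; an equal one leaves the
  -- comparison to the tails.
  ∑-below : ∀ m (s : Digit → ℚ) f (p : Vec Digit m) →
    ∑[ e ∈ digits ] ∑[ a ∈ words m ] (s e * below (e ∷ a) (f ∷ p)) ≡
    partialSum s f * four m + s f * ∑[ a ∈ words m ] below a p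
  ∑-below m s f p = trans (∑-digits _) (cases f)
    where
    q = four m
    B = ∑[ a ∈ words m ] below a p
    one : ∀ c → ∑[ a ∈ words m ] (c * 1ℚ) ≡ c * q
    one c = trans (∑-*ˡ (words m) c _) (cong (c *_) (card-words m))
    nil : ∀ c → ∑[ a ∈ words m ] (c * 0ℚ) ≡ 0ℚ
    nil c = trans (∑-cong (words m) (λ _ → zeroʳ c)) (∑-zero (words m))
    eq : ∀ c → ∑[ a ∈ words m ] (c * below a p) ≡ c * B
    eq c = ∑-*ˡ (words m) c _
    row : Digit → ℚ
    row f = ∑[ a ∈ words m ] (s 0F * below (0F ∷ a) (f ∷ p)) + (∑[ a ∈ words m ] (s 1F * below (1F ∷ a) (f ∷ p))
      + (∑[ a ∈ words m ] (s 2F * below (2F ∷ a) (f ∷ p)) + (∑[ a ∈ words m ] (s 3F * below (3F ∷ a) (f ∷ p)) + 0ℚ)))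
    cases : ∀ f → row f ≡ partialSum s f * q + s f * B
    cases 0F = trans (cong₂ _+_ (eq (s 0F)) (cong₂ _+_ (nil (s 1F)) (cong₂ _+_ (nil (s 2F)) (cong (_+ 0ℚ) (nil (s 3F))))))
      (solve 2 (λ q x → x :+ (con (ℤ.+ 0) :+ (con (ℤ.+ 0) :+ (con (ℤ.+ 0) :+ con (ℤ.+ 0)))) := con (ℤ.+ 0) :* q :+ x) refl q (s 0F * B))
    cases 1F = trans (cong₂ _+_ (one (s 0F)) (cong₂ _+_ (eq (s 1F)) (cong₂ _+_ (nil (s 2F)) (cong (_+ 0ℚ) (nil (s 3F))))))
      (solve 3 (λ q a x → a :* q :+ (x :+ (con (ℤ.+ 0) :+ (con (ℤ.+ 0) :+ con (ℤ.+ 0)))) := a :* q :+ x) refl q (s 0F) (s 1F * B))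
    cases 2F = trans (cong₂ _+_ (one (s 0F)) (cong₂ _+_ (one (s 1F)) (cong₂ _+_ (eq (s 2F)) (cong (_+ 0ℚ) (nil (s 3F))))))
      (solve 4 (λ q a b x → a :* q :+ (b :* q :+ (x :+ (con (ℤ.+ 0) :+ con (ℤ.+ 0)))) := (a :+ b) :* q :+ x) refl q (s 0F) (s 1F) (s 2F * B))
    cases 3F = trans (cong₂ _+_ (one (s 0F)) (cong₂ _+_ (one (s 1F)) (cong₂ _+_ (one (s 2F)) (cong (_+ 0ℚ) (eq (s 3F))))))
      (solve 5 (λ q a b c x → a :* q :+ (b :* q :+ (c :* q :+ (x :+ con (ℤ.+ 0)))) := (a :+ b :+ c) :* q :+ x) refl q (s 0F) (s 1F) (s 2F) (s 3F * B))

  ∑-below≡val : ∀ m (p : Vec Digit m) → ∑[ a ∈ words m ] below a p ≡ val p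
  ∑-below≡val zero    []      = +-identityʳ 0ℚ
  ∑-below≡val (suc m) (f ∷ p) = begin
    ∑[ a ∈ words (suc m) ] below a (f ∷ p)
      ≡⟨ ∑-words m _ ⟩
    ∑[ e ∈ digits ] ∑[ a ∈ words m ] below (e ∷ a) (f ∷ p)
      ≡⟨ ∑-cong digits (λ e → ∑-cong (words m) (λ a → *-identityˡ _)) ⟨
    ∑[ e ∈ digits ] ∑[ a ∈ words m ] (1ℚ * below (e ∷ a) (f ∷ p))
      ≡⟨ ∑-below m (λ _ → 1ℚ) f p ⟩
    partialSum (λ _ → 1ℚ) f * four m + 1ℚ * ∑[ a ∈ words m ] below a p
      ≡⟨ cong₂ (λ x z → x * four m + z) (counts f) (trans (*-identityˡ _) (∑-below≡val m p)) ⟩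
    val (f ∷ p) ∎
    where
    open ≡-Reasoning
    counts : ∀ f → partialSum (λ _ → 1ℚ) f ≡ ⌜ toℕ f ⌝
    counts 0F = refl
    counts 1F = refl
    counts 2F = sym (ι-+ (ℤ.+ 1) (ℤ.+ 1))
    counts 3F = sym (trans (ι-+ (ℤ.+ 2) (ℤ.+ 1)) (cong (_+ 1ℚ) (ι-+ (ℤ.+ 1) (ℤ.+ 1))))

  δ-refl : ∀ e → δ e e ≡ 1ℚ
  δ-refl e with e Fin.≟ e
  ... | yes _  = refl
  ... | no e≢e = contradiction refl e≢e

  δ-≢ : ∀ {e f} → e ≢ f → δ e f ≡ 0ℚ
  δ-≢ {e} {f} e≢f with e Fin.≟ f
  ... | yes e≡f = contradiction e≡f e≢f
  ... | no _    = refl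

  -- If p lies in a quarter to the right of the one containing R, all of `y R` is summed, and its
  -- mean is zero; to the left, nothing is summed. Otherwise the common digit is removed.
  summation : ∀ R m (p : Vec Digit m) → ∑[ a ∈ words m ] (y R a * below a p) ≡ g R p
  summation R       zero    []      = solve 0 (con (ℤ.+ 0) :* con (ℤ.+ 0) :+ con (ℤ.+ 0) := con (ℤ.+ 0)) refl
  summation []      (suc m) (f ∷ p) = begin
    ∑[ a ∈ words (suc m) ] (y [] a * below a (f ∷ p))
      ≡⟨ ∑-words m _ ⟩
    ∑[ e ∈ digits ] ∑[ a ∈ words m ] (slope e * below (e ∷ a) (f ∷ p))
      ≡⟨ ∑-below m slope f p ⟩
    partialSum slope f * four m + slope f * ∑[ a ∈ words m ] below a p
      ≡⟨ cong₂ (λ x z → x * four m + slope f * z) (heights f) (∑-below≡val m p) ⟩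
    height f * four m + slope f * val p ∎
    where
    open ≡-Reasoning
    heights : ∀ f → partialSum slope f ≡ height f
    heights 0F = refl
    heights 1F = refl
    heights 2F = sym (ι-+ (ℤ.+ 1) ℤ.-[1+ 2 ])
    heights 3F = sym (trans (ι-+ ℤ.-[1+ 1 ] (ℤ.+ 3)) (cong (_+ ⌜ 3 ⌝) (ι-+ (ℤ.+ 1) ℤ.-[1+ 2 ])))
  summation (e ∷ R) (suc m) (f ∷ p) = trans (begin
    ∑[ a ∈ words (suc m) ] (y (e ∷ R) a * below a (f ∷ p))
      ≡⟨ ∑-cong (words (suc m)) (λ a → *-comm (y (e ∷ R) a) _) ⟩
    ∑[ a ∈ words (suc m) ] (below a (f ∷ p) * y (e ∷ R) a)
      ≡⟨ Y.∑-child (λ a → below a (f ∷ p)) e R ⟩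
    ∑[ a ∈ words m ] (below (e ∷ a) (f ∷ p) * y R a) ∎) cases
    where
    open ≡-Reasoning
    cases : ∑[ a ∈ words m ] (below (e ∷ a) (f ∷ p) * y R a) ≡ δ f e * g R p
    cases with Fin.<-cmp e f
    ... | tri< _ e≢f _ = trans (y-mean R m)
      (trans (sym (zeroˡ (g R p))) (cong (_* g R p) (sym (δ-≢ (e≢f ∘ sym)))))
    ... | tri≈ _ refl _ = trans (∑-cong (words m) (λ a → *-comm _ (y R a)))
      (trans (summation R m p) (trans (sym (*-identityˡ _)) (cong (_* g R p) (sym (δ-refl e)))))
    ... | tri> _ e≢f _ = trans (trans (∑-cong (words m) (λ a → zeroˡ (y R a))) (∑-zero (words m)))
      (trans (sym (zeroˡ (g R p))) (cong (_* g R p) (sym (δ-≢ (e≢f ∘ sym)))))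

  summationᵈ : ∀ {m d} (R : Vec (List Digit) d) (p : Vec (Vec Digit m) d) →
    ∑[ a ∈ grid m d ] (yᵈ R a * belowᵈ a p) ≡ gᵈ R p
  summationᵈ []       []       = solve 0 (con (ℤ.+ 1) :* con (ℤ.+ 1) :+ con (ℤ.+ 0) := con (ℤ.+ 1)) refl
  summationᵈ {m} {suc d} (R ∷ Rs) (p ∷ ps) = begin
    ∑[ a ∈ grid m (suc d) ] (yᵈ (R ∷ Rs) a * belowᵈ a (p ∷ ps))
      ≡⟨ ∑-grid m d _ ⟩
    ∑[ a ∈ words m ] ∑[ as ∈ grid m d ] (y R a * yᵈ Rs as * (below a p * belowᵈ as ps))
      ≡⟨ ∑-cong (words m) (λ a → ∑-cong (grid m d) (λ as →
           solve 4 (λ x y b c → x :* y :* (b :* c) := x :* b :* (y :* c)) refl (y R a) (yᵈ Rs as) (below a p) (belowᵈ as ps))) ⟩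
    ∑[ a ∈ words m ] ∑[ as ∈ grid m d ] (y R a * below a p * (yᵈ Rs as * belowᵈ as ps))
      ≡⟨ ∑-product (words m) (grid m d) _ _ ⟩
    ∑[ a ∈ words m ] (y R a * below a p) * ∑[ as ∈ grid m d ] (yᵈ Rs as * belowᵈ as ps)
      ≡⟨ cong₂ _*_ (summation R m p) (summationᵈ Rs ps) ⟩
    g R p * gᵈ Rs ps ∎
    where open ≡-Reasoning

  -- Lower bound on the trace

  κ : ℚ
  κ = pow ¼ 3

  0≤κ : 0ℚ ≤ κ
  0≤κ = pow-nonneg 0≤¼ 3

  -- The term 5 (q - 2v)² of `g-root-norm` is dropped. The strict bound on the length guarantees
  -- that the interval still has quarters.
  g-lower : ∀ m R → length R ℕ.< m →
            pow (side m) 3 * pow κ (length R) ≤ ∑[ p ∈ words m ] (g R p) ²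
  g-lower (suc m) [] _ = begin
    pow (side (suc m)) 3 * 1ℚ
      ≡⟨ cong (λ x → pow x 3 * 1ℚ) (side-suc m) ⟩
    pow q 3 * 1ℚ
      ≡⟨ solve 1 (λ q → (q :* (q :* (q :* con (ℤ.+ 1)))) :* con (ℤ.+ 1) := q :* q :* q) refl q ⟩
    q ² * q
      ≡⟨ trans (∑-const (words m) _) (cong (q ² *_) (card-words m)) ⟨
    ∑[ w ∈ words m ] q ²
      ≤⟨ ∑-mono (words m) (λ w → subst (q ² ≤_) (+-comm _ (q ²)) (p≤q+p (*-nonneg 0≤⌜ 5 ⌝ (²-nonneg _)))) ⟩
    ∑[ w ∈ words m ] (q ² + ⌜ 5 ⌝ * (q - (val w + val w)) ²)
      ≡⟨ g-root-norm m ⟨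
    ∑[ e ∈ digits ] ∑[ w ∈ words m ] (height e * q + slope e * val w) ²
      ≡⟨ ∑-words m _ ⟨
    ∑[ p ∈ words (suc m) ] (g [] p) ² ∎
    where
    open ≤R
    q = four m
  g-lower (suc m) (f ∷ R) (ℕ.s≤s len<m) = begin
    pow (side (suc m)) 3 * (κ * pow κ (length R))
      ≡⟨ *-assoc _ κ _ ⟨
    pow (side (suc m)) 3 * κ * pow κ (length R)
      ≡⟨ cong (_* pow κ (length R)) (trans (sym (pow-* (side (suc m)) ¼ 3)) (cong (λ x → pow x 3) (side-step m))) ⟩
    pow (side m) 3 * pow κ (length R)
      ≤⟨ g-lower m R len<m ⟩
    ∑[ p ∈ words m ] (g R p) ²
      ≡⟨ ∑-cong (words m) (λ w → cong (_* g R w) (trans (cong (_* g R w) (δ-refl f)) (*-identityˡ _))) ⟨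
    ∑[ w ∈ words m ] (δ f f * g R w * g R w)
      ≡⟨ G.∑-child (g (f ∷ R)) f R ⟨
    ∑[ p ∈ words (suc m) ] (g (f ∷ R) p) ² ∎
    where open ≤R

  module _ (τ : ℕ) where
    open Hyperbolic τ

    -- The first two factors on the left count the boxes, the bracket is the lower bound on the
    -- squared norm common to all of them; `∑-codepth` provides one factor τ for each side but the
    -- last.
    g-trace : ∀ m d u → d ℕ.* τ ℕ.+ u ℕ.< m →
      pow ⌜ τ ⌝ d * four (d ℕ.* τ ℕ.+ u) * (pow (pow (side m) 3) (suc d) * pow κ (d ℕ.* τ ℕ.+ u))
        ≤ ∑[ R ∈ hyp d u ] ∑[ p ∈ grid m (suc d) ] (gᵈ R p) ²
    g-trace m zero u u<m = begin
      1ℚ * four u * (S * 1ℚ * pow κ u)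
        ≡⟨ solve 3 (λ f s k → con (ℤ.+ 1) :* f :* (s :* con (ℤ.+ 1) :* k) := s :* k :* f) refl (four u) S (pow κ u) ⟩
      S * pow κ u * four u
        ≡⟨ trans (∑-const (words u) _) (cong (S * pow κ u *_) (card-words u)) ⟨
      ∑[ R ∈ words u ] (S * pow κ u)
        ≤⟨ ∑-mono (words u) (λ R → subst (λ l → S * pow κ l ≤ ∑[ p ∈ words m ] (g (toList R) p) ²) (length-toList R)
             (g-lower m (toList R) (subst (ℕ._< m) (sym (length-toList R)) u<m))) ⟩
      ∑[ R ∈ words u ] ∑[ p ∈ words m ] (g (toList R) p) ²
        ≡⟨ ∑-cong (words u) (λ R → trans (∑-grid m 0 _) (∑-cong (words m) (λ p →
             solve 1 (λ x → x :* con (ℤ.+ 1) :* (x :* con (ℤ.+ 1)) :+ con (ℤ.+ 0) := x :* x) refl (g (toList R) p)))) ⟨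
      ∑[ R ∈ words u ] ∑[ p ∈ grid m 1 ] (gᵈ (toList R ∷ []) p) ²
        ≡⟨ ∑-hyp₀ u _ ⟨
      ∑[ R ∈ hyp 0 u ] ∑[ p ∈ grid m 1 ] (gᵈ R p) ² ∎
      where
      open ≤R
      S = pow (side m) 3
    g-trace m (suc d) u t<m = begin
      ⌜ τ ⌝ * T * four (suc d ℕ.* τ ℕ.+ u) * (S * Sᵈ * K)
        ≡⟨ cong (λ x → ⌜ τ ⌝ * T * x * (S * Sᵈ * K)) (trans (cong four (ℕ.+-assoc τ (d ℕ.* τ) u)) (pow-+ ⌜ 4 ⌝ τ (d ℕ.* τ ℕ.+ u))) ⟩
      ⌜ τ ⌝ * T * (four τ * four t) * (S * Sᵈ * K)
        ≡⟨ solve 7 (λ n T a b S s K → n :* T :* (a :* b) :* (S :* s :* K) := T :* b :* (S :* s :* K) :* (n :* a)) refl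
             ⌜ τ ⌝ T (four τ) (four t) S Sᵈ K ⟩
      T * four t * (S * Sᵈ * K) * (⌜ τ ⌝ * four τ)
        ≡⟨ cong (T * four t * (S * Sᵈ * K) *_) (∑-codepth τ) ⟨
      T * four t * (S * Sᵈ * K) * ∑[ R ∈ nodes τ ] four (codepth R)
        ≡⟨ ∑-*ˡ (nodes τ) _ _ ⟨
      ∑[ R ∈ nodes τ ] (T * four t * (S * Sᵈ * K) * four (codepth R))
        ≡⟨ ∑-cong (nodes τ) regroup ⟩
      ∑[ R ∈ nodes τ ] (S * pow κ (depth R) * (T * four (t′ R) * (Sᵈ * pow κ (t′ R))))
        ≤⟨ ∑-mono (nodes τ) (λ R → *-mono-≤ (*-nonneg 0≤S (pow-nonneg 0≤κ (depth R)))
             (∑-nonneg (rest R) (λ Rs → ∑-nonneg (grid m (suc d)) (λ ps → ²-nonneg _)))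
             (subst (λ l → S * pow κ l ≤ ∑[ p ∈ words m ] (g (path R) p) ²) (length-path R)
               (g-lower m (path R) (subst (ℕ._< m) (sym (length-path R)) (depth<m R))))
             (g-trace m d (codepth R ℕ.+ u) (ℕ.≤-<-trans (ℕ.m≤n+m (t′ R) (depth R)) (subst (ℕ._< m) (sym (exponent d u R)) t<m)))) ⟩
      ∑[ R ∈ nodes τ ] (∑[ p ∈ words m ] (g (path R) p) ² * ∑[ Rs ∈ rest R ] ∑[ ps ∈ grid m (suc d) ] (gᵈ Rs ps) ²)
        ≡⟨ ∑-cong (nodes τ) factor ⟨
      ∑[ R ∈ nodes τ ] ∑[ Rs ∈ rest R ] ∑[ p ∈ grid m (suc (suc d)) ] (gᵈ (path R ∷ Rs) p) ²
        ≡⟨ ∑-hyp d u _ ⟨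
      ∑[ R ∈ hyp (suc d) u ] ∑[ p ∈ grid m (suc (suc d)) ] (gᵈ R p) ² ∎
      where
      open ≤R
      S = pow (side m) 3
      Sᵈ = pow S (suc d)
      T = pow ⌜ τ ⌝ d
      t = d ℕ.* τ ℕ.+ u
      K = pow κ (suc d ℕ.* τ ℕ.+ u)
      t′ : Node τ → ℕ
      t′ R = d ℕ.* τ ℕ.+ (codepth R ℕ.+ u)
      rest : Node τ → List (Vec (List Digit) (suc d))
      rest R = hyp d (codepth R ℕ.+ u)
      0≤S : 0ℚ ≤ S
      0≤S = pow-nonneg (0≤side m) 3
      depth<m : ∀ R → depth R ℕ.< m
      depth<m R = ℕ.≤-<-trans (ℕ.m≤m+n (depth R) (t′ R)) (subst (ℕ._< m) (sym (exponent d u R)) t<m)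
      regroup : ∀ R → T * four t * (S * Sᵈ * K) * four (codepth R) ≡
                      S * pow κ (depth R) * (T * four (t′ R) * (Sᵈ * pow κ (t′ R)))
      regroup R = begin-equality
        T * four t * (S * Sᵈ * K) * four (codepth R)
          ≡⟨ cong (λ x → T * four t * (S * Sᵈ * x) * four (codepth R))
               (trans (cong (pow κ) (sym (exponent d u R))) (pow-+ κ (depth R) (t′ R))) ⟩
        T * four t * (S * Sᵈ * (pow κ (depth R) * pow κ (t′ R))) * four (codepth R)
          ≡⟨ solve 7 (λ T a b S s k l → T :* b :* (S :* s :* (k :* l)) :* a := S :* k :* (T :* (a :* b) :* (s :* l))) refl
               T (four (codepth R)) (four t) S Sᵈ (pow κ (depth R)) (pow κ (t′ R)) ⟩
        S * pow κ (depth R) * (T * (four (codepth R) * four t) * (Sᵈ * pow κ (t′ R)))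
          ≡⟨ cong (λ x → S * pow κ (depth R) * (T * x * (Sᵈ * pow κ (t′ R))))
               (trans (sym (pow-+ ⌜ 4 ⌝ (codepth R) t)) (cong four (shuffle (codepth R)))) ⟩
        S * pow κ (depth R) * (T * four (t′ R) * (Sᵈ * pow κ (t′ R))) ∎
        where
        shuffle : ∀ c → c ℕ.+ (d ℕ.* τ ℕ.+ u) ≡ d ℕ.* τ ℕ.+ (c ℕ.+ u)
        shuffle c = trans (sym (ℕ.+-assoc c (d ℕ.* τ) u)) (trans (cong (ℕ._+ u) (ℕ.+-comm c (d ℕ.* τ))) (ℕ.+-assoc (d ℕ.* τ) c u))
      factor : ∀ R → ∑[ Rs ∈ rest R ] ∑[ p ∈ grid m (suc (suc d)) ] (gᵈ (path R ∷ Rs) p) ² ≡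
        ∑[ p ∈ words m ] (g (path R) p) ² * ∑[ Rs ∈ rest R ] ∑[ ps ∈ grid m (suc d) ] (gᵈ Rs ps) ²
      factor R = trans (∑-cong (rest R) (λ Rs → trans (∑-grid m (suc d) _) (trans
        (∑-cong (words m) (λ p → ∑-cong (grid m (suc d)) (λ ps →
          solve 2 (λ x y → x :* y :* (x :* y) := x :* x :* (y :* y)) refl (g (path R) p) (gᵈ Rs ps))))
        (∑-product (words m) (grid m (suc d)) _ _))))
        (∑-*ˡ (rest R) _ _)

  -- Constants, and the selection applied to the grid

  ⌜⌝-cancel : ∀ {m n} → ⌜ m ⌝ ≤ ⌜ n ⌝ → m ℕ.≤ n
  ⌜⌝-cancel {m} {n} (ℚ.*≤* le) = ℤ.drop‿+≤+ (subst₂ ℤ._≤_ (ℤ.*-identityʳ (ℤ.+ m)) (ℤ.*-identityʳ (ℤ.+ n)) le)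

  ⌜⌝-^ : ∀ a n → ⌜ a ℕ.^ n ⌝ ≡ pow ⌜ a ⌝ n
  ⌜⌝-^ a zero    = refl
  ⌜⌝-^ a (suc n) = trans (⌜⌝-* a (a ℕ.^ n)) (cong (⌜ a ⌝ *_) (⌜⌝-^ a n))

  pow-pos : ∀ {x} → 0ℚ < x → ∀ n → 0ℚ < pow x n
  pow-pos 0<x zero    = ℚ.positive⁻¹ 1ℚ
  pow-pos 0<x (suc n) = *-pos 0<x (pow-pos 0<x n)

  0<⌜suc_⌝ : ∀ n → 0ℚ < ⌜ suc n ⌝
  0<⌜suc n ⌝ = ℚ.positive⁻¹ ⌜ suc n ⌝

  pow-1 : ∀ n → pow 1ℚ n ≡ 1ℚ
  pow-1 zero    = refl
  pow-1 (suc n) = trans (*-identityˡ _) (pow-1 n)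

  pow-pow : ∀ x k n → pow (pow x k) n ≡ pow (pow x n) k
  pow-pow x zero    n = pow-1 n
  pow-pow x (suc k) n = trans (pow-* x (pow x k) n) (cong (pow x n *_) (pow-pow x k n))

  -- In fractions: D ≤ s L / (e Q), so L s b ≤ h s² L² / e² ≤ s L². Everything is multiplied out to
  -- stay in ℕ.
  cancel-bound : ∀ c e h L s b Q D T .{{_ : ℕ.NonZero c}} .{{_ : ℕ.NonZero e}} .{{_ : ℕ.NonZero L}} .{{_ : ℕ.NonZero s}} →
    L ℕ.* s ℕ.* b ℕ.≤ h ℕ.* (Q ℕ.* Q) ℕ.* (D ℕ.* D) → T ℕ.* Q ≡ c ℕ.* s ℕ.* L →
    c ℕ.* e ℕ.* D ℕ.≤ T → h ℕ.* s ℕ.≤ e ℕ.* e → b ℕ.≤ L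
  cancel-bound c e h L s b Q D T bad TQ D≤ hs≤ = ℕ.*-cancelˡ-≤ (c ℕ.* c ℕ.* (L ℕ.* s) ℕ.* (e ℕ.* e)) {{nonZero}} (begin
    c ℕ.* c ℕ.* (L ℕ.* s) ℕ.* (e ℕ.* e) ℕ.* b
      ≡⟨ solveℕ 5 (λ c e L s b → c ⊠ c ⊠ (L ⊠ s) ⊠ (e ⊠ e) ⊠ b ≜ L ⊠ s ⊠ b ⊠ (c ⊠ e ⊠ (c ⊠ e))) refl c e L s b ⟩
    L ℕ.* s ℕ.* b ℕ.* (c ℕ.* e ℕ.* (c ℕ.* e))
      ≤⟨ ℕ.*-monoˡ-≤ (c ℕ.* e ℕ.* (c ℕ.* e)) bad ⟩
    h ℕ.* (Q ℕ.* Q) ℕ.* (D ℕ.* D) ℕ.* (c ℕ.* e ℕ.* (c ℕ.* e))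
      ≡⟨ solveℕ 5 (λ c e h Q D → h ⊠ (Q ⊠ Q) ⊠ (D ⊠ D) ⊠ (c ⊠ e ⊠ (c ⊠ e)) ≜ h ⊠ (Q ⊠ Q) ⊠ (c ⊠ e ⊠ D ⊠ (c ⊠ e ⊠ D))) refl c e h Q D ⟩
    h ℕ.* (Q ℕ.* Q) ℕ.* (c ℕ.* e ℕ.* D ℕ.* (c ℕ.* e ℕ.* D))
      ≤⟨ ℕ.*-monoʳ-≤ (h ℕ.* (Q ℕ.* Q)) (ℕ.*-mono-≤ D≤ D≤) ⟩
    h ℕ.* (Q ℕ.* Q) ℕ.* (T ℕ.* T)
      ≡⟨ solveℕ 3 (λ h Q T → h ⊠ (Q ⊠ Q) ⊠ (T ⊠ T) ≜ h ⊠ (T ⊠ Q ⊠ (T ⊠ Q))) refl h Q T ⟩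
    h ℕ.* (T ℕ.* Q ℕ.* (T ℕ.* Q))
      ≡⟨ cong (λ x → h ℕ.* (x ℕ.* x)) TQ ⟩
    h ℕ.* (c ℕ.* s ℕ.* L ℕ.* (c ℕ.* s ℕ.* L))
      ≡⟨ solveℕ 4 (λ c h s L → h ⊠ (c ⊠ s ⊠ L ⊠ (c ⊠ s ⊠ L)) ≜ h ⊠ s ⊠ (c ⊠ c ⊠ (L ⊠ s) ⊠ L)) refl c h s L ⟩
    h ℕ.* s ℕ.* (c ℕ.* c ℕ.* (L ℕ.* s) ℕ.* L)
      ≤⟨ ℕ.*-monoˡ-≤ (c ℕ.* c ℕ.* (L ℕ.* s) ℕ.* L) hs≤ ⟩
    e ℕ.* e ℕ.* (c ℕ.* c ℕ.* (L ℕ.* s) ℕ.* L)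
      ≡⟨ solveℕ 4 (λ c e s L → e ⊠ e ⊠ (c ⊠ c ⊠ (L ⊠ s) ⊠ L) ≜ c ⊠ c ⊠ (L ⊠ s) ⊠ (e ⊠ e) ⊠ L) refl c e s L ⟩
    c ℕ.* c ℕ.* (L ℕ.* s) ℕ.* (e ℕ.* e) ℕ.* L ∎)
    where
    open ℕ.≤-Reasoning
    nonZero : ℕ.NonZero (c ℕ.* c ℕ.* (L ℕ.* s) ℕ.* (e ℕ.* e))
    nonZero = ℕ.m*n≢0 _ _ {{ℕ.m*n≢0 _ _ {{ℕ.m*n≢0 c c}} {{ℕ.m*n≢0 L s}}}} {{ℕ.m*n≢0 e e}}

  -- The dimension is F = f + 1, and `K-eq` ties ℓ to the number of boxes; the summand 0 is the
  -- initial `u` of `hyp`.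
  module Bound (f τ ℓ : ℕ) (K-eq : τ ℕ.^ f ℕ.* 4 ℕ.^ (f ℕ.* τ ℕ.+ 0) ≡ 10 ℕ.* 6 ℕ.^ suc f ℕ.* suc ℓ) where
    open Hyperbolic τ

    F t m : ℕ
    F = suc f
    t = f ℕ.* τ ℕ.+ 0
    m = suc t

    LatticePoint : Set
    LatticePoint = Vec (Vec Digit m) F

    open Selection {LatticePoint} {Vec (List Digit) F} (hyp f 0)

    v : Family
    v p R = gᵈ R p

    -- `Z` is the common lower bound on the squared norms of the functions `gᵈ R`, and `s` is the
    -- trace left after all selections, averaged over the N grid points.
    P W X Z s N : ℚ
    P = four t
    W = pow ¼ t
    X = pow P F
    Z = pow X 3 * pow W 3
    N = card (grid m F)
    s = ⌜ 4 ⌝ * ⌜ suc ℓ ⌝ * pow ⌜ 6 ⌝ F * Z * inv N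

    PW≡1 : P * W ≡ 1ℚ
    PW≡1 = trans (sym (pow-* ⌜ 4 ⌝ ¼ t)) (trans (cong (λ x → pow x t) 4*¼) (pow-1 t))

    0<P : 0ℚ < P
    0<P = pow-pos 0<⌜suc 3 ⌝ t

    0<W : 0ℚ < W
    0<W = pow-pos (ℚ.positive⁻¹ ¼) t

    0<X : 0ℚ < X
    0<X = pow-pos 0<P F

    0<Z : 0ℚ < Z
    0<Z = *-pos (pow-pos 0<X 3) (pow-pos 0<W 3)

    N≡ : N ≡ pow ⌜ 4 ⌝ F * X
    N≡ = trans (card-grid m F) (pow-* ⌜ 4 ⌝ P F)

    0<N : 0ℚ < N
    0<N = subst (0ℚ <_) (sym N≡) (*-pos (pow-pos 0<⌜suc 3 ⌝ F) 0<X)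

    sN : s * N ≡ ⌜ 4 ⌝ * ⌜ suc ℓ ⌝ * pow ⌜ 6 ⌝ F * Z
    sN = begin
      A * inv N * N   ≡⟨ *-assoc A (inv N) N ⟩
      A * (inv N * N) ≡⟨ cong (A *_) (trans (*-comm (inv N) N) (inv-right 0<N)) ⟩
      A * 1ℚ          ≡⟨ *-identityʳ A ⟩
      A               ∎
      where
      open ≡-Reasoning
      A = ⌜ 4 ⌝ * ⌜ suc ℓ ⌝ * pow ⌜ 6 ⌝ F * Z

    0<A : 0ℚ < ⌜ suc ℓ ⌝ * pow ⌜ 6 ⌝ F * Z
    0<A = *-pos (*-pos 0<⌜suc ℓ ⌝ (pow-pos 0<⌜suc 5 ⌝ F)) 0<Z

    0<s : 0ℚ < s
    0<s = ℚ.≰⇒> λ s≤0 → ℚ.<-irrefl refl (begin-strict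
      0ℚ  <⟨ *-pos 0<⌜suc 3 ⌝ 0<A ⟩
      ⌜ 4 ⌝ * (⌜ suc ℓ ⌝ * pow ⌜ 6 ⌝ F * Z)
          ≡⟨ solve 4 (λ a b c d → a :* (b :* c :* d) := a :* b :* c :* d) refl ⌜ 4 ⌝ ⌜ suc ℓ ⌝ (pow ⌜ 6 ⌝ F) Z ⟩
      ⌜ 4 ⌝ * ⌜ suc ℓ ⌝ * pow ⌜ 6 ⌝ F * Z ≡⟨ sN ⟨
      s * N  ≤⟨ *-monoˡ-≤ (ℚ.<⇒≤ 0<N) s≤0 ⟩
      0ℚ * N ≡⟨ zeroˡ N ⟩
      0ℚ     ∎)
      where open ≤R

    c-g c-y : ℚ
    c-g = pow (g-norm m) F * pow κ t
    c-y = pow (y-norm m) F * pow ¼ t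

    Z≡ : pow (pow (side m) 3) F * pow κ t ≡ Z
    Z≡ = cong₂ _*_ (trans (cong (λ x → pow (pow x 3) F) (side-suc t)) (pow-pow P 3 F)) (pow-pow ¼ 3 t)

    c-g≡ : c-g ≡ pow ⌜ 6 ⌝ F * Z
    c-g≡ = trans (cong (_* pow κ t) (pow-* ⌜ 6 ⌝ (pow (side m) 3) F)) (trans (*-assoc (pow ⌜ 6 ⌝ F) _ _) (cong (pow ⌜ 6 ⌝ F *_) Z≡))

    c-y≡ : c-y ≡ pow ⌜ 20 ⌝ F * (X * W)
    c-y≡ = trans (cong (_* W) (trans (cong (λ x → pow (⌜ 20 ⌝ * x) F) (side-suc t)) (pow-* ⌜ 20 ⌝ P F))) (*-assoc (pow ⌜ 20 ⌝ F) X W)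

    K≡ : pow ⌜ τ ⌝ f * P ≡ ⌜ 10 ⌝ * pow ⌜ 6 ⌝ F * ⌜ suc ℓ ⌝
    K≡ = begin
      pow ⌜ τ ⌝ f * P                     ≡⟨ cong₂ _*_ (⌜⌝-^ τ f) (⌜⌝-^ 4 t) ⟨
      ⌜ τ ℕ.^ f ⌝ * ⌜ 4 ℕ.^ t ⌝           ≡⟨ ⌜⌝-* (τ ℕ.^ f) (4 ℕ.^ t) ⟨
      ⌜ τ ℕ.^ f ℕ.* 4 ℕ.^ t ⌝             ≡⟨ cong ⌜_⌝ K-eq ⟩
      ⌜ 10 ℕ.* 6 ℕ.^ F ℕ.* suc ℓ ⌝        ≡⟨ trans (⌜⌝-* (10 ℕ.* 6 ℕ.^ F) (suc ℓ)) (cong (_* ⌜ suc ℓ ⌝) (trans (⌜⌝-* 10 (6 ℕ.^ F)) (cong (⌜ 10 ⌝ *_) (⌜⌝-^ 6 F)))) ⟩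
      ⌜ 10 ⌝ * pow ⌜ 6 ⌝ F * ⌜ suc ℓ ⌝    ∎
      where open ≡-Reasoning

    bessel : ∀ w → ∑[ p ∈ grid m F ] ⟨ v p , w ⟩ ² ≤ c-g * ⟨ w , w ⟩
    bessel w = subst (_≤ c-g * ⟨ w , w ⟩) (∑-cong (grid m F) (λ p → cong _² (⟨⟩-comm w (v p)))) (g-bessel τ m f 0 w)

    -- Here 10 = 4 + 5 + 1: 4 for the remaining trace `s * N`, 5 for the selections, and 1 to make
    -- the inequality strict.
    trace : s * card (grid m F) + ⌜ suc ℓ ℕ.* 5 ⌝ * c-g < ∑[ p ∈ grid m F ] ⟨ v p , v p ⟩
    trace = begin-strict
      s * N + ⌜ suc ℓ ℕ.* 5 ⌝ * c-g
        ≡⟨ cong₂ _+_ sN (cong₂ _*_ (⌜⌝-* (suc ℓ) 5) c-g≡) ⟩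
      ⌜ 4 ⌝ * L * S * Z + L * ⌜ 5 ⌝ * (S * Z)
        ≡⟨ solve 3 (λ l s z → con (ℤ.+ 4) :* l :* s :* z :+ l :* con (ℤ.+ 5) :* (s :* z) := con (ℤ.+ 0) :+ con (ℤ.+ 9) :* (l :* s :* z)) refl L S Z ⟩
      0ℚ + ⌜ 9 ⌝ * (L * S * Z)
        <⟨ +-mono-<-≤ 0<A (ℚ.≤-refl {⌜ 9 ⌝ * (L * S * Z)}) ⟩
      L * S * Z + ⌜ 9 ⌝ * (L * S * Z)
        ≡⟨ solve 3 (λ l s z → l :* s :* z :+ con (ℤ.+ 9) :* (l :* s :* z) := con (ℤ.+ 10) :* s :* l :* z) refl L S Z ⟩
      ⌜ 10 ⌝ * S * L * Z
        ≡⟨ cong₂ _*_ K≡ Z≡ ⟨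
      pow ⌜ τ ⌝ f * P * (pow (pow (side m) 3) F * pow κ t)
        ≤⟨ g-trace τ m f 0 ℕ.≤-refl ⟩
      ∑[ R ∈ hyp f 0 ] ∑[ p ∈ grid m F ] (gᵈ R p) ²
        ≡⟨ ∑-swap (hyp f 0) (grid m F) (λ R p → (gᵈ R p) ²) ⟩
      ∑[ p ∈ grid m F ] ⟨ v p , v p ⟩ ∎
      where
      open ≤R
      L = ⌜ suc ℓ ⌝
      S = pow ⌜ 6 ⌝ F

    opaque
      selected : ∃[ ps ] Separated s v {suc ℓ ℕ.* 5} ps
      selected = select (grid m F) c-g 0≤c 0<s (suc ℓ ℕ.* 5) v bessel trace
        where
        0≤c : 0ℚ ≤ c-g
        0≤c = subst (0ℚ ≤_) (sym c-g≡) (ℚ.<⇒≤ (*-pos (pow-pos 0<⌜suc 5 ⌝ F) 0<Z))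

    points : Vec LatticePoint (suc ℓ ℕ.* 5)
    points = proj₁ selected

    points-distinct : Distinct points
    points-distinct = separated-distinct 0<s v points (proj₂ selected)

    discrepancy : ∀ {k} → Vec LatticePoint k → Vec Trit k → LatticePoint → ℚ
    discrepancy []       []       a = 0ℚ
    discrepancy (p ∷ ps) (x ∷ xs) a = tri x * belowᵈ a p + discrepancy ps xs a

    combination-discrepancy : ∀ {k} (ps : Vec LatticePoint k) xs R →
      combination v ps xs R ≡ ∑[ a ∈ grid m F ] (yᵈ R a * discrepancy ps xs a)
    combination-discrepancy []       []       R =
      sym (trans (∑-cong (grid m F) (λ a → zeroʳ (yᵈ R a))) (∑-zero (grid m F)))
    combination-discrepancy (p ∷ ps) (x ∷ xs) R = sym (begin
      ∑[ a ∈ grid m F ] (yᵈ R a * (tri x * belowᵈ a p + discrepancy ps xs a))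
        ≡⟨ ∑-cong (grid m F) (λ a → solve 4 (λ y x b d → y :* (x :* b :+ d) := x :* (y :* b) :+ y :* d) refl
             (yᵈ R a) (tri x) (belowᵈ a p) (discrepancy ps xs a)) ⟩
      ∑[ a ∈ grid m F ] (tri x * (yᵈ R a * belowᵈ a p) + yᵈ R a * discrepancy ps xs a)
        ≡⟨ trans (∑-+ (grid m F) _ _) (cong₂ _+_ (∑-*ˡ (grid m F) (tri x) _) (sym (combination-discrepancy ps xs R))) ⟩
      tri x * ∑[ a ∈ grid m F ] (yᵈ R a * belowᵈ a p) + combination v ps xs R
        ≡⟨ cong (λ z → tri x * z + combination v ps xs R) (summationᵈ R p) ⟩
      tri x * gᵈ R p + combination v ps xs R ∎)
      where open ≡-Reasoning

    -- `y-bessel` bounds the map from coefficients to functions on the grid; S_x arises from the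
    -- transposed map, which has the same bound.
    combination-bound : ∀ {k} (ps : Vec LatticePoint k) xs D → (∀ a → (discrepancy ps xs a) ² ≤ ⌜ D ⌝ ²) →
      ⟨ combination v ps xs , combination v ps xs ⟩ ≤ c-y * (⌜ D ⌝ ² * N)
    combination-bound ps xs D bound = begin
      ⟨ combination v ps xs , combination v ps xs ⟩
        ≡⟨ ∑-cong (hyp f 0) (λ R → cong _² (combination-discrepancy ps xs R)) ⟩
      ∑[ R ∈ hyp f 0 ] (∑[ a ∈ grid m F ] (yᵈ R a * discrepancy ps xs a)) ²
        ≤⟨ transpose-bound (grid m F) (hyp f 0) yᵈ c-y 0<c (y-bessel τ m f 0) (discrepancy ps xs) ⟩
      c-y * ∑[ a ∈ grid m F ] (discrepancy ps xs a) ²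
        ≤⟨ *-monoʳ-≤ (ℚ.<⇒≤ 0<c) (∑-mono (grid m F) bound) ⟩
      c-y * ∑[ a ∈ grid m F ] ⌜ D ⌝ ²
        ≡⟨ cong (c-y *_) (∑-const (grid m F) _) ⟩
      c-y * (⌜ D ⌝ ² * N) ∎
      where
      open ≤R
      0<c : 0ℚ < c-y
      0<c = subst (0ℚ <_) (sym c-y≡) (*-pos (pow-pos 0<⌜suc 19 ⌝ F) (*-pos 0<X 0<W))

    -- After multiplication by N the factor `⌜ 4 ⌝ * Z` cancels and leaves integers. In 320 = 20 ·
    -- 4², the 20 comes from `y-norm` and each 4 from one of the two factors N = 4ᶠ X, with exponent
    -- F.
    badness≤disc² : ∀ xs D → (∀ a → (discrepancy points xs a) ² ≤ ⌜ D ⌝ ²) →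
      suc ℓ ℕ.* 6 ℕ.^ F ℕ.* badness v points xs ℕ.≤ 320 ℕ.^ F ℕ.* (4 ℕ.^ t ℕ.* 4 ℕ.^ t) ℕ.* (D ℕ.* D)
    badness≤disc² xs D bound = ⌜⌝-cancel (*-cancel-≤ 0<M (begin
      M * ⌜ suc ℓ ℕ.* 6 ℕ.^ F ℕ.* b ⌝
        ≡⟨ cong (M *_) (trans (⌜⌝-* (suc ℓ ℕ.* 6 ℕ.^ F) b) (cong (_* ⌜ b ⌝) (trans (⌜⌝-* (suc ℓ) (6 ℕ.^ F)) (cong (⌜ suc ℓ ⌝ *_) (⌜⌝-^ 6 F))))) ⟩
      M * (⌜ suc ℓ ⌝ * pow ⌜ 6 ⌝ F * ⌜ b ⌝)
        ≡⟨ solve 5 (λ x w l s b → con (ℤ.+ 4) :* (x :* (x :* (x :* con (ℤ.+ 1))) :* (w :* (w :* (w :* con (ℤ.+ 1))))) :* (l :* s :* b)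
             := con (ℤ.+ 4) :* l :* s :* (x :* (x :* (x :* con (ℤ.+ 1))) :* (w :* (w :* (w :* con (ℤ.+ 1))))) :* b) refl X W ⌜ suc ℓ ⌝ (pow ⌜ 6 ⌝ F) ⌜ b ⌝ ⟩
      ⌜ 4 ⌝ * ⌜ suc ℓ ⌝ * pow ⌜ 6 ⌝ F * Z * ⌜ b ⌝
        ≡⟨ trans (cong (_* ⌜ b ⌝) (sym sN)) (solve 3 (λ s n b → s :* n :* b := n :* (s :* b)) refl s N ⌜ b ⌝) ⟩
      N * (s * ⌜ b ⌝)
        ≤⟨ *-monoʳ-≤ (ℚ.<⇒≤ 0<N) (ℚ.≤-trans (badness-bound 0<s v points (proj₂ selected) xs)
             (*-monoʳ-≤ 0≤⌜ 4 ⌝ (combination-bound points xs D bound))) ⟩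
      N * (⌜ 4 ⌝ * (c-y * (⌜ D ⌝ ² * N)))
        ≡⟨ cong₂ (λ n c → n * (⌜ 4 ⌝ * (c * (⌜ D ⌝ ² * n)))) N≡ c-y≡ ⟩
      pow ⌜ 4 ⌝ F * X * (⌜ 4 ⌝ * (pow ⌜ 20 ⌝ F * (X * W) * (⌜ D ⌝ ² * (pow ⌜ 4 ⌝ F * X))))
        ≡⟨ solve 5 (λ q h x w d → q :* x :* (con (ℤ.+ 4) :* (h :* (x :* w) :* (d :* d :* (q :* x))))
             := con (ℤ.+ 4) :* (x :* (x :* (x :* con (ℤ.+ 1))) :* w) :* (h :* (q :* q) :* (d :* d))) refl
             (pow ⌜ 4 ⌝ F) (pow ⌜ 20 ⌝ F) X W ⌜ D ⌝ ⟩
      ⌜ 4 ⌝ * (pow X 3 * W) * (pow ⌜ 20 ⌝ F * (pow ⌜ 4 ⌝ F * pow ⌜ 4 ⌝ F) * ⌜ D ⌝ ²)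
        -- P W = 1 turns W into W³ P², which brings out the factor `Z`.
        ≡⟨ cong₂ (λ x y → ⌜ 4 ⌝ * (pow X 3 * x) * (y * ⌜ D ⌝ ²)) W≡ 320≡ ⟩
      ⌜ 4 ⌝ * (pow X 3 * (pow W 3 * (P * P))) * (⌜ 320 ℕ.^ F ⌝ * ⌜ D ⌝ ²)
        ≡⟨ solve 5 (λ x w p h d → con (ℤ.+ 4) :* (x :* (w :* (p :* p))) :* (h :* (d :* d))
             := con (ℤ.+ 4) :* (x :* w) :* (h :* (p :* p) :* (d :* d))) refl (pow X 3) (pow W 3) P ⌜ 320 ℕ.^ F ⌝ ⌜ D ⌝ ⟩
      M * (⌜ 320 ℕ.^ F ⌝ * (P * P) * ⌜ D ⌝ ²)
        ≡⟨ cong (M *_) (begin-equality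
             ⌜ 320 ℕ.^ F ⌝ * (P * P) * ⌜ D ⌝ ²
               ≡⟨ cong₂ (λ x y → ⌜ 320 ℕ.^ F ⌝ * x * y) (trans (⌜⌝-* (4 ℕ.^ t) (4 ℕ.^ t)) (cong _² (⌜⌝-^ 4 t))) (⌜⌝-* D D) ⟨
             ⌜ 320 ℕ.^ F ⌝ * ⌜ 4 ℕ.^ t ℕ.* 4 ℕ.^ t ⌝ * ⌜ D ℕ.* D ⌝
               ≡⟨ trans (⌜⌝-* (320 ℕ.^ F ℕ.* (4 ℕ.^ t ℕ.* 4 ℕ.^ t)) (D ℕ.* D)) (cong (_* ⌜ D ℕ.* D ⌝) (⌜⌝-* (320 ℕ.^ F) _)) ⟨
             ⌜ 320 ℕ.^ F ℕ.* (4 ℕ.^ t ℕ.* 4 ℕ.^ t) ℕ.* (D ℕ.* D) ⌝ ∎) ⟩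
      M * ⌜ 320 ℕ.^ F ℕ.* (4 ℕ.^ t ℕ.* 4 ℕ.^ t) ℕ.* (D ℕ.* D) ⌝ ∎))
      where
      open ≤R
      b = badness v points xs
      M = ⌜ 4 ⌝ * Z
      0<M : 0ℚ < M
      0<M = *-pos 0<⌜suc 3 ⌝ 0<Z
      W≡ : W ≡ pow W 3 * (P * P)
      W≡ = sym (begin-equality
        pow W 3 * (P * P)        ≡⟨ solve 2 (λ w p → w :* (w :* (w :* con (ℤ.+ 1))) :* (p :* p) := w :* (p :* w) :* (p :* w)) refl W P ⟩
        W * (P * W) * (P * W)    ≡⟨ cong (λ x → W * x * x) PW≡1 ⟩
        W * 1ℚ * 1ℚ              ≡⟨ trans (*-identityʳ _) (*-identityʳ W) ⟩
        W                        ∎)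
      320≡ : pow ⌜ 20 ⌝ F * (pow ⌜ 4 ⌝ F * pow ⌜ 4 ⌝ F) ≡ ⌜ 320 ℕ.^ F ⌝
      320≡ = begin-equality
        pow ⌜ 20 ⌝ F * (pow ⌜ 4 ⌝ F * pow ⌜ 4 ⌝ F) ≡⟨ cong (pow ⌜ 20 ⌝ F *_) (pow-* ⌜ 4 ⌝ ⌜ 4 ⌝ F) ⟨
        pow ⌜ 20 ⌝ F * pow (⌜ 4 ⌝ * ⌜ 4 ⌝) F        ≡⟨ pow-* ⌜ 20 ⌝ (⌜ 4 ⌝ * ⌜ 4 ⌝) F ⟨
        pow (⌜ 20 ⌝ * (⌜ 4 ⌝ * ⌜ 4 ⌝)) F            ≡⟨ cong (λ x → pow x F) (trans (⌜⌝-* 20 16) (cong (⌜ 20 ⌝ *_) (⌜⌝-* 4 4))) ⟨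
        pow ⌜ 320 ⌝ F                              ≡⟨ ⌜⌝-^ 320 F ⟨
        ⌜ 320 ℕ.^ F ⌝                              ∎

    some-large-discrepancy : (x : ∀ J → Fin (size J) → Sign) (D : Subset (suc ℓ ℕ.* 5) → ℕ) →
      (∀ J a → (discrepancy points (extend J (x J)) a) ² ≤ ⌜ D J ⌝ ²) →
      ¬ (∀ J → 10 ℕ.* 44 ℕ.^ F ℕ.* D J ℕ.≤ τ ℕ.^ f)
    some-large-discrepancy x D bound small = some-bad v ℓ points x (λ J →
      cancel-bound 10 (44 ℕ.^ F) (320 ℕ.^ F) (suc ℓ) (6 ℕ.^ F) (badness v points (extend J (x J))) (4 ℕ.^ t) (D J) (τ ℕ.^ f)
        {{_}} {{ℕ.m^n≢0 44 F}} {{_}} {{ℕ.m^n≢0 6 F}}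
        (badness≤disc² (extend J (x J)) (D J) (bound J)) K-eq (small J)
        -- 320 · 6 = 1920 ≤ 1936 = 44², and 44 is the least integer with this property.
        (subst₂ ℕ._≤_ (^-distribʳ-* F 320 6) (^-distribʳ-* F 44 44) (ℕ.^-monoˡ-≤ F (ℕ.≤ᵇ⇒≤ 1920 1936 _))))

open import Defs
open LinearAlgebra using
  ( ι; ι-+; ι-*; ⌜_⌝; ⌜⌝-*; ⌜⌝-mono; 0≤⌜_⌝; 0<⌜suc_⌝; zeroˡ; zeroʳ; +-identityˡ
  ; *-identityˡ; *-identityʳ; *-comm; *-assoc; *-monoʳ-≤; *≡; _²; inv; inv-right; inv-nonneg
  ; Digit; below; belowᵈ; tri; trit; extend; size; size≤; Distinct; ^-distribʳ-*; module Bound )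
  renaming (_+_ to _⊕_; _*_ to _⊛_)

-- Discrepancy of sets of lattice points

least : ∀ {A : Pred ℕ 0ℓ} → Decidable A → ∀ k → A k → ∃[ m ] IsMin A m
least {A} A? k Ak with search (suc k)
  where
  search : ∀ k → (∀ j → j ℕ.< k → ¬ A j) ⊎ ∃[ m ] IsMin A m
  search zero = inj₁ λ _ ()
  search (suc k) with search k
  ... | inj₂ found = inj₂ found
  ... | inj₁ none with A? k
  ...   | yes Ak = inj₂ (k , Ak , λ j Aj → ℕ.≮⇒≥ (λ j<k → none j j<k Aj))
  ...   | no ¬Ak = inj₁ λ j j<1+k Aj → none j (ℕ.≤∧≢⇒< (ℕ.s≤s⁻¹ j<1+k) (λ { refl → ¬Ak Aj })) Aj
... | inj₁ none  = contradiction Ak (none k ℕ.≤-refl)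
... | inj₂ found = found

greatest : ∀ {A : Pred ℕ 0ℓ} → Decidable A → ∀ {k} → A k → ∀ b → (∀ j → A j → j ℕ.≤ b) → ∃[ m ] IsMax A m
greatest {A} A? {k} Ak zero    bound = 0 , subst A (ℕ.n≤0⇒n≡0 (bound k Ak)) Ak , bound
greatest {A} A? {k} Ak (suc b) bound with A? (suc b)
... | yes Ab = suc b , Ab , bound
... | no ¬Ab = greatest A? Ak b (λ j Aj → ℕ.s≤s⁻¹ (ℕ.≤∧≢⇒< (bound j Aj) (λ { refl → ¬Ab Aj })))

module _ {n} {𝓕 : SetSystem n} (𝓕? : Decidable 𝓕) {F₀ : Subset n} (F₀∈𝓕 : 𝓕 F₀) where

  ∣signedSum∣≤n : ∀ x F → ℤ.∣ signedSum {n} x F ∣ ℕ.≤ n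
  ∣signedSum∣≤n x F = go (λ v → if lookup F v then x v ◃ 1 else ℤ.+ 0) (λ v → small (lookup F v) (x v))
    where
    small : ∀ b s → ℤ.∣ (if b then s ◃ 1 else ℤ.+ 0) ∣ ℕ.≤ 1
    small true  Sign.+ = ℕ.≤-refl
    small true  Sign.- = ℕ.≤-refl
    small false s      = ℕ.z≤n
    go : ∀ {n} (f : Fin n → ℤ) → (∀ i → ℤ.∣ f i ∣ ℕ.≤ 1) → ℤ.∣ sum f ∣ ℕ.≤ n
    go {zero}  f le = ℕ.z≤n
    go {suc n} f le = ℕ.≤-trans (ℤ.∣i+j∣≤∣i∣+∣j∣ (f zero) (sum (f ∘ suc))) (ℕ.+-mono-≤ (le zero) (go (f ∘ suc) (le ∘ suc)))

  discUnder : ∀ x → ∃[ k ] IsDiscUnder 𝓕 x k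
  discUnder x = greatest
    (λ k → anySubset? (λ F → 𝓕? F ×-dec (k ℕ.≟ ℤ.∣ signedSum x F ∣)))
    (F₀ , F₀∈𝓕 , refl) n (λ { k (F , _ , refl) → ∣signedSum∣≤n x F })

  private
    colour : Subset n → Colouring n
    colour s i = if lookup s i then Sign.+ else Sign.-

    positive : Sign → Bool
    positive Sign.+ = true
    positive Sign.- = false

    encode : Colouring n → Subset n
    encode x = tabulate (positive ∘ x)

    colour-encode : ∀ x i → colour (encode x) i ≡ x i
    colour-encode x i = trans
      (cong (λ b → if b then Sign.+ else Sign.-) (lookup∘tabulate (positive ∘ x) i)) (decode (x i))
      where
      decode : ∀ s → (if positive s then Sign.+ else Sign.-) ≡ s
      decode Sign.+ = refl
      decode Sign.- = refl

    signedSum-cong : ∀ {x x′ : Colouring n} → (∀ i → x i ≡ x′ i) → ∀ F → signedSum x F ≡ signedSum x′ F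
    signedSum-cong eq F = sum-cong-≗ (λ i → cong (λ s → if lookup F i then s ◃ 1 else ℤ.+ 0) (eq i))

    value : Subset n → ℕ
    value s = proj₁ (discUnder (colour s))

  -- The search runs over subsets that encode colourings. Encoding recovers a colouring only
  -- pointwise, which suffices as `signedSum` respects pointwise equality.
  disc : ∃[ D ] IsDisc 𝓕 D
  disc with least (λ k → anySubset? (λ s → k ℕ.≟ value s)) (value Subset.⊥) (Subset.⊥ , refl)
  ... | D , (s , refl) , minimal = D , (colour s , proj₂ (discUnder (colour s))) , λ k (x , isMax) →
    ℕ.≤-trans (minimal _ (encode x , refl)) (below-max k x isMax)
    where
    below-max : ∀ k x → IsDiscUnder 𝓕 x k → value (encode x) ℕ.≤ k
    below-max k x (_ , upper) with discUnder (colour (encode x))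
    ... | _ , (F , F∈𝓕 , refl) , _ = upper _ (F , F∈𝓕 , cong ℤ.∣_∣ (signedSum-cong (colour-encode x) F))

  -- Makes large discrepancy force many points, hence arbitrarily large n.
  disc≤n : ∀ {D} → IsDisc 𝓕 D → D ℕ.≤ n
  disc≤n ((x , (F , _ , refl) , _) , _) = ∣signedSum∣≤n x F

fromℕ-mono : ∀ {a b} → a ℕ.≤ b → ℤ.+ a ℚ./ 1 ℚ.≤ ℤ.+ b ℚ./ 1
fromℕ-mono {a} {b} a≤b = LogFacts.frac-≤ a 0 b 0 (ℕ.*-monoˡ-≤ 1 a≤b)

≤-fromℕ : ∀ x {a b} → x ≤ fromℕ a → a ℕ.≤ b → x ≤ fromℕ b
≤-fromℕ x x≤a a≤b ε 0<ε =
  let N , h = x≤a ε 0<ε in N , λ n N≤n → ℚ.≤-trans (h n N≤n) (ℚ.+-monoˡ-≤ ε (fromℕ-mono a≤b))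

fromℕ-≤ : ∀ x {a b} → a ℕ.≤ b → fromℕ b ≤ x → fromℕ a ≤ x
fromℕ-≤ x a≤b b≤x ε 0<ε =
  let N , h = b≤x ε 0<ε in N , λ n N≤n → ℚ.≤-trans (fromℕ-mono a≤b) (h n N≤n)

fromℕ-refl : ∀ a → fromℕ a ≤ fromℕ a
fromℕ-refl a ε 0<ε = 0 , λ _ _ →
  subst (ℚ._≤ (ℤ.+ a ℚ./ 1) ℚ.+ ε) (ℚ.+-identityʳ (ℤ.+ a ℚ./ 1)) (ℚ.+-monoʳ-≤ (ℤ.+ a ℚ./ 1) (ℚ.<⇒≤ 0<ε))

fromℕ-≤⁺ : ∀ {a b} → a ℕ.≤ b → fromℕ a ≤ fromℕ b
fromℕ-≤⁺ {b = b} a≤b = fromℕ-≤ (fromℕ b) a≤b (fromℕ-refl b)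

-- Slack 1/2 in the order of the reals already separates integers.
fromℕ-≤⁻ : ∀ {a b} → fromℕ a ≤ fromℕ b → a ℕ.≤ b
fromℕ-≤⁻ {a} {b} a≤b with a≤b ℚ.½ (ℚ.positive⁻¹ ℚ.½)
... | N , h = ℕ.≮⇒≥ λ b<a → ℚ.<-irrefl refl (begin-strict
  (ℤ.+ b ℚ./ 1) ℚ.+ ℚ.½     <⟨ ℚ.+-monoʳ-< (ℤ.+ b ℚ./ 1) {ℚ.½} {1ℚ} (ℚ.*<* (ℤ.+<+ (ℕ.s≤s (ℕ.s≤s ℕ.z≤n)))) ⟩
  (ℤ.+ b ℚ./ 1) ℚ.+ 1ℚ      ≡⟨ LogFacts.frac-suc b 0 ⟨
  ℤ.+ suc b ℚ./ 1           ≤⟨ fromℕ-mono b<a ⟩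
  ℤ.+ a ℚ./ 1               ≤⟨ h N ℕ.≤-refl ⟩
  (ℤ.+ b ℚ./ 1) ℚ.+ ℚ.½     ∎)
  where open ℚ.≤-Reasoning

-- Box ranges of lattice point sets

module Lattice {d n} (coord : Fin n → Fin (suc d) → ℕ) (b : ℕ) (coord≤b : ∀ i j → coord i j ℕ.≤ b)
  (coord-injective : ∀ {i i′} → (∀ j → coord i j ≡ coord i′ j) → i ≡ i′) where

  lattice : PointSet (suc d) n
  lattice = record
    { point    = λ i j → fromℕ (coord i j)
    ; distinct = λ eq → coord-injective (λ j → ℕ.≤-antisym (fromℕ-≤⁻ (proj₁ (eq j))) (fromℕ-≤⁻ (proj₂ (eq j))))
    }

  -- Membership in the bounding box of F, stated by witnesses in F. Boxes have real corners and no
  -- decidable comparison; this integer condition is decidable and induces the same set system.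
  Hull : Subset n → Fin n → Set
  Hull F i = ∀ j → (∃[ i₁ ] (i₁ ∈ F × coord i₁ j ℕ.≤ coord i j)) × (∃[ i₂ ] (i₂ ∈ F × coord i j ℕ.≤ coord i₂ j))

  HullClosed : Subset n → Set
  HullClosed F = ∀ i → Hull F i → i ∈ F

  hullClosed? : Decidable HullClosed
  hullClosed? F = Fin.all? λ i → Fin.all? (λ j →
      Fin.any? (λ i₁ → (i₁ ∈? F) ×-dec (coord i₁ j ℕ.≤? coord i j)) ×-dec
      Fin.any? (λ i₂ → (i₂ ∈? F) ×-dec (coord i j ℕ.≤? coord i₂ j)))
    →-dec (i ∈? F)

  box⇒closed : ∀ F → 𝓡 lattice F → HullClosed F
  box⇒closed F (R , i∈⇔) i hull = Equivalence.from (i∈⇔ i) λ j →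
    let (i₁ , i₁∈F , c₁≤) , (i₂ , i₂∈F , ≤c₂) = hull j in
    ≤-fromℕ (Box.lower R j) (proj₁ (Equivalence.to (i∈⇔ i₁) i₁∈F j)) c₁≤ ,
    fromℕ-≤ (Box.upper R j) ≤c₂ (proj₂ (Equivalence.to (i∈⇔ i₂) i₂∈F j))

  closed⇒box : ∀ F → HullClosed F → 𝓡 lattice F
  closed⇒box F closed with Fin.any? (_∈? F)
  -- The empty set is cut out by the one-point box at b + 1, beyond all coordinates; the
  -- contradiction uses coordinate `zero`.
  ... | no empty = record
      { lower = λ _ → fromℕ (suc b) ; upper = λ _ → fromℕ (suc b) ; lower≤upper = λ _ → fromℕ-refl (suc b) }
    , λ i → mk⇔ (λ i∈F → contradiction (i , i∈F) empty)
        (λ i∈R → contradiction (ℕ.≤-trans (fromℕ-≤⁻ (proj₁ (i∈R zero))) (coord≤b i zero)) (ℕ.<-irrefl refl))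
  ... | yes (i₀ , i₀∈F) = record
      { lower = λ j → fromℕ (lo j) ; upper = λ j → fromℕ (hi j)
      ; lower≤upper = λ j → fromℕ-≤⁺ (ℕ.≤-trans (lo≤ j i₀∈F) (≤hi j i₀∈F)) }
    , λ i → mk⇔ (λ i∈F j → fromℕ-≤⁺ (lo≤ j i∈F) , fromℕ-≤⁺ (≤hi j i∈F))
        (λ i∈R → closed i (λ j →
          (let k , k∈F , eq = proj₁ (proj₂ (lowest j)) in
             k , k∈F , ℕ.≤-trans (ℕ.≤-reflexive (sym eq)) (fromℕ-≤⁻ (proj₁ (i∈R j)))) ,
          (let k , k∈F , eq = proj₁ (proj₂ (highest j)) in
             k , k∈F , ℕ.≤-trans (fromℕ-≤⁻ (proj₂ (i∈R j))) (ℕ.≤-reflexive eq))))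
    where
    Occurs : Fin (suc d) → Pred ℕ 0ℓ
    Occurs j c = ∃[ i ] (i ∈ F × c ≡ coord i j)
    occurs? : ∀ j → Decidable (Occurs j)
    occurs? j c = Fin.any? (λ i → (i ∈? F) ×-dec (c ℕ.≟ coord i j))
    lowest : ∀ j → ∃[ c ] IsMin (Occurs j) c
    lowest j = least (occurs? j) _ (i₀ , i₀∈F , refl)
    highest : ∀ j → ∃[ c ] IsMax (Occurs j) c
    highest j = greatest (occurs? j) (i₀ , i₀∈F , refl) b (λ { c (i , _ , refl) → coord≤b i j })
    lo hi : Fin (suc d) → ℕ
    lo j = proj₁ (lowest j)
    hi j = proj₁ (highest j)
    lo≤ : ∀ j {i} → i ∈ F → lo j ℕ.≤ coord i j
    lo≤ j {i} i∈F = proj₂ (proj₂ (lowest j)) _ (i , i∈F , refl)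
    ≤hi : ∀ j {i} → i ∈ F → coord i j ℕ.≤ hi j
    ≤hi j {i} i∈F = proj₂ (proj₂ (highest j)) _ (i , i∈F , refl)

  𝓡? : Decidable (𝓡 lattice)
  𝓡? F = map′ (closed⇒box F) (box⇒closed F) (hullClosed? F)

  empty∈𝓡 : 𝓡 lattice Subset.⊥
  empty∈𝓡 = closed⇒box Subset.⊥ (λ i hull → contradiction (proj₁ (proj₂ (proj₁ (hull zero)))) ∉⊥)

  orthant : (Fin (suc d) → ℕ) → Subset n
  orthant a = tabulate (λ i → Dec.does (Fin.all? (λ j → a j ℕ.<? coord i j)))

  -- An orthant is unbounded, but its trace on the point set is hull-closed: the lower witnesses
  -- already exceed `a`.
  orthant∈𝓡 : ∀ a → 𝓡 lattice (orthant a)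
  orthant∈𝓡 a = closed⇒box (orthant a) λ i hull → intro i (λ j →
    let (i₁ , i₁∈ , c₁≤) , _ = hull j in ℕ.≤-trans (elim i₁ i₁∈ j) c₁≤)
    where
    intro : ∀ i → (∀ j → a j ℕ.< coord i j) → i ∈ orthant a
    intro i above = lookup⇒[]= i (orthant a) (trans (lookup∘tabulate _ i) (dec-true (Fin.all? (λ j → a j ℕ.<? coord i j)) above))
    elim : ∀ i → i ∈ orthant a → ∀ j → a j ℕ.< coord i j
    elim i i∈ = witness (Fin.all? (λ j → a j ℕ.<? coord i j)) (trans (sym (lookup∘tabulate _ i)) ([]=⇒lookup i∈))
      where
      witness : ∀ {A : Set} (A? : Dec A) → Dec.does A? ≡ true → A
      witness (yes a) _ = a

-- Base-4 words as integers

value : ∀ {m} → Vec Digit m → ℕ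
value []              = 0
value {suc m} (e ∷ w) = toℕ e ℕ.* 4 ℕ.^ m ℕ.+ value w

value< : ∀ {m} (w : Vec Digit m) → value w ℕ.< 4 ℕ.^ m
value-∷-< : ∀ {m} (e : Digit) (w : Vec Digit m) → value (e ∷ w) ℕ.< suc (toℕ e) ℕ.* 4 ℕ.^ m
value< []              = ℕ.≤-refl
value< {suc m} (e ∷ w) = ℕ.≤-trans (value-∷-< e w) (ℕ.*-monoˡ-≤ (4 ℕ.^ m) (Fin.toℕ<n e))
value-∷-< {m} e w = subst (value (e ∷ w) ℕ.<_) (ℕ.+-comm (toℕ e ℕ.* 4 ℕ.^ m) (4 ℕ.^ m)) (ℕ.+-monoʳ-< (toℕ e ℕ.* 4 ℕ.^ m) (value< w))

value-digit-< : ∀ {m} {e f} (a p : Vec Digit m) → e Fin.< f → value (e ∷ a) ℕ.< value (f ∷ p)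
value-digit-< {m} {e} {f} a p e<f =
  ℕ.<-≤-trans (value-∷-< e a) (ℕ.≤-trans (ℕ.*-monoˡ-≤ (4 ℕ.^ m) e<f) (ℕ.m≤m+n _ (value p)))

below-value : ∀ {m} (a p : Vec Digit m) →
  (below a p ≡ 1ℚ × value a ℕ.< value p) ⊎ (below a p ≡ 0ℚ × value p ≤ℕ value a)
below-value []      []      = inj₂ (refl , ℕ.≤-refl)
below-value {suc m} (e ∷ a) (f ∷ p) with Fin.<-cmp e f
... | tri< e<f _ _ = inj₁ (refl , value-digit-< a p e<f)
... | tri> _ _ f<e = inj₂ (refl , ℕ.<⇒≤ (value-digit-< p a f<e))
... | tri≈ _ refl _ with below-value a p
...   | inj₁ (eq , lt) = inj₁ (eq , ℕ.+-monoʳ-< (toℕ e ℕ.* 4 ℕ.^ m) lt)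
...   | inj₂ (eq , ge) = inj₂ (eq , ℕ.+-monoʳ-≤ (toℕ e ℕ.* 4 ℕ.^ m) ge)

value-injective : ∀ {m} (a p : Vec Digit m) → value a ≡ value p → a ≡ p
value-injective []      []      _ = refl
value-injective {suc m} (e ∷ a) (f ∷ p) eq with Fin.<-cmp e f
... | tri< e<f _ _ = contradiction eq (ℕ.<⇒≢ (value-digit-< a p e<f))
... | tri> _ _ f<e = contradiction (sym eq) (ℕ.<⇒≢ (value-digit-< p a f<e))
... | tri≈ _ refl _ = cong (e ∷_) (value-injective a p (ℕ.+-cancelˡ-≡ (toℕ e ℕ.* 4 ℕ.^ m) _ _ eq))

Above : ∀ {m d} → Vec (Vec Digit m) d → Vec (Vec Digit m) d → Set
Above a p = ∀ j → value (lookup a j) ℕ.< value (lookup p j)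

above? : ∀ {m d} (a p : Vec (Vec Digit m) d) → Dec (Above a p)
above? a p = Fin.all? (λ j → value (lookup a j) ℕ.<? value (lookup p j))

belowᵈ-above : ∀ {m d} (a p : Vec (Vec Digit m) d) →
  (belowᵈ a p ≡ 1ℚ × Above a p) ⊎ (belowᵈ a p ≡ 0ℚ × ¬ Above a p)
belowᵈ-above []       []       = inj₁ (refl , λ ())
belowᵈ-above (a ∷ as) (p ∷ ps) with below-value a p | belowᵈ-above as ps
... | inj₁ (eq , lt) | inj₁ (eqs , above) =
  inj₁ (trans (cong₂ _⊛_ eq eqs) (*-identityˡ 1ℚ) , λ { zero → lt ; (suc j) → above j })
... | inj₁ (eq , lt) | inj₂ (eqs , ¬above) =
  inj₂ (trans (cong (below a p ⊛_) eqs) (zeroʳ _) , λ above → ¬above (above ∘ suc))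
... | inj₂ (eq , ge) | _ =
  inj₂ (trans (cong (_⊛ belowᵈ as ps) eq) (zeroˡ _) , λ above → ℕ.<⇒≱ (above zero) ge)

belowᵈ≡ : ∀ {m d} (a p : Vec (Vec Digit m) d) → belowᵈ a p ≡ (if Dec.does (above? a p) then 1ℚ else 0ℚ)
belowᵈ≡ a p with belowᵈ-above a p
... | inj₁ (eq , above)  rewrite dec-true (above? a p) above   = eq
... | inj₂ (eq , ¬above) rewrite dec-false (above? a p) ¬above = eq

-- Subsets of the selected points

pick : ∀ {A : Set} {k} (J : Subset k) → Vec A k → Vec A (size J)
pick []            []       = []
pick (outside ∷ J) (p ∷ ps) = pick J ps
pick (inside  ∷ J) (p ∷ ps) = p ∷ pick J ps

pick-∈ : ∀ {A : Set} {k} (J : Subset k) (ps : Vec A k) {p} → p ∈ᵛ pick J ps → p ∈ᵛ ps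
pick-∈ []            []       ()
pick-∈ (outside ∷ J) (_ ∷ ps) p∈         = there (pick-∈ J ps p∈)
pick-∈ (inside  ∷ J) (_ ∷ ps) (here eq)  = here eq
pick-∈ (inside  ∷ J) (_ ∷ ps) (there p∈) = there (pick-∈ J ps p∈)

pick-distinct : ∀ {A : Set} {k} (J : Subset k) (ps : Vec A k) → Distinct ps → Distinct (pick J ps)
pick-distinct []            []       _            = _
pick-distinct (outside ∷ J) (_ ∷ ps) (_ , dist)   = pick-distinct J ps dist
pick-distinct (inside  ∷ J) (_ ∷ ps) (p∉ , dist)  = p∉ ∘ pick-∈ J ps , pick-distinct J ps dist

distinct-lookup : ∀ {A : Set} {k} (ps : Vec A k) → Distinct ps → ∀ i j → lookup ps i ≡ lookup ps j → i ≡ j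
distinct-lookup (p ∷ ps) _          zero    zero    _  = refl
distinct-lookup (p ∷ ps) (p∉ , _)   zero    (suc j) eq = contradiction (subst (_∈ᵛ ps) (sym eq) (∈-lookup j ps)) p∉
distinct-lookup (p ∷ ps) (p∉ , _)   (suc i) zero    eq = contradiction (subst (_∈ᵛ ps) eq (∈-lookup i ps)) p∉
distinct-lookup (p ∷ ps) (_ , dist) (suc i) (suc j) eq = cong suc (distinct-lookup ps dist i j eq)

lookup-injective : ∀ {A : Set} {k} (xs ys : Vec A k) → (∀ j → lookup xs j ≡ lookup ys j) → xs ≡ ys
lookup-injective xs ys eq = trans (sym (tabulate∘lookup xs)) (trans (tabulate-cong eq) (tabulate∘lookup ys))

ι²≤ : ∀ z D → ℤ.∣ z ∣ ≤ℕ D → (ι z) ² ℚ.≤ ⌜ D ⌝ ²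
ι²≤ z D ∣z∣≤D = subst₂ ℚ._≤_ (trans (cong ι (square z)) (ι-* z z)) (⌜⌝-* D D) (⌜⌝-mono (ℕ.*-mono-≤ ∣z∣≤D ∣z∣≤D))
  where
  square : ∀ z → ℤ.+ (ℤ.∣ z ∣ ℕ.* ℤ.∣ z ∣) ≡ z ℤ.* z
  square (ℤ.+ n)    = ℤ.pos-* n n
  square ℤ.-[1+ n ] = refl

not-all-≤ : ∀ {k} (D : Subset k → ℕ) b c → ¬ (∀ J → c ℕ.* D J ≤ℕ b) → ∃[ J ] b ℕ.< c ℕ.* D J
not-all-≤ D b c ¬all with anySubset? (λ J → b ℕ.<? c ℕ.* D J)
... | yes found = found
... | no  none  = contradiction (λ J → ℕ.≮⇒≥ (λ lt → none (J , lt))) ¬all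

module Sets (f τ ℓ : ℕ) (K-eq : τ ℕ.^ f ℕ.* 4 ℕ.^ (f ℕ.* τ ℕ.+ 0) ≡ 10 ℕ.* 6 ℕ.^ suc f ℕ.* suc ℓ) where
  open Bound f τ ℓ K-eq

  k : ℕ
  k = suc ℓ ℕ.* 5

  module _ (J : Subset k) where
    coord : Fin (size J) → Fin F → ℕ
    coord i j = value (lookup (lookup (pick J points) i) j)

    open Lattice coord (4 ℕ.^ m) (λ i j → ℕ.<⇒≤ (value< (lookup (lookup (pick J points) i) j)))
      (λ {i} {i′} eq → distinct-lookup (pick J points) (pick-distinct J points points-distinct) i i′
        (lookup-injective _ _ (λ j → value-injective _ _ (eq j))))
      public

  opaque
    isDisc : ∀ J → ∃[ D ] IsDisc (𝓡 (lattice J)) D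
    isDisc J = disc (𝓡? J) (empty∈𝓡 J)

  D : Subset k → ℕ
  D J = proj₁ (isDisc J)

  D≤size : ∀ J → D J ≤ℕ size J
  D≤size J = disc≤n (𝓡? J) (empty∈𝓡 J) (proj₂ (isDisc J))

  colouring : ∀ J → Fin (size J) → Sign
  colouring J = proj₁ (proj₁ (proj₂ (isDisc J)))

  -- Points outside J carry the coefficient 0, so the sum over all points reduces to the picked
  -- ones.
  discrepancy-sum : ∀ {k} (ps : Vec LatticePoint k) (J : Subset k) x a → discrepancy ps (extend J x) a ≡
    ι (sum (λ i → if Dec.does (above? a (lookup (pick J ps) i)) then x i ◃ 1 else ℤ.+ 0))
  discrepancy-sum []       []            x a = refl
  discrepancy-sum (p ∷ ps) (outside ∷ J) x a =
    trans (cong (_⊕ discrepancy ps (extend J x) a) (zeroˡ _)) (trans (+-identityˡ _) (discrepancy-sum ps J x a))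
  discrepancy-sum (p ∷ ps) (inside ∷ J) x a = sym (trans (ι-+ _ _) (sym (cong₂ _⊕_
    (trans (cong (tri (trit (x zero)) ⊛_) (belowᵈ≡ a p)) (term (Dec.does (above? a p)) (x zero)))
    (discrepancy-sum ps J (x ∘ suc) a))))
    where
    term : ∀ b s → tri (trit s) ⊛ (if b then 1ℚ else 0ℚ) ≡ ι (if b then s ◃ 1 else ℤ.+ 0)
    term false s      = zeroʳ _
    term true  Sign.+ = *-identityʳ _
    term true  Sign.- = *-identityʳ _

  -- The colouring attains the minimum, so `D J` is its maximum over all box ranges, among them the
  -- orthants.
  discrepancy≤D : ∀ J a → (discrepancy points (extend J (colouring J)) a) ² ℚ.≤ ⌜ D J ⌝ ²
  discrepancy≤D J a = subst (λ z → z ² ℚ.≤ ⌜ D J ⌝ ²) (sym (begin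
    discrepancy points (extend J (colouring J)) a
      ≡⟨ discrepancy-sum points J (colouring J) a ⟩
    ι (sum (λ i → if Dec.does (above? a (lookup (pick J points) i)) then colouring J i ◃ 1 else ℤ.+ 0))
      ≡⟨ cong ι (sum-cong-≗ (λ i → cong (λ b → if b then colouring J i ◃ 1 else ℤ.+ 0) (lookup∘tabulate _ i))) ⟨
    ι (signedSum (colouring J) F∈) ∎))
    (ι²≤ _ (D J) (proj₂ (proj₂ (proj₁ (proj₂ (isDisc J)))) _ (F∈ , orthant∈𝓡 J (value ∘ lookup a) , refl)))
    where
    open ≡-Reasoning
    F∈ = orthant J (value ∘ lookup a)

  opaque
    large-disc : ∃[ J ] τ ℕ.^ f ℕ.< 10 ℕ.* 44 ℕ.^ F ℕ.* D J
    large-disc = not-all-≤ D (τ ℕ.^ f) (10 ℕ.* 44 ℕ.^ F) (some-large-discrepancy colouring D discrepancy≤D)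

-- The logarithm

/1≡⌜⌝ : ∀ n → ℤ.+ n ℚ./ 1 ≡ ⌜ n ⌝
/1≡⌜⌝ n = ℚ.fromℚᵘ-toℚᵘ ⌜ n ⌝

harmonic-mono : ∀ {a b} → a ≤ℕ b → harmonic a ℚ.≤ harmonic b
harmonic-mono {a} {b} a≤b = subst (λ x → harmonic a ℚ.≤ harmonic x) (ℕ.m+[n∸m]≡n a≤b) (begin
  harmonic a                                     ≡⟨ ℚ.+-identityʳ (harmonic a) ⟨
  harmonic a ℚ.+ 0ℚ                              ≤⟨ ℚ.+-monoʳ-≤ (harmonic a) (LogFacts.frac-≤ 0 0 t (a ℕ.+ t) ℕ.z≤n) ⟩
  harmonic a ℚ.+ ℤ.+ t ℚ./ suc (a ℕ.+ t)         ≤⟨ LogFacts.harmonic-lower a t (a ℕ.+ t) (ℕ.n≤1+n _) ⟩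
  harmonic (a ℕ.+ t)                             ∎)
  where
  open ℚ.≤-Reasoning
  t = b ∸ a

-- Each doubling adds N terms below 1/N. Hence the base-2 logarithm can stand in for the natural one
-- as an upper bound.
harmonic-double : ∀ s r → harmonic (2 ℕ.^ r ℕ.* suc s) ℚ.≤ harmonic (suc s) ℚ.+ ℤ.+ r ℚ./ 1
harmonic-double s zero = ℚ.≤-reflexive (trans (cong harmonic (ℕ.*-identityˡ (suc s))) (sym (ℚ.+-identityʳ (harmonic (suc s)))))
harmonic-double s (suc r) = begin
  harmonic (2 ℕ.^ suc r ℕ.* suc s)             ≡⟨ cong harmonic doubling ⟩
  harmonic (N ℕ.+ N)                           ≤⟨ LogFacts.harmonic-upper N N M (ℕ.≤-reflexive N≡) ⟩
  harmonic N ℚ.+ ℤ.+ N ℚ./ suc M               ≤⟨ ℚ.+-mono-≤ (harmonic-double s r) (LogFacts.frac-≤ N M 1 0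
                                                    (ℕ.≤-reflexive (trans (ℕ.*-identityʳ N) (trans (sym N≡) (sym (ℕ.*-identityˡ (suc M))))))) ⟩
  harmonic (suc s) ℚ.+ ℤ.+ r ℚ./ 1 ℚ.+ 1ℚ      ≡⟨ ℚ.+-assoc (harmonic (suc s)) (ℤ.+ r ℚ./ 1) 1ℚ ⟩
  harmonic (suc s) ℚ.+ (ℤ.+ r ℚ./ 1 ℚ.+ 1ℚ)    ≡⟨ cong (harmonic (suc s) ℚ.+_) (LogFacts.frac-suc r 0) ⟨
  harmonic (suc s) ℚ.+ ℤ.+ suc r ℚ./ 1         ∎
  where
  open ℚ.≤-Reasoning
  N = 2 ℕ.^ r ℕ.* suc s
  M = ℕ.pred N
  N≡ : suc M ≡ N
  N≡ = ℕ.suc-pred N {{ℕ.m*n≢0 (2 ℕ.^ r) (suc s) {{ℕ.m^n≢0 2 r}}}}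
  doubling : 2 ℕ.^ suc r ℕ.* suc s ≡ N ℕ.+ N
  doubling = trans (ℕ.*-assoc 2 (2 ℕ.^ r) (suc s)) (cong (N ℕ.+_) (ℕ.+-identityʳ N))

log-bounds : ∀ n r i → n ≤ℕ 2 ℕ.^ r → 0ℚ ℚ.≤ seq (log n) i × seq (log n) i ℚ.≤ ⌜ r ⌝
log-bounds zero    r i _    = ℚ.≤-refl , 0≤⌜ r ⌝
log-bounds (suc n) r i n≤2ʳ =
  subst (ℚ._≤ H ℚ.- h) (ℚ.+-inverseʳ h) (ℚ.+-monoˡ-≤ (ℚ.- h) (harmonic-mono (ℕ.m≤n*m (suc i) (suc n)))) ,
  (begin
    H ℚ.- h                               ≤⟨ ℚ.+-monoˡ-≤ (ℚ.- h) (ℚ.≤-trans (harmonic-mono (ℕ.*-monoˡ-≤ (suc i) n≤2ʳ)) (harmonic-double i r)) ⟩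
    h ℚ.+ ℤ.+ r ℚ./ 1 ℚ.- h               ≡⟨ CauchyFacts.Identity.cancel h (ℤ.+ r ℚ./ 1) ⟩
    ℤ.+ r ℚ./ 1                           ≡⟨ /1≡⌜⌝ r ⟩
    ⌜ r ⌝                                 ∎)
  where
  open ℚ.≤-Reasoning
  H = harmonic (suc n ℕ.* suc i)
  h = harmonic (suc i)

^-bounds : ∀ x r i → 0ℚ ℚ.≤ seq x i → seq x i ℚ.≤ ⌜ r ⌝ → ∀ k → 0ℚ ℚ.≤ seq (x ^ k) i × seq (x ^ k) i ℚ.≤ ⌜ r ℕ.^ k ⌝
^-bounds x r i 0≤x x≤r zero    = 0≤⌜ 1 ⌝ , ℚ.≤-refl
^-bounds x r i 0≤x x≤r (suc k) with ^-bounds x r i 0≤x x≤r k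
... | 0≤xᵏ , xᵏ≤rᵏ =
  subst (ℚ._≤ seq x i ℚ.* seq (x ^ k) i) (ℚ.*-zeroʳ (seq x i)) (CauchyFacts.mul-≤ 0≤x 0≤xᵏ ℚ.≤-refl 0≤xᵏ) ,
  subst (seq x i ℚ.* seq (x ^ k) i ℚ.≤_) (trans (sym (*≡ ⌜ r ⌝ ⌜ r ℕ.^ k ⌝)) (sym (⌜⌝-* r (r ℕ.^ k))))
    (CauchyFacts.mul-≤ 0≤x 0≤⌜ r ℕ.^ k ⌝ x≤r xᵏ≤rᵏ)

scaled-log-bound : ∀ M .{{_ : ℕ.NonZero M}} n r k D → n ≤ℕ 2 ℕ.^ r → r ℕ.^ k ≤ℕ M ℕ.* D →
                   fromℚ (inv ⌜ M ⌝) * log n ^ k ≤ fromℕ D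
-- The estimates hold for every approximant, so the threshold is 0 and ε is only added at the end.
scaled-log-bound M@(suc M-1) n r k D n≤2ʳ rᵏ≤MD ε 0<ε = 0 , λ i _ →
  let 0≤log , log≤r = log-bounds n r i n≤2ʳ
      0≤pow , pow≤  = ^-bounds (log n) r i 0≤log log≤r k
  in begin
    inv ⌜ M ⌝ ℚ.* seq (log n ^ k) i    ≤⟨ CauchyFacts.mul-≤ (inv-nonneg 0<⌜suc M-1 ⌝) 0≤⌜ M ℕ.* D ⌝ ℚ.≤-refl
                                            (ℚ.≤-trans pow≤ (⌜⌝-mono rᵏ≤MD)) ⟩
    inv ⌜ M ⌝ ℚ.* ⌜ M ℕ.* D ⌝          ≡⟨ *≡ (inv ⌜ M ⌝) _ ⟨
    inv ⌜ M ⌝ ⊛ ⌜ M ℕ.* D ⌝            ≡⟨ cong (inv ⌜ M ⌝ ⊛_) (⌜⌝-* M D) ⟩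
    inv ⌜ M ⌝ ⊛ (⌜ M ⌝ ⊛ ⌜ D ⌝)        ≡⟨ *-assoc (inv ⌜ M ⌝) ⌜ M ⌝ ⌜ D ⌝ ⟨
    (inv ⌜ M ⌝ ⊛ ⌜ M ⌝) ⊛ ⌜ D ⌝        ≡⟨ cong (_⊛ ⌜ D ⌝) (trans (*-comm (inv ⌜ M ⌝) ⌜ M ⌝) (inv-right 0<⌜suc M-1 ⌝)) ⟩
    1ℚ ⊛ ⌜ D ⌝                         ≡⟨ *-identityˡ ⌜ D ⌝ ⟩
    ⌜ D ⌝                              ≡⟨ /1≡⌜⌝ D ⟨
    ℤ.+ D ℚ./ 1                        ≡⟨ ℚ.+-identityʳ (ℤ.+ D ℚ./ 1) ⟨
    (ℤ.+ D ℚ./ 1) ℚ.+ 0ℚ               ≤⟨ ℚ.+-monoʳ-≤ (ℤ.+ D ℚ./ 1) (ℚ.<⇒≤ 0<ε) ⟩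
    (ℤ.+ D ℚ./ 1) ℚ.+ ε                ∎
  where open ℚ.≤-Reasoning

inv-positive : ∀ M .{{_ : ℕ.NonZero M}} → 0ℝ < fromℚ (inv ⌜ M ⌝)
inv-positive M@(suc M-1) = inv ⌜ M ⌝ , 0<inv , 0 , λ _ _ → ℚ.≤-reflexive (ℚ.+-identityˡ (inv ⌜ M ⌝))
  where
  0<inv : 0ℚ ℚ.< inv ⌜ M ⌝
  0<inv = ℚ.≰⇒> λ inv≤0 → ℚ.<-irrefl refl (ℚ.<-≤-trans (ℚ.positive⁻¹ 1ℚ)
    (subst₂ ℚ._≤_ (inv-right 0<⌜suc M-1 ⌝) (zeroʳ ⌜ M ⌝) (*-monoʳ-≤ 0≤⌜ M ⌝ inv≤0)))

-- Infinitely many n, and the constant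

n≤2ⁿ : ∀ n → n ≤ℕ 2 ℕ.^ n
n≤2ⁿ zero    = ℕ.z≤n
n≤2ⁿ (suc n) = ℕ.+-mono-≤ (ℕ.m^n>0 2 n) (subst (n ≤ℕ_) (sym (ℕ.+-identityʳ (2 ℕ.^ n))) (n≤2ⁿ n))

-- From τ ≤ 2^τ and 4 = 2²: the exponents are f τ and 2 f τ. This is the bound log n = O(τ).
size-bound : ∀ f τ → τ ℕ.^ f ℕ.* 4 ℕ.^ (f ℕ.* τ ℕ.+ 0) ≤ℕ 2 ℕ.^ (3 ℕ.* f ℕ.* τ)
size-bound f τ = begin
  τ ℕ.^ f ℕ.* 4 ℕ.^ (f ℕ.* τ ℕ.+ 0)
    ≤⟨ ℕ.*-mono-≤ (ℕ.^-monoˡ-≤ f (n≤2ⁿ τ)) (ℕ.≤-reflexive (ℕ.^-*-assoc 2 2 (f ℕ.* τ ℕ.+ 0))) ⟩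
  (2 ℕ.^ τ) ℕ.^ f ℕ.* 2 ℕ.^ (2 ℕ.* (f ℕ.* τ ℕ.+ 0))
    ≡⟨ cong (ℕ._* 2 ℕ.^ (2 ℕ.* (f ℕ.* τ ℕ.+ 0))) (ℕ.^-*-assoc 2 τ f) ⟩
  2 ℕ.^ (τ ℕ.* f) ℕ.* 2 ℕ.^ (2 ℕ.* (f ℕ.* τ ℕ.+ 0))
    ≡⟨ ℕ.^-distribˡ-+-* 2 (τ ℕ.* f) _ ⟨
  2 ℕ.^ (τ ℕ.* f ℕ.+ 2 ℕ.* (f ℕ.* τ ℕ.+ 0))
    ≡⟨ cong (2 ℕ.^_) (solveℕ 2 (λ t f → t ⊠ f ⊞ conℕ 2 ⊠ (f ⊠ t ⊞ conℕ 0) ≜ conℕ 3 ⊠ f ⊠ t) refl τ f) ⟩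
  2 ℕ.^ (3 ℕ.* f ℕ.* τ) ∎
  where
  open ℕ.≤-Reasoning

record LargeDisc (f τ E b : ℕ) : Set where
  field
    {n D}    : ℕ
    pointSet : PointSet (suc f) n
    isDisc   : IsDisc (𝓡 pointSet) D
    D≤n      : D ≤ℕ n
    n≤b      : n ≤ℕ b
    τᶠ<ED    : τ ℕ.^ f ℕ.< E ℕ.* D

-- E and B are variables because conversion checking would unfold the numerals.
largeDisc : ∀ f τ ℓ E B → E ≡ 10 ℕ.* 44 ℕ.^ suc f → B ≡ 10 ℕ.* 6 ℕ.^ suc f →
            τ ℕ.^ f ℕ.* 4 ℕ.^ (f ℕ.* τ ℕ.+ 0) ≡ B ℕ.* suc ℓ → LargeDisc f τ E (suc ℓ ℕ.* 5)
largeDisc f τ ℓ _ _ refl refl K-eq = record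
  { n = size J ; D = S.D J ; pointSet = S.lattice J ; isDisc = proj₂ (S.isDisc J) ; D≤n = S.D≤size J ; n≤b = size≤ J ; τᶠ<ED = proj₂ S.large-disc }
  where
  module S = Sets f τ ℓ K-eq
  J = proj₁ S.large-disc

largeDiscs : ∀ f E B .{{_ : ℕ.NonZero E}} .{{_ : ℕ.NonZero B}} → E ≡ 10 ℕ.* 44 ℕ.^ suc (suc f) → B ≡ 10 ℕ.* 6 ℕ.^ suc (suc f) →
  5 ≤ℕ B → ∀ N → Σ[ τ ∈ ℕ ] Σ[ S ∈ LargeDisc (suc f) τ E (2 ℕ.^ (3 ℕ.* suc f ℕ.* τ)) ] N ≤ℕ LargeDisc.n S
largeDiscs f E B E≡ B≡ 5≤B N = τ , record { LargeDisc S ; n≤b = n≤ } , N≤n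
  where
  σ τ t L ℓ : ℕ
  -- As τ is a multiple of B, so is the number of boxes, and ℓ is integral. As τ exceeds E N, the
  -- bound on D gives N < D ≤ n.
  σ = suc (E ℕ.* N)
  τ = B ℕ.* σ
  t = suc f ℕ.* τ ℕ.+ 0
  L = σ ℕ.* τ ℕ.^ f ℕ.* 4 ℕ.^ t
  ℓ = ℕ.pred L
  τᶠ≢0 : ℕ.NonZero (τ ℕ.^ f)
  τᶠ≢0 = ℕ.m^n≢0 τ f {{ℕ.m*n≢0 B σ}}
  L≢0 : ℕ.NonZero L
  L≢0 = ℕ.m*n≢0 (σ ℕ.* τ ℕ.^ f) (4 ℕ.^ t) {{ℕ.m*n≢0 σ (τ ℕ.^ f) {{_}} {{τᶠ≢0}}}} {{ℕ.m^n≢0 4 t}}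
  regroup : ∀ b s x y → b ℕ.* s ℕ.* x ℕ.* y ≡ b ℕ.* (s ℕ.* x ℕ.* y)
  regroup b s x y = trans (cong (ℕ._* y) (ℕ.*-assoc b s x)) (ℕ.*-assoc b (s ℕ.* x) y)
  K-eq : τ ℕ.^ suc f ℕ.* 4 ℕ.^ t ≡ B ℕ.* suc ℓ
  K-eq = trans (regroup B σ (τ ℕ.^ f) (4 ℕ.^ t)) (cong (B ℕ.*_) (sym (ℕ.suc-pred L {{L≢0}})))
  S : LargeDisc (suc f) τ E (suc ℓ ℕ.* 5)
  S = largeDisc (suc f) τ ℓ E B E≡ B≡ K-eq
  open LargeDisc S using (n; D; D≤n; n≤b; τᶠ<ED)
  N≤n : N ≤ℕ n
  N≤n = ℕ.≤-trans (ℕ.<⇒≤ (ℕ.*-cancelˡ-< E N D (ℕ.≤-<-trans EN≤τᶠ τᶠ<ED))) D≤n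
    where
    EN≤τᶠ : E ℕ.* N ≤ℕ τ ℕ.^ suc f
    EN≤τᶠ = ℕ.≤-trans (ℕ.n≤1+n (E ℕ.* N)) (ℕ.≤-trans (ℕ.m≤n*m σ B) (ℕ.m≤m*n τ (τ ℕ.^ f) {{τᶠ≢0}}))
  n≤ : n ≤ℕ 2 ℕ.^ (3 ℕ.* suc f ℕ.* τ)
  n≤ = ℕ.≤-trans n≤b (ℕ.≤-trans (ℕ.*-monoʳ-≤ (suc ℓ) 5≤B) (ℕ.≤-trans
    (ℕ.≤-reflexive (trans (ℕ.*-comm (suc ℓ) B) (sym K-eq))) (size-bound (suc f) τ)))

power-bound : ∀ f τ E D a → τ ℕ.^ f ℕ.< E ℕ.* D → (a ℕ.* τ) ℕ.^ f ≤ℕ E ℕ.* a ℕ.^ f ℕ.* D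
power-bound f τ E D a lt = subst₂ _≤ℕ_ (sym (^-distribʳ-* f a τ))
  (trans (sym (ℕ.*-assoc (a ℕ.^ f) E D)) (cong (ℕ._* D) (ℕ.*-comm (a ℕ.^ f) E)))
  (ℕ.*-monoʳ-≤ (a ℕ.^ f) (ℕ.<⇒≤ lt))

-- The constant is 1/M with M = E aᵈ⁻¹ and a = 3 (d - 1), where d - 1 is `suc f`: since n ≤ 2^(a τ),
-- the power logᵈ⁻¹ n is at most (a τ)ᵈ⁻¹, hence at most M D.
disc-lower-bound : ∀ f E B → .{{_ : ℕ.NonZero E}} .{{_ : ℕ.NonZero B}} →
  E ≡ 10 ℕ.* 44 ℕ.^ suc (suc f) → B ≡ 10 ℕ.* 6 ℕ.^ suc (suc f) → 5 ≤ℕ B →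
  Σ[ c ∈ ℝ ] (0ℝ < c × InfinitelyMany (λ n →
    Σ[ P ∈ PointSet (suc (suc f)) n ] ∃[ D ] (IsDisc (𝓡 P) D × c * log n ^ suc f ≤ fromℕ D)))
disc-lower-bound f E B {{E≢0}} E≡ B≡ 5≤B = fromℚ (inv ⌜ M ⌝) , inv-positive M {{M≢0}} , λ N →
  let τ , S , N≤n = largeDiscs f E B E≡ B≡ 5≤B N
      open LargeDisc S
  in n , N≤n , pointSet , D , isDisc ,
     scaled-log-bound M {{M≢0}} n (3 ℕ.* suc f ℕ.* τ) (suc f) D n≤b (power-bound (suc f) τ E D (3 ℕ.* suc f) τᶠ<ED)
  where
  M : ℕ
  M = E ℕ.* (3 ℕ.* suc f) ℕ.^ suc f
  M≢0 : ℕ.NonZero M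
  M≢0 = ℕ.m*n≢0 E _ {{E≢0}} {{ℕ.m^n≢0 (3 ℕ.* suc f) (suc f)}}

theorem1p1 : (d : ℕ) → 2 ≤ℕ d →
    Σ[ c ∈ ℝ ] (0ℝ < c ×
    InfinitelyMany (λ n →
    Σ[ P ∈ PointSet d n ] ∃[ D ] (IsDisc (𝓡 P) D × c * log n ^ (d ∸ 1) ≤ fromℕ D)))
theorem1p1 (suc zero)    (s≤s ())
theorem1p1 (suc (suc f)) _ = disc-lower-bound f (10 ℕ.* 44 ℕ.^ suc (suc f)) (10 ℕ.* 6 ℕ.^ suc (suc f))
  {{ℕ.m*n≢0 10 _ {{_}} {{ℕ.m^n≢0 44 (suc (suc f))}}}} {{ℕ.m*n≢0 10 _ {{_}} {{6≢0}}}} refl refl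
  (ℕ.≤-trans (ℕ.m≤m+n 5 5) (ℕ.m≤m*n 10 (6 ℕ.^ suc (suc f)) {{6≢0}}))
  where
  6≢0 : ℕ.NonZero (6 ℕ.^ suc (suc f))
  6≢0 = ℕ.m^n≢0 6 (suc (suc f))
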